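{- Let $K$ be a number field with ring of integers $\mathcal{O}_K$, and let $\mathcal{R}_K$ be a unique factorization domain with $\mathcal{O}_K\subset\mathcal{R}_K\subset K$ whose group of units is finitely generated. Let $e_1,e_2,e_3\in\mathcal{R}_K[t]$ and let $E=E(t): y^2=(x-e_1)(x-e_2)(x-e_3)$ be a nonconstant elliptic curve over $K(t)$. Let $t_0\in K$ be such that the specialization $E(t_0)$ is an elliptic curve over $K$. Assume that for every nonconstant square-free divisor $h$ in $\mathcal{R}_K[t]$ of $(e_1-e_2)(e_1-e_3)$, or of $(e_2-e_1)(e_2-e_3)$, or of $(e_3-e_1)(e_3-e_2)$, the algebraic number $h(t_0)$ is not a square in $K$. Then the specialization homomorphism $\sigma: E(K(t))\to E(t_0)(K)$ is injective.
   Context: An elliptic curve over $K(t)$ is nonconstant if it is not isomorphic over $K(t)$ to an elliptic curve defined over $K$. The specialization homomorphism $\sigma=\sigma_{t_0}$ sends a point of $E(K(t))$ to the point of $E(t_0)(K)$ obtained by evaluating its projective coordinates at $t=t_0$. Divisibility and square-freeness are taken in the UFD $\mathcal{R}_K[t]$. -}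

module Defs where

open import Algebra.Bundles using (CommutativeRing; Group; AbelianGroup; RawRing)
open import Algebra.Definitions using (AlmostLeftCancellative)
open import Algebra.Morphism.Structures using (IsRingHomomorphism; IsRingMonomorphism)
import Algebra.Definitions.RawMagma
import Algebra.Definitions.RawMonoid
import Algebra.Definitions.RawSemiring
import Algebra.Morphism.RingMonomorphism
import Algebra.Properties.Group
import Algebra.Properties.Ring
import Algebra.Solver.Ring.NaturalCoefficients.Default as SemiringSolver
open import Data.Empty using (⊥-elim)
open import Data.Fin.Base using (Fin)
open import Data.Integer.Base using (ℤ)
open import Data.List.Base using (List; []; _∷_; _++_; foldr; length; map)
open import Data.List.Properties using (length-map)
open import Data.List.Relation.Binary.Permutation.Homogeneous using (Permutation)
open import Data.List.Relation.Unary.All using (All)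
open import Data.Nat.Base as ℕ using (ℕ; zero; suc)
import Data.Nat.Properties as ℕ
open import Data.Product.Base using (∃; ∃₂; Σ; _×_; _,_; proj₁; proj₂)
open import Data.Rational.Base as ℚ using (ℚ; 0ℚ)
open import Data.Sum.Base using (_⊎_; inj₁; inj₂)
import Data.Sum.Base as Sum
open import Function.Base using (_∘_; id)
open import Level using (Level; _⊔_)
open import Relation.Binary.Definitions using (Decidable)
open import Relation.Binary.PropositionalEquality.Core using (_≡_)
import Relation.Binary.PropositionalEquality.Core as ≡
open import Relation.Nullary using (¬_; Dec; yes; no)
import Relation.Nullary.Decidable as Dec
import Relation.Binary.Reasoning.Setoid
open import Relation.Unary using (Pred)

module Divisibility {c ℓ} (A : CommutativeRing c ℓ) where
  open CommutativeRing A
  open Algebra.Definitions.RawMagma *-rawMagma public using (_∣_; _∥_)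
  open Algebra.Definitions.RawSemiring (RawRing.rawSemiring rawRing) public using (Irreducible)

  IsUnit : Pred Carrier (c ⊔ ℓ)
  IsUnit u = u ∣ 1#

  SquareFree : Pred Carrier (c ⊔ ℓ)
  SquareFree h = ∀ d → (d * d) ∣ h → IsUnit d

  IsSquare : Pred Carrier (c ⊔ ℓ)
  IsSquare x = ∃ λ y → x ≈ y * y

  product : List Carrier → Carrier
  product = foldr _*_ 1#

  record IsUFD : Set (c ⊔ ℓ) where
    field
      1≉0          : ¬ 1# ≈ 0#
      noZeroDiv    : ∀ x y → x * y ≈ 0# → x ≈ 0# ⊎ y ≈ 0#
      factor       : ∀ x → ¬ x ≈ 0# →
                     ∃₂ λ u ps → IsUnit u × All Irreducible ps × x ≈ u * product ps
      factorUnique : ∀ ps qs → All Irreducible ps → All Irreducible qs →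
                     product ps ∥ product qs → Permutation _∥_ ps qs

module _ {c ℓ} (A : CommutativeRing c ℓ) where
  open CommutativeRing A
  open Divisibility A
  open Relation.Binary.Reasoning.Setoid setoid
  private module S = SemiringSolver commutativeSemiring

  record Unit : Set (c ⊔ ℓ) where
    constructor mkUnit
    field
      value    : Carrier
      inverse  : Carrier
      inverseʳ : value * inverse ≈ 1#
  open Unit

  unitGroup : AbelianGroup (c ⊔ ℓ) ℓ
  unitGroup = record
    { Carrier = Unit
    ; _≈_     = λ u v → value u ≈ value v
    ; _∙_     = λ u v → mkUnit (value u * value v) (inverse u * inverse v) (begin
        (value u * value v) * (inverse u * inverse v)
          ≈⟨ S.solve 4 (λ a b a′ b′ → (a S.:* b) S.:* (a′ S.:* b′) S.:= (a S.:* a′) S.:* (b S.:* b′))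
                       refl (value u) (value v) (inverse u) (inverse v) ⟩
        (value u * inverse u) * (value v * inverse v) ≈⟨ *-cong (inverseʳ u) (inverseʳ v) ⟩
        1# * 1#                                       ≈⟨ *-identityˡ 1# ⟩
        1# ∎)
    ; ε       = mkUnit 1# 1# (*-identityˡ 1#)
    ; _⁻¹     = λ u → mkUnit (inverse u) (value u) (trans (*-comm _ _) (inverseʳ u))
    ; isAbelianGroup = record
      { isGroup = record
        { isMonoid = record
          { isSemigroup = record
            { isMagma = record
              { isEquivalence = record { refl = refl ; sym = sym ; trans = trans }
              ; ∙-cong = *-cong
              }
            ; assoc = λ u v w → *-assoc (value u) (value v) (value w)
            }
          ; identity = (λ u → *-identityˡ (value u)) , (λ u → *-identityʳ (value u))
          }
        ; inverse = (λ u → trans (*-comm _ _) (inverseʳ u)) , inverseʳ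
        ; ⁻¹-cong = λ {u} {v} u≈v → begin
            inverse u                              ≈⟨ *-identityʳ _ ⟨
            inverse u * 1#                         ≈⟨ *-congˡ (inverseʳ v) ⟨
            inverse u * (value v * inverse v)      ≈⟨ *-assoc _ _ _ ⟨
            (inverse u * value v) * inverse v      ≈⟨ *-congʳ (*-congˡ u≈v) ⟨
            (inverse u * value u) * inverse v      ≈⟨ *-congʳ (*-comm _ _) ⟩
            (value u * inverse u) * inverse v      ≈⟨ *-congʳ (inverseʳ u) ⟩
            1# * inverse v                         ≈⟨ *-identityˡ _ ⟩
            inverse v ∎
        }
      ; comm = λ u v → *-comm (value u) (value v)
      }
    }

module _ {g ℓ} (G : Group g ℓ) where
  open Group G

  data Generated {n} (gens : Fin n → Carrier) : Pred Carrier (g ⊔ ℓ) where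
    gen  : ∀ i → Generated gens (gens i)
    unit : Generated gens ε
    mult : ∀ {x y} → Generated gens x → Generated gens y → Generated gens (x ∙ y)
    inv  : ∀ {x} → Generated gens x → Generated gens (x ⁻¹)
    resp : ∀ {x y} → x ≈ y → Generated gens x → Generated gens y

  FinitelyGenerated : Set (g ⊔ ℓ)
  FinitelyGenerated = ∃₂ λ n (gens : Fin n → Carrier) → ∀ x → Generated gens x

-- Domains and fields are discrete, i.e. have decidable equality.  A number
-- field always does: compare coordinates in a basis over ℚ.

record IntegralDomain c ℓ : Set (Level.suc (c ⊔ ℓ)) where
  field
    commutativeRing : CommutativeRing c ℓ
  open CommutativeRing commutativeRing public
  infix 4 _≟_
  field
    1≉0    : ¬ 1# ≈ 0#
    cancel : AlmostLeftCancellative _≈_ 0# _*_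
    _≟_    : Decidable _≈_

record Field c ℓ : Set (Level.suc (c ⊔ ℓ)) where
  field
    commutativeRing : CommutativeRing c ℓ
  open CommutativeRing commutativeRing public
  infix 4 _≟_
  field
    1≉0        : ¬ 1# ≈ 0#
    invertible : ∀ x → ¬ x ≈ 0# → ∃ λ y → x * y ≈ 1#
    _≟_        : Decidable _≈_

  cancel : AlmostLeftCancellative _≈_ 0# _*_
  cancel x y z x≉0 xy≈xz with x⁻¹ , xx⁻¹≈1 ← invertible x x≉0 = begin
    y              ≈⟨ expand y ⟩
    x⁻¹ * (x * y)  ≈⟨ *-congˡ xy≈xz ⟩
    x⁻¹ * (x * z)  ≈⟨ expand z ⟨
    z              ∎
    where
    open Relation.Binary.Reasoning.Setoid setoid
    expand : ∀ w → w ≈ x⁻¹ * (x * w)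
    expand w = begin
      w               ≈⟨ *-identityˡ w ⟨
      1# * w          ≈⟨ *-congʳ xx⁻¹≈1 ⟨
      (x * x⁻¹) * w   ≈⟨ *-congʳ (*-comm x x⁻¹) ⟩
      (x⁻¹ * x) * w   ≈⟨ *-assoc _ _ _ ⟩
      x⁻¹ * (x * w)   ∎

-- A polynomial is a list of coefficients, constant term first, with lists
-- compared coefficientwise, so that trailing zeros are immaterial.

module Polynomial {c ℓ} (A : CommutativeRing c ℓ) where
  open CommutativeRing A
  open Algebra.Properties.Ring ring using (-0#≈0#; -‿distribˡ-*)
  open Relation.Binary.Reasoning.Setoid setoid
  private module S = SemiringSolver commutativeSemiring

  Poly : Set c
  Poly = List Carrier

  coeff : Poly → ℕ → Carrier
  coeff []      _       = 0#
  coeff (a ∷ p) zero    = a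
  coeff (a ∷ p) (suc i) = coeff p i

  infix 4 _≋_
  record _≋_ (p q : Poly) : Set ℓ where
    constructor mk≋
    field coeff≈ : ∀ i → coeff p i ≈ coeff q i
  open _≋_ public

  const : Carrier → Poly
  const a = a ∷ []

  IsConstant : Pred Poly (c ⊔ ℓ)
  IsConstant p = ∃ λ a → p ≋ const a

  eval : Carrier → Poly → Carrier
  eval x = foldr (λ a r → a + x * r) 0#

  infixl 6 _⊕_
  infixl 7 _⊛_ _•_

  _⊕_ : Poly → Poly → Poly
  []      ⊕ q       = q
  (a ∷ p) ⊕ []      = a ∷ p
  (a ∷ p) ⊕ (b ∷ q) = (a + b) ∷ (p ⊕ q)

  ⊖_ : Poly → Poly
  ⊖_ = map (-_)

  _•_ : Carrier → Poly → Poly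
  a • p = map (a *_) p

  shift : Poly → Poly
  shift p = 0# ∷ p

  _⊛_ : Poly → Poly → Poly
  []      ⊛ q = []
  (a ∷ p) ⊛ q = a • q ⊕ shift (p ⊛ q)

  coeff-⊕ : ∀ p q i → coeff (p ⊕ q) i ≈ coeff p i + coeff q i
  coeff-⊕ []      q       i       = sym (+-identityˡ _)
  coeff-⊕ (a ∷ p) []      i       = sym (+-identityʳ _)
  coeff-⊕ (a ∷ p) (b ∷ q) zero    = refl
  coeff-⊕ (a ∷ p) (b ∷ q) (suc i) = coeff-⊕ p q i

  coeff-⊖ : ∀ p i → coeff (⊖ p) i ≈ - coeff p i
  coeff-⊖ []      i       = sym -0#≈0#
  coeff-⊖ (a ∷ p) zero    = refl
  coeff-⊖ (a ∷ p) (suc i) = coeff-⊖ p i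

  coeff-• : ∀ a p i → coeff (a • p) i ≈ a * coeff p i
  coeff-• a []      i       = sym (zeroʳ a)
  coeff-• a (b ∷ p) zero    = refl
  coeff-• a (b ∷ p) (suc i) = coeff-• a p i

  ≋-refl : ∀ {p} → p ≋ p
  ≋-refl = mk≋ λ _ → refl

  ≋-sym : ∀ {p q} → p ≋ q → q ≋ p
  ≋-sym e = mk≋ λ i → sym (coeff≈ e i)

  ≋-trans : ∀ {p q r} → p ≋ q → q ≋ r → p ≋ r
  ≋-trans e f = mk≋ λ i → trans (coeff≈ e i) (coeff≈ f i)

  ∷-cong : ∀ {a b p q} → a ≈ b → p ≋ q → (a ∷ p) ≋ (b ∷ q)
  ∷-cong a≈b p≋q = mk≋ λ { zero → a≈b ; (suc i) → coeff≈ p≋q i }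

  tail-≋ : ∀ {a b p q} → (a ∷ p) ≋ (b ∷ q) → p ≋ q
  tail-≋ e = mk≋ λ i → coeff≈ e (suc i)

  ∷≋[] : ∀ {a p} → a ≈ 0# → p ≋ [] → (a ∷ p) ≋ []
  ∷≋[] a≈0 p≋[] = mk≋ λ { zero → a≈0 ; (suc i) → coeff≈ p≋[] i }

  tail-≋[] : ∀ {a p} → (a ∷ p) ≋ [] → p ≋ []
  tail-≋[] e = mk≋ λ i → coeff≈ e (suc i)

  ⊕-cong : ∀ {p p′ q q′} → p ≋ p′ → q ≋ q′ → p ⊕ q ≋ p′ ⊕ q′
  ⊕-cong {p} {p′} {q} {q′} e f = mk≋ λ i →
    trans (coeff-⊕ p q i) (trans (+-cong (coeff≈ e i) (coeff≈ f i)) (sym (coeff-⊕ p′ q′ i)))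

  ⊕-comm : ∀ p q → p ⊕ q ≋ q ⊕ p
  ⊕-comm p q = mk≋ λ i → trans (coeff-⊕ p q i) (trans (+-comm _ _) (sym (coeff-⊕ q p i)))

  ⊕-assoc : ∀ p q r → (p ⊕ q) ⊕ r ≋ p ⊕ (q ⊕ r)
  ⊕-assoc p q r = mk≋ λ i → begin
    coeff ((p ⊕ q) ⊕ r) i                   ≈⟨ coeff-⊕ (p ⊕ q) r i ⟩
    coeff (p ⊕ q) i + coeff r i             ≈⟨ +-congʳ (coeff-⊕ p q i) ⟩
    (coeff p i + coeff q i) + coeff r i     ≈⟨ +-assoc _ _ _ ⟩
    coeff p i + (coeff q i + coeff r i)     ≈⟨ +-congˡ (coeff-⊕ q r i) ⟨
    coeff p i + coeff (q ⊕ r) i             ≈⟨ coeff-⊕ p (q ⊕ r) i ⟨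
    coeff (p ⊕ (q ⊕ r)) i                   ∎

  ⊕-identityʳ : ∀ p → p ⊕ [] ≋ p
  ⊕-identityʳ p = ⊕-comm p []

  ⊖-cong : ∀ {p q} → p ≋ q → ⊖ p ≋ ⊖ q
  ⊖-cong {p} {q} e = mk≋ λ i →
    trans (coeff-⊖ p i) (trans (-‿cong (coeff≈ e i)) (sym (coeff-⊖ q i)))

  ⊖-inverseʳ : ∀ p → p ⊕ ⊖ p ≋ []
  ⊖-inverseʳ p = mk≋ λ i →
    trans (coeff-⊕ p (⊖ p) i) (trans (+-congˡ (coeff-⊖ p i)) (-‿inverseʳ _))

  •-cong : ∀ {a b p q} → a ≈ b → p ≋ q → a • p ≋ b • q
  •-cong {a} {b} {p} {q} a≈b e = mk≋ λ i →
    trans (coeff-• a p i) (trans (*-cong a≈b (coeff≈ e i)) (sym (coeff-• b q i)))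

  •-⊕ : ∀ a p q → a • (p ⊕ q) ≋ a • p ⊕ a • q
  •-⊕ a p q = mk≋ λ i → begin
    coeff (a • (p ⊕ q)) i                  ≈⟨ coeff-• a (p ⊕ q) i ⟩
    a * coeff (p ⊕ q) i                    ≈⟨ *-congˡ (coeff-⊕ p q i) ⟩
    a * (coeff p i + coeff q i)            ≈⟨ distribˡ _ _ _ ⟩
    a * coeff p i + a * coeff q i          ≈⟨ +-cong (coeff-• a p i) (coeff-• a q i) ⟨
    coeff (a • p) i + coeff (a • q) i      ≈⟨ coeff-⊕ (a • p) (a • q) i ⟨
    coeff (a • p ⊕ a • q) i                ∎

  +-• : ∀ a b p → (a + b) • p ≋ a • p ⊕ b • p
  +-• a b p = mk≋ λ i → begin
    coeff ((a + b) • p) i                  ≈⟨ coeff-• (a + b) p i ⟩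
    (a + b) * coeff p i                    ≈⟨ distribʳ _ _ _ ⟩
    a * coeff p i + b * coeff p i          ≈⟨ +-cong (coeff-• a p i) (coeff-• b p i) ⟨
    coeff (a • p) i + coeff (b • p) i      ≈⟨ coeff-⊕ (a • p) (b • p) i ⟨
    coeff (a • p ⊕ b • p) i                ∎

  *-• : ∀ a b p → (a * b) • p ≋ a • (b • p)
  *-• a b p = mk≋ λ i → begin
    coeff ((a * b) • p) i    ≈⟨ coeff-• (a * b) p i ⟩
    (a * b) * coeff p i      ≈⟨ *-assoc _ _ _ ⟩
    a * (b * coeff p i)      ≈⟨ *-congˡ (coeff-• b p i) ⟨
    a * coeff (b • p) i      ≈⟨ coeff-• a (b • p) i ⟨
    coeff (a • (b • p)) i    ∎

  0-• : ∀ p → 0# • p ≋ []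
  0-• p = mk≋ λ i → trans (coeff-• 0# p i) (zeroˡ _)

  1-• : ∀ p → 1# • p ≋ p
  1-• p = mk≋ λ i → trans (coeff-• 1# p i) (*-identityˡ _)

  shift-⊕ : ∀ p q → shift (p ⊕ q) ≋ shift p ⊕ shift q
  shift-⊕ p q = ∷-cong (sym (+-identityˡ 0#)) ≋-refl

  shift-• : ∀ a p → a • shift p ≋ shift (a • p)
  shift-• a p = ∷-cong (zeroʳ a) ≋-refl

  ⊕-swap : ∀ p q r s → (p ⊕ q) ⊕ (r ⊕ s) ≋ (p ⊕ r) ⊕ (q ⊕ s)
  ⊕-swap p q r s = mk≋ λ i → begin
    coeff ((p ⊕ q) ⊕ (r ⊕ s)) i                             ≈⟨ expand p q r s i ⟩
    (coeff p i + coeff q i) + (coeff r i + coeff s i)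
      ≈⟨ S.solve 4 (λ a b c d → (a S.:+ b) S.:+ (c S.:+ d) S.:= (a S.:+ c) S.:+ (b S.:+ d)) refl
           (coeff p i) (coeff q i) (coeff r i) (coeff s i) ⟩
    (coeff p i + coeff r i) + (coeff q i + coeff s i)       ≈⟨ expand p r q s i ⟨
    coeff ((p ⊕ r) ⊕ (q ⊕ s)) i                             ∎
    where
    expand : ∀ p q r s i →
             coeff ((p ⊕ q) ⊕ (r ⊕ s)) i ≈ (coeff p i + coeff q i) + (coeff r i + coeff s i)
    expand p q r s i = trans (coeff-⊕ (p ⊕ q) (r ⊕ s) i) (+-cong (coeff-⊕ p q i) (coeff-⊕ r s i))

  ⊛-distribʳ : ∀ r p q → (p ⊕ q) ⊛ r ≋ p ⊛ r ⊕ q ⊛ r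
  ⊛-distribʳ r []      q       = ≋-refl
  ⊛-distribʳ r (a ∷ p) []      = ≋-sym (⊕-identityʳ _)
  ⊛-distribʳ r (a ∷ p) (b ∷ q) =
    ≋-trans (⊕-cong (+-• a b r)
              (≋-trans (∷-cong refl (⊛-distribʳ r p q)) (shift-⊕ (p ⊛ r) (q ⊛ r))))
            (⊕-swap (a • r) (b • r) (shift (p ⊛ r)) (shift (q ⊛ r)))

  ⊛-zeroʳ : ∀ p → p ⊛ [] ≋ []
  ⊛-zeroʳ []      = ≋-refl
  ⊛-zeroʳ (a ∷ p) = ∷≋[] refl (⊛-zeroʳ p)

  ⊛-∷ʳ : ∀ p b q → p ⊛ (b ∷ q) ≋ b • p ⊕ shift (p ⊛ q)
  ⊛-∷ʳ []      b q = mk≋ λ { zero → refl ; (suc i) → refl }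
  ⊛-∷ʳ (a ∷ p) b q = ∷-cong (+-congʳ (*-comm a b))
    (≋-trans (⊕-cong ≋-refl (⊛-∷ʳ p b q))
    (≋-trans (≋-sym (⊕-assoc (a • q) (b • p) (shift (p ⊛ q))))
    (≋-trans (⊕-cong (⊕-comm (a • q) (b • p)) ≋-refl)
             (⊕-assoc (b • p) (a • q) (shift (p ⊛ q))))))

  ⊛-comm : ∀ p q → p ⊛ q ≋ q ⊛ p
  ⊛-comm []      q = ≋-sym (⊛-zeroʳ q)
  ⊛-comm (a ∷ p) q =
    ≋-trans (⊕-cong ≋-refl (∷-cong refl (⊛-comm p q))) (≋-sym (⊛-∷ʳ q a p))

  ⊛-congˡ : ∀ p {q r} → q ≋ r → p ⊛ q ≋ p ⊛ r
  ⊛-congˡ []      e = ≋-refl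
  ⊛-congˡ (a ∷ p) e = ⊕-cong (•-cong refl e) (∷-cong refl (⊛-congˡ p e))

  ⊛-cong : ∀ {p p′ q q′} → p ≋ p′ → q ≋ q′ → p ⊛ q ≋ p′ ⊛ q′
  ⊛-cong {p} {p′} {q} {q′} e f =
    ≋-trans (⊛-congˡ p f)
    (≋-trans (⊛-comm p q′) (≋-trans (⊛-congˡ q′ e) (⊛-comm q′ p′)))

  •-⊛ : ∀ a p q → (a • p) ⊛ q ≋ a • (p ⊛ q)
  •-⊛ a []      q = ≋-refl
  •-⊛ a (b ∷ p) q =
    ≋-trans (⊕-cong (*-• a b q)
              (≋-trans (∷-cong refl (•-⊛ a p q)) (≋-sym (shift-• a (p ⊛ q)))))
            (≋-sym (•-⊕ a (b • q) (shift (p ⊛ q))))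

  shift-⊛ : ∀ p q → shift p ⊛ q ≋ shift (p ⊛ q)
  shift-⊛ p q = ⊕-cong (0-• q) ≋-refl

  ⊛-assoc : ∀ p q r → (p ⊛ q) ⊛ r ≋ p ⊛ (q ⊛ r)
  ⊛-assoc []      q r = ≋-refl
  ⊛-assoc (a ∷ p) q r =
    ≋-trans (⊛-distribʳ r (a • q) (shift (p ⊛ q)))
    (⊕-cong (•-⊛ a q r)
      (≋-trans (shift-⊛ (p ⊛ q) r) (∷-cong refl (⊛-assoc p q r))))

  ⊛-identityˡ : ∀ p → const 1# ⊛ p ≋ p
  ⊛-identityˡ p =
    ≋-trans (⊕-cong (1-• p) (∷≋[] refl ≋-refl)) (⊕-identityʳ p)

  polynomialRing : CommutativeRing c ℓ
  polynomialRing = record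
    { Carrier = Poly
    ; _≈_ = _≋_
    ; _+_ = _⊕_
    ; _*_ = _⊛_
    ; -_  = ⊖_
    ; 0#  = []
    ; 1#  = const 1#
    ; isCommutativeRing = record
      { isRing = record
        { +-isAbelianGroup = record
          { isGroup = record
            { isMonoid = record
              { isSemigroup = record
                { isMagma = record
                  { isEquivalence = record { refl = ≋-refl ; sym = ≋-sym ; trans = ≋-trans }
                  ; ∙-cong = ⊕-cong
                  }
                ; assoc = ⊕-assoc
                }
              ; identity = (λ _ → ≋-refl) , ⊕-identityʳ
              }
            ; inverse = (λ p → ≋-trans (⊕-comm (⊖ p) p) (⊖-inverseʳ p)) , ⊖-inverseʳ
            ; ⁻¹-cong = ⊖-cong
            }
          ; comm = ⊕-comm
          }
        ; *-cong = ⊛-cong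
        ; *-assoc = ⊛-assoc
        ; *-identity = ⊛-identityˡ , (λ p → ≋-trans (⊛-comm p (const 1#)) (⊛-identityˡ p))
        ; distrib = (λ p q r → ≋-trans (⊛-comm p (q ⊕ r))
                       (≋-trans (⊛-distribʳ p q r) (⊕-cong (⊛-comm q p) (⊛-comm r p))))
                  , ⊛-distribʳ
        }
      ; *-comm = ⊛-comm
      }
    }

  module _ (x : Carrier) where

    eval-≋[] : ∀ {p} → p ≋ [] → eval x p ≈ 0#
    eval-≋[] {[]}    e = refl
    eval-≋[] {a ∷ p} e = begin
      a + x * eval x p   ≈⟨ +-cong (coeff≈ e 0) (*-congˡ (eval-≋[] (tail-≋[] e))) ⟩
      0# + x * 0#        ≈⟨ +-identityˡ _ ⟩
      x * 0#             ≈⟨ zeroʳ x ⟩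
      0#                 ∎

    eval-cong : ∀ {p q} → p ≋ q → eval x p ≈ eval x q
    eval-cong {[]}    {q}     e = sym (eval-≋[] (≋-sym e))
    eval-cong {a ∷ p} {[]}    e = eval-≋[] e
    eval-cong {a ∷ p} {b ∷ q} e = +-cong (coeff≈ e 0) (*-congˡ (eval-cong (tail-≋ e)))

    eval-⊕ : ∀ p q → eval x (p ⊕ q) ≈ eval x p + eval x q
    eval-⊕ []      q       = sym (+-identityˡ _)
    eval-⊕ (a ∷ p) []      = sym (+-identityʳ _)
    eval-⊕ (a ∷ p) (b ∷ q) = begin
      (a + b) + x * eval x (p ⊕ q)            ≈⟨ +-congˡ (*-congˡ (eval-⊕ p q)) ⟩
      (a + b) + x * (eval x p + eval x q)
        ≈⟨ S.solve 5 (λ a b x u v → (a S.:+ b) S.:+ x S.:* (u S.:+ v)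
                            S.:= (a S.:+ x S.:* u) S.:+ (b S.:+ x S.:* v))
                     refl a b x (eval x p) (eval x q) ⟩
      (a + x * eval x p) + (b + x * eval x q) ∎

    eval-• : ∀ a p → eval x (a • p) ≈ a * eval x p
    eval-• a []      = sym (zeroʳ a)
    eval-• a (b ∷ p) = begin
      a * b + x * eval x (a • p)     ≈⟨ +-congˡ (*-congˡ (eval-• a p)) ⟩
      a * b + x * (a * eval x p)
        ≈⟨ S.solve 4 (λ a b x u → a S.:* b S.:+ x S.:* (a S.:* u)
                            S.:= a S.:* (b S.:+ x S.:* u)) refl a b x (eval x p) ⟩
      a * (b + x * eval x p)         ∎

    eval-⊛ : ∀ p q → eval x (p ⊛ q) ≈ eval x p * eval x q
    eval-⊛ []      q = sym (zeroˡ _)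
    eval-⊛ (a ∷ p) q = begin
      eval x (a • q ⊕ shift (p ⊛ q))           ≈⟨ eval-⊕ (a • q) (shift (p ⊛ q)) ⟩
      eval x (a • q) + (0# + x * eval x (p ⊛ q))
        ≈⟨ +-cong (eval-• a q) (trans (+-identityˡ _) (*-congˡ (eval-⊛ p q))) ⟩
      a * eval x q + x * (eval x p * eval x q)
        ≈⟨ S.solve 4 (λ a x u v → a S.:* v S.:+ x S.:* (u S.:* v)
                            S.:= (a S.:+ x S.:* u) S.:* v) refl a x (eval x p) (eval x q) ⟩
      (a + x * eval x p) * eval x q            ∎

    eval-const : ∀ a → eval x (const a) ≈ a
    eval-const a = trans (+-congˡ (zeroʳ x)) (+-identityʳ a)

    linear : Poly
    linear = - x ∷ 1# ∷ []

    quotient : Poly → Poly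
    quotient []              = []
    quotient (a ∷ [])        = []
    quotient (a ∷ p@(_ ∷ _)) = eval x p ∷ quotient p

    linear-⊛ : ∀ q → linear ⊛ q ≋ (- x) • q ⊕ shift q
    linear-⊛ q = ⊕-cong ≋-refl (∷-cong refl (⊛-identityˡ q))

    division-step : ∀ a p e q → p ≋ const e ⊕ ((- x) • q ⊕ shift q) →
                    (a ∷ p) ≋ const (a + x * e) ⊕ ((- x) • (e ∷ q) ⊕ shift (e ∷ q))
    division-step a p e q ih = mk≋ λ
      { zero    → sym (begin
          (a + x * e) + (- x * e + 0#)   ≈⟨ +-congˡ (+-identityʳ _) ⟩
          (a + x * e) + - x * e          ≈⟨ +-assoc _ _ _ ⟩
          a + (x * e + - x * e)          ≈⟨ +-congˡ (distribʳ e x (- x)) ⟨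
          a + (x + - x) * e              ≈⟨ +-congˡ (*-congʳ (-‿inverseʳ x)) ⟩
          a + 0# * e                     ≈⟨ +-congˡ (zeroˡ e) ⟩
          a + 0#                         ≈⟨ +-identityʳ a ⟩
          a                              ∎)
      ; (suc i) → begin
          coeff p i                                           ≈⟨ coeff≈ ih i ⟩
          coeff (const e ⊕ (s ⊕ shift q)) i                   ≈⟨ coeff-⊕ (const e) (s ⊕ shift q) i ⟩
          coeff (const e) i + coeff (s ⊕ shift q) i           ≈⟨ +-congˡ (coeff-⊕ s (shift q) i) ⟩
          coeff (const e) i + (coeff s i + coeff (shift q) i) ≈⟨ rearrange _ _ _ ⟩
          coeff s i + (coeff (const e) i + coeff (shift q) i) ≈⟨ +-congˡ (join i) ⟩
          coeff s i + coeff (e ∷ q) i                         ≈⟨ coeff-⊕ s (e ∷ q) i ⟨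
          coeff (s ⊕ (e ∷ q)) i                               ∎
      }
      where
      s = (- x) • q
      rearrange : ∀ u v w → u + (v + w) ≈ v + (u + w)
      rearrange u v w = trans (sym (+-assoc u v w)) (trans (+-congʳ (+-comm u v)) (+-assoc v u w))
      join : ∀ i → coeff (const e) i + coeff (shift q) i ≈ coeff (e ∷ q) i
      join zero    = +-identityʳ e
      join (suc i) = +-identityˡ _

    division : ∀ p → p ≋ const (eval x p) ⊕ ((- x) • quotient p ⊕ shift (quotient p))
    division []              = mk≋ λ { zero → sym (+-identityˡ _) ; (suc i) → refl }
    division (a ∷ [])        = mk≋ λ
      { zero    → sym (trans (+-identityʳ _) (eval-const a))
      ; (suc i) → refl
      }
    division (a ∷ p@(_ ∷ _)) = division-step a p (eval x p) (quotient p) (division p)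

    length-quotient : ∀ p → length (quotient p) ≡ length p ℕ.∸ 1
    length-quotient []              = ≡.refl
    length-quotient (a ∷ [])        = ≡.refl
    length-quotient (a ∷ p@(_ ∷ _)) = ≡.cong suc (length-quotient p)

    root⇒factor : ∀ p → eval x p ≈ 0# → p ≋ linear ⊛ quotient p
    root⇒factor p p[x]≈0 =
      ≋-trans (division p)
      (≋-trans (⊕-cong (∷≋[] p[x]≈0 ≋-refl) ≋-refl)
               (≋-sym (linear-⊛ (quotient p))))

  eval-⊖ : ∀ x p → eval x (⊖ p) ≈ - eval x p
  eval-⊖ x p = begin
    eval x (⊖ p)                             ≈⟨ +-identityˡ _ ⟨
    0# + eval x (⊖ p)                        ≈⟨ +-congʳ (-‿inverseˡ (eval x p)) ⟨
    (- eval x p + eval x p) + eval x (⊖ p)   ≈⟨ +-assoc _ _ _ ⟩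
    - eval x p + (eval x p + eval x (⊖ p))   ≈⟨ +-congˡ (eval-⊕ x p (⊖ p)) ⟨
    - eval x p + eval x (p ⊕ ⊖ p)            ≈⟨ +-congˡ (eval-≋[] x (⊖-inverseʳ p)) ⟩
    - eval x p + 0#                          ≈⟨ +-identityʳ _ ⟩
    - eval x p                               ∎

  eval-isRingHomomorphism : ∀ x →
    IsRingHomomorphism (CommutativeRing.rawRing polynomialRing) rawRing (eval x)
  eval-isRingHomomorphism x = record
    { isSemiringHomomorphism = record
      { isNearSemiringHomomorphism = record
        { +-isMonoidHomomorphism = record
          { isMagmaHomomorphism = record
            { isRelHomomorphism = record { cong = eval-cong x }
            ; homo = eval-⊕ x
            }
          ; ε-homo = refl
          }
        ; *-homo = eval-⊛ x
        }
      ; 1#-homo = eval-const x 1#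
      }
    ; -‿homo = eval-⊖ x
    }

module _ {c ℓ} (F : Field c ℓ) where
  open Field F
  open Polynomial commutativeRing
  private
    module P = CommutativeRing polynomialRing

    ≋[]? : ∀ p → Dec (p ≋ [])
    ≋[]? []      = yes ≋-refl
    ≋[]? (a ∷ p) with a ≟ 0# | ≋[]? p
    ... | yes a≈0 | yes p≋[] = yes (∷≋[] a≈0 p≋[])
    ... | no  a≉0 | _        = no λ e → a≉0 (coeff≈ e 0)
    ... | yes _   | no  p≉[] = no λ e → p≉[] (tail-≋[] e)

    zero-product-step : ∀ a p b q →
      (p ⊛ (b ∷ q) ≋ [] → p ≋ [] ⊎ (b ∷ q) ≋ []) →
      ((a ∷ p) ⊛ q ≋ [] → (a ∷ p) ≋ [] ⊎ q ≋ []) →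
      (a ∷ p) ⊛ (b ∷ q) ≋ [] → (a ∷ p) ≋ [] ⊎ (b ∷ q) ≋ []
    zero-product-step a p b q ihˡ ihʳ e with a ≟ 0#
    ... | yes a≈0 = Sum.map₁ (∷≋[] a≈0) (ihˡ (tail-≋[] (≋-trans (≋-sym (≋-trans
            (⊛-cong {a ∷ p} {shift p} {b ∷ q} (∷-cong a≈0 ≋-refl) ≋-refl)
            (shift-⊛ p (b ∷ q)))) e)))
    ... | no  a≉0 = Sum.map₂ (∷≋[] b≈0) (ihʳ (tail-≋[] (≋-trans (≋-sym (≋-trans
            (⊛-∷ʳ (a ∷ p) b q)
            (⊕-cong (≋-trans (•-cong {p = a ∷ p} b≈0 ≋-refl) (0-• (a ∷ p))) ≋-refl))) e)))
      where
      b≈0 : b ≈ 0#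
      b≈0 = cancel a b 0# a≉0
              (trans (sym (+-identityʳ _)) (trans (coeff≈ e 0) (sym (zeroʳ a))))

    zero-product : ∀ p q → p ⊛ q ≋ [] → p ≋ [] ⊎ q ≋ []
    zero-product []      q       e = inj₁ ≋-refl
    zero-product (a ∷ p) []      e = inj₂ ≋-refl
    zero-product (a ∷ p) (b ∷ q) e =
      zero-product-step a p b q (zero-product p (b ∷ q)) (zero-product (a ∷ p) q) e

    module PR = Algebra.Properties.Ring P.ring
    module PG = Algebra.Properties.Group P.+-group

    ≋-from-difference : ∀ p q → p ⊕ ⊖ q ≋ [] → p ≋ q
    ≋-from-difference = PG.x∙y⁻¹≈ε⇒x≈y

  polynomialDomain : IntegralDomain c ℓ
  polynomialDomain = record
    { commutativeRing = polynomialRing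
    ; 1≉0    = λ e → 1≉0 (coeff≈ e 0)
    ; cancel = λ p q r p≉0 pq≋pr → cancel′ p q r p≉0
        (zero-product p (q ⊕ ⊖ r) (P.trans (PR.x[y-z]≈xy-xz p q r) (PG.x≈y⇒x∙y⁻¹≈ε pq≋pr)))
    ; _≟_    = λ p q → Dec.map′ (≋-from-difference p q) PG.x≈y⇒x∙y⁻¹≈ε (≋[]? (p ⊕ ⊖ q))
    }
    where
    cancel′ : ∀ p q r → ¬ p ≋ [] → p ≋ [] ⊎ (q ⊕ ⊖ r) ≋ [] → q ≋ r
    cancel′ p q r p≉0 (inj₁ p≋0) = ⊥-elim (p≉0 p≋0)
    cancel′ p q r p≉0 (inj₂ e)   = ≋-from-difference q r e

module Fractions {c ℓ} (D : IntegralDomain c ℓ) where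
  open IntegralDomain D
  open Algebra.Properties.Ring ring using (-‿distribˡ-*)
  open Relation.Binary.Reasoning.Setoid setoid
  private module S = SemiringSolver commutativeSemiring
  open S using (solve; _:=_; _:+_; _:*_; con)

  *-nonzero : ∀ {x y} → ¬ x ≈ 0# → ¬ y ≈ 0# → ¬ x * y ≈ 0#
  *-nonzero {x} {y} x≉0 y≉0 xy≈0 = y≉0 (cancel x y 0# x≉0 (trans xy≈0 (sym (zeroʳ x))))

  record Fraction : Set (c ⊔ ℓ) where
    constructor mkFraction
    field
      num   : Carrier
      den   : Carrier
      den≉0 : ¬ den ≈ 0#
  open Fraction public

  infix 4 _≃_
  record _≃_ (x y : Fraction) : Set ℓ where
    constructor mk≃
    field cross : num x * den y ≈ num y * den x
  open _≃_ public

  fromDomain : Carrier → Fraction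
  fromDomain a = mkFraction a 1# 1≉0

  _⊞_ _⊠_ : Fraction → Fraction → Fraction
  x ⊞ y = mkFraction (num x * den y + num y * den x) (den x * den y) (*-nonzero (den≉0 x) (den≉0 y))
  x ⊠ y = mkFraction (num x * num y) (den x * den y) (*-nonzero (den≉0 x) (den≉0 y))

  ⊟_ : Fraction → Fraction
  ⊟ x = mkFraction (- num x) (den x) (den≉0 x)

  ≃-refl : ∀ {x} → x ≃ x
  ≃-refl = mk≃ refl

  ≃-sym : ∀ {x y} → x ≃ y → y ≃ x
  ≃-sym (mk≃ e) = mk≃ (sym e)

  ≃-trans : ∀ {x y z} → x ≃ y → y ≃ z → x ≃ z
  ≃-trans {x} {y} {z} (mk≃ e) (mk≃ f) = mk≃ (cancel (den y) _ _ (den≉0 y) (begin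
    den y * (num x * den z)   ≈⟨ solve 3 (λ a b c → a :* (b :* c) := (b :* a) :* c) refl _ _ _ ⟩
    (num x * den y) * den z   ≈⟨ *-congʳ e ⟩
    (num y * den x) * den z   ≈⟨ solve 3 (λ a b c → (a :* b) :* c := (a :* c) :* b) refl _ _ _ ⟩
    (num y * den z) * den x   ≈⟨ *-congʳ f ⟩
    (num z * den y) * den x   ≈⟨ solve 3 (λ a b c → (a :* b) :* c := b :* (a :* c)) refl _ _ _ ⟩
    den y * (num z * den x)   ∎))

  ⊞-cong : ∀ {x x′ y y′} → x ≃ x′ → y ≃ y′ → (x ⊞ y) ≃ (x′ ⊞ y′)
  ⊞-cong {x} {x′} {y} {y′} (mk≃ e) (mk≃ f) = mk≃ (begin
    (num x * den y + num y * den x) * (den x′ * den y′)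
      ≈⟨ solve 6 (λ a b c d b′ d′ → (a :* d :+ c :* b) :* (b′ :* d′)
                   := (a :* b′) :* (d :* d′) :+ (c :* d′) :* (b :* b′)) refl
           (num x) (den x) (num y) (den y) (den x′) (den y′) ⟩
    (num x * den x′) * (den y * den y′) + (num y * den y′) * (den x * den x′)
      ≈⟨ +-cong (*-congʳ e) (*-congʳ f) ⟩
    (num x′ * den x) * (den y * den y′) + (num y′ * den y) * (den x * den x′)
      ≈⟨ solve 6 (λ a b c d b′ d′ → (a :* b) :* (d :* d′) :+ (c :* d) :* (b :* b′)
                   := (a :* d′ :+ c :* b′) :* (b :* d)) refl
           (num x′) (den x) (num y′) (den y) (den x′) (den y′) ⟩
    (num x′ * den y′ + num y′ * den x′) * (den x * den y) ∎)

  ⊠-cong : ∀ {x x′ y y′} → x ≃ x′ → y ≃ y′ → (x ⊠ y) ≃ (x′ ⊠ y′)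
  ⊠-cong {x} {x′} {y} {y′} (mk≃ e) (mk≃ f) = mk≃ (begin
    (num x * num y) * (den x′ * den y′)   ≈⟨ interchange _ _ _ _ ⟩
    (num x * den x′) * (num y * den y′)   ≈⟨ *-cong e f ⟩
    (num x′ * den x) * (num y′ * den y)   ≈⟨ interchange _ _ _ _ ⟩
    (num x′ * num y′) * (den x * den y)   ∎)
    where
    interchange : ∀ a b c d → (a * b) * (c * d) ≈ (a * c) * (b * d)
    interchange = solve 4 (λ a b c d → (a :* b) :* (c :* d) := (a :* c) :* (b :* d)) refl

  ⊟-cong : ∀ {x y} → x ≃ y → (⊟ x) ≃ (⊟ y)
  ⊟-cong {x} {y} (mk≃ e) = mk≃ (begin
    - num x * den y     ≈⟨ -‿distribˡ-* _ _ ⟨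
    - (num x * den y)   ≈⟨ -‿cong e ⟩
    - (num y * den x)   ≈⟨ -‿distribˡ-* _ _ ⟩
    - num y * den x     ∎)

  ⊟-inverseˡ : ∀ x → ((⊟ x) ⊞ x) ≃ fromDomain 0#
  ⊟-inverseˡ x = mk≃ (begin
    (- num x * den x + num x * den x) * 1#   ≈⟨ *-identityʳ _ ⟩
    - num x * den x + num x * den x          ≈⟨ distribʳ _ _ _ ⟨
    (- num x + num x) * den x                ≈⟨ *-congʳ (-‿inverseˡ _) ⟩
    0# * den x                               ≈⟨ zeroˡ _ ⟩
    0#                                       ≈⟨ zeroˡ _ ⟨
    0# * (den x * den x)                     ∎)

  ⊞-comm : ∀ x y → (x ⊞ y) ≃ (y ⊞ x)
  ⊞-comm x y = mk≃ (solve 4 (λ a b c d → (a :* d :+ c :* b) :* (d :* b)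
                               := (c :* b :+ a :* d) :* (b :* d)) refl
                      (num x) (den x) (num y) (den y))

  ⊞-identityˡ : ∀ x → (fromDomain 0# ⊞ x) ≃ x
  ⊞-identityˡ x = mk≃ (solve 2 (λ a b → (con 0 :* b :+ a :* con 1) :* b := a :* (con 1 :* b))
                         refl (num x) (den x))

  ⊠-comm : ∀ x y → (x ⊠ y) ≃ (y ⊠ x)
  ⊠-comm x y = mk≃ (solve 4 (λ a b c d → (a :* c) :* (d :* b) := (c :* a) :* (b :* d)) refl
                      (num x) (den x) (num y) (den y))

  ⊠-identityˡ : ∀ x → (fromDomain 1# ⊠ x) ≃ x
  ⊠-identityˡ x = mk≃ (solve 2 (λ a b → (con 1 :* a) :* b := a :* (con 1 :* b))
                         refl (num x) (den x))

  ⊠-distribˡ : ∀ x y z → (x ⊠ (y ⊞ z)) ≃ ((x ⊠ y) ⊞ (x ⊠ z))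
  ⊠-distribˡ x y z = mk≃ (solve 6 (λ a b c d e f →
      (a :* (c :* f :+ e :* d)) :* ((b :* d) :* (b :* f))
      := ((a :* c) :* (b :* f) :+ (a :* e) :* (b :* d)) :* (b :* (d :* f))) refl
      (num x) (den x) (num y) (den y) (num z) (den z))

  fractionRing : CommutativeRing (c ⊔ ℓ) ℓ
  fractionRing = record
    { Carrier = Fraction
    ; _≈_ = _≃_
    ; _+_ = _⊞_
    ; _*_ = _⊠_
    ; -_  = ⊟_
    ; 0#  = fromDomain 0#
    ; 1#  = fromDomain 1#
    ; isCommutativeRing = record
      { isRing = record
        { +-isAbelianGroup = record
          { isGroup = record
            { isMonoid = record
              { isSemigroup = record
                { isMagma = record
                  { isEquivalence = record { refl = ≃-refl ; sym = ≃-sym ; trans = ≃-trans }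
                  ; ∙-cong = ⊞-cong
                  }
                ; assoc = λ x y z → mk≃ (solve 6 (λ a b c d e f →
                    ((a :* d :+ c :* b) :* f :+ e :* (b :* d)) :* (b :* (d :* f))
                    := (a :* (d :* f) :+ (c :* f :+ e :* d) :* b) :* ((b :* d) :* f)) refl
                    (num x) (den x) (num y) (den y) (num z) (den z))
                }
              ; identity = ⊞-identityˡ , λ x → ≃-trans (⊞-comm x (fromDomain 0#)) (⊞-identityˡ x)
              }
            ; inverse = ⊟-inverseˡ , λ x → ≃-trans (⊞-comm x (⊟ x)) (⊟-inverseˡ x)
            ; ⁻¹-cong = ⊟-cong
            }
          ; comm = ⊞-comm
          }
        ; *-cong = ⊠-cong
        ; *-assoc = λ x y z → mk≃ (solve 6 (λ a b c d e f →
            ((a :* c) :* e) :* (b :* (d :* f)) := (a :* (c :* e)) :* ((b :* d) :* f)) refl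
            (num x) (den x) (num y) (den y) (num z) (den z))
        ; *-identity = ⊠-identityˡ , λ x → ≃-trans (⊠-comm x (fromDomain 1#)) (⊠-identityˡ x)
        ; distrib = ⊠-distribˡ , λ x y z → ≃-trans (⊠-comm (y ⊞ z) x)
            (≃-trans (⊠-distribˡ x y z) (⊞-cong (⊠-comm x y) (⊠-comm x z)))
        }
      ; *-comm = ⊠-comm
      }
    }

  fromDomain-injective : ∀ {a b} → fromDomain a ≃ fromDomain b → a ≈ b
  fromDomain-injective (mk≃ e) = trans (sym (*-identityʳ _)) (trans e (*-identityʳ _))

  fromDomain-cong : ∀ {a b} → a ≈ b → fromDomain a ≃ fromDomain b
  fromDomain-cong e = mk≃ (*-congʳ e)

  fromDomain-⊠ : ∀ a b → fromDomain (a * b) ≃ (fromDomain a ⊠ fromDomain b)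
  fromDomain-⊠ a b = mk≃ (*-congˡ (*-identityˡ 1#))

  fromDomain-isRingHomomorphism :
    IsRingHomomorphism rawRing (CommutativeRing.rawRing fractionRing) fromDomain
  fromDomain-isRingHomomorphism = record
    { isSemiringHomomorphism = record
      { isNearSemiringHomomorphism = record
        { +-isMonoidHomomorphism = record
          { isMagmaHomomorphism = record
            { isRelHomomorphism = record { cong = fromDomain-cong }
            ; homo = λ a b → mk≃ (solve 2 (λ a b → (a :+ b) :* (con 1 :* con 1)
                                     := (a :* con 1 :+ b :* con 1) :* con 1) refl a b)
            }
          ; ε-homo = ≃-refl
          }
        ; *-homo = fromDomain-⊠
        }
      ; 1#-homo = ≃-refl
      }
    ; -‿homo = λ _ → ≃-refl
    }

  fractionField : Field (c ⊔ ℓ) ℓ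
  fractionField = record
    { commutativeRing = fractionRing
    ; 1≉0        = λ e → 1≉0 (fromDomain-injective e)
    ; invertible = λ x x≉0 →
        let num≉0 = λ e → x≉0 (mk≃ (trans (*-congʳ e) (trans (zeroˡ _) (sym (zeroˡ _)))))
        in mkFraction (den x) (num x) num≉0
         , mk≃ (solve 2 (λ a b → (a :* b) :* con 1 := con 1 :* (b :* a)) refl (num x) (den x))
    ; _≟_        = λ x y → Dec.map′ mk≃ cross (num x * den y ≟ num y * den x)
    }

record Weierstrass {c ℓ} (A : CommutativeRing c ℓ) : Set c where
  constructor mkWeierstrass
  open CommutativeRing A
  field a₁ a₂ a₃ a₄ a₆ : Carrier

-- y² = (x - e₁)(x - e₂)(x - e₃), expanded.
fromRoots : ∀ {c ℓ} (A : CommutativeRing c ℓ) (e₁ e₂ e₃ : CommutativeRing.Carrier A) → Weierstrass A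
fromRoots A e₁ e₂ e₃ = record
  { a₁ = 0#
  ; a₂ = - (e₁ + e₂ + e₃)
  ; a₃ = 0#
  ; a₄ = e₁ * e₂ + e₁ * e₃ + e₂ * e₃
  ; a₆ = - (e₁ * e₂ * e₃)
  }
  where open CommutativeRing A

mapWeierstrass : ∀ {c ℓ c′ ℓ′} (A : CommutativeRing c ℓ) (B : CommutativeRing c′ ℓ′) →
                 (CommutativeRing.Carrier A → CommutativeRing.Carrier B) →
                 Weierstrass A → Weierstrass B
mapWeierstrass A B f W = mkWeierstrass (f a₁) (f a₂) (f a₃) (f a₄) (f a₆)
  where open Weierstrass W

module Cubic {c ℓ} (A : CommutativeRing c ℓ) (W : Weierstrass A) where
  open CommutativeRing A
  open Algebra.Definitions.RawMonoid +-rawMonoid using () renaming (_×_ to _·_)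
  open Weierstrass W

  Δ : Carrier
  Δ = - (b₂ * b₂ * b₈) - 8 · (b₄ * b₄ * b₄) - 27 · (b₆ * b₆) + 9 · (b₂ * b₄ * b₆)
    where
    b₂ = a₁ * a₁ + 4 · a₂
    b₄ = 2 · a₄ + a₁ * a₃
    b₆ = a₃ * a₃ + 4 · a₆
    b₈ = a₁ * a₁ * a₆ + 4 · (a₂ * a₆) - a₁ * a₃ * a₄ + a₂ * (a₃ * a₃) - a₄ * a₄

  -- The two sides of the homogenized Weierstrass equation.
  lhs rhs : Carrier → Carrier → Carrier → Carrier
  lhs x y z = y * y * z + a₁ * (x * y * z) + a₃ * (y * z * z)
  rhs x y z = x * x * x + a₂ * (x * x * z) + a₄ * (x * z * z) + a₆ * (z * z * z)

module _ {c ℓ} (F : Field c ℓ) where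
  open Field F
  open Algebra.Definitions.RawMonoid +-rawMonoid using () renaming (_×_ to _·_)

  IsElliptic : Weierstrass commutativeRing → Set ℓ
  IsElliptic W = ¬ Cubic.Δ commutativeRing W ≈ 0#

  -- An isomorphism of elliptic curves in Weierstrass form is an admissible
  -- change of variables x = u²x′ + r, y = u³y′ + su²x′ + t with u ≠ 0; the
  -- fields say how it carries the coefficients of the first curve to those
  -- of the second.
  record _≅_ (W W′ : Weierstrass commutativeRing) : Set (c ⊔ ℓ) where
    open Weierstrass W
    open Weierstrass W′ renaming (a₁ to a₁′; a₂ to a₂′; a₃ to a₃′; a₄ to a₄′; a₆ to a₆′)
    field
      u r s t : Carrier
      u≉0     : ¬ u ≈ 0#
      a₁-eq   : u * a₁′ ≈ a₁ + 2 · s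
      a₂-eq   : u * u * a₂′ ≈ a₂ - s * a₁ + 3 · r - s * s
      a₃-eq   : u * u * u * a₃′ ≈ a₃ + r * a₁ + 2 · t
      a₄-eq   : u * u * u * u * a₄′
                ≈ a₄ - s * a₃ + 2 · (r * a₂) - (t + r * s) * a₁ + 3 · (r * r) - 2 · (s * t)
      a₆-eq   : u * u * u * u * u * u * a₆′
                ≈ a₆ + r * a₄ + r * r * a₂ + r * r * r - t * a₃ - t * t - r * t * a₁

  Triple : Set c
  Triple = Carrier × Carrier × Carrier

  NonZero : Pred Triple ℓ
  NonZero (x , y , z) = ¬ (x ≈ 0# × y ≈ 0# × z ≈ 0#)

  -- Equality of homogeneous coordinates as points of the projective plane.
  infix 4 _∼_
  _∼_ : Triple → Triple → Set (c ⊔ ℓ)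
  (x , y , z) ∼ (x′ , y′ , z′) =
    ∃ λ k → ¬ k ≈ 0# × x ≈ k * x′ × y ≈ k * y′ × z ≈ k * z′

  OnCurve : Weierstrass commutativeRing → Pred Triple ℓ
  OnCurve W (x , y , z) = lhs x y z ≈ rhs x y z
    where open Cubic commutativeRing W

  record Point (W : Weierstrass commutativeRing) : Set (c ⊔ ℓ) where
    constructor mkPoint
    field
      coords  : Triple
      nonZero : NonZero coords
      onCurve : OnCurve W coords
  open Point public

  infix 4 _≈ᴾ_
  _≈ᴾ_ : ∀ {W} → Point W → Point W → Set (c ⊔ ℓ)
  P ≈ᴾ Q = coords P ∼ coords Q

  private
    module S = SemiringSolver commutativeSemiring
  open Relation.Binary.Reasoning.Setoid setoid

  ∼-refl : ∀ {u} → u ∼ u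
  ∼-refl = 1# , 1≉0 , sym (*-identityˡ _) , sym (*-identityˡ _) , sym (*-identityˡ _)

  ∼-trans : ∀ {u v w} → u ∼ v → v ∼ w → u ∼ w
  ∼-trans (k , k≉0 , e₁ , e₂ , e₃) (l , l≉0 , f₁ , f₂ , f₃) =
    k * l , (λ kl≈0 → l≉0 (cancel k l 0# k≉0 (trans kl≈0 (sym (zeroʳ k))))) ,
    step e₁ f₁ , step e₂ f₂ , step e₃ f₃
    where
    step : ∀ {x y z} → x ≈ k * y → y ≈ l * z → x ≈ (k * l) * z
    step e f = trans e (trans (*-congˡ f) (sym (*-assoc k l _)))

  ∼-sym : ∀ {u v} → u ∼ v → v ∼ u
  ∼-sym (k , k≉0 , e₁ , e₂ , e₃) with k⁻¹ , kk⁻¹≈1 ← invertible k k≉0 =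
    k⁻¹ , (λ k⁻¹≈0 → 1≉0 (trans (sym kk⁻¹≈1) (trans (*-congˡ k⁻¹≈0) (zeroʳ k)))) ,
    step e₁ , step e₂ , step e₃
    where
    step : ∀ {x y} → x ≈ k * y → y ≈ k⁻¹ * x
    step {x} {y} e = begin
      y               ≈⟨ *-identityˡ y ⟨
      1# * y          ≈⟨ *-congʳ kk⁻¹≈1 ⟨
      (k * k⁻¹) * y   ≈⟨ *-congʳ (*-comm k k⁻¹) ⟩
      (k⁻¹ * k) * y   ≈⟨ *-assoc k⁻¹ k y ⟩
      k⁻¹ * (k * y)   ≈⟨ *-congˡ e ⟨
      k⁻¹ * x         ∎

  ∼-nonZero : ∀ {u v} → u ∼ v → NonZero v → NonZero u
  ∼-nonZero (k , k≉0 , e₁ , e₂ , e₃) v≉0 (x≈0 , y≈0 , z≈0) =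
    v≉0 (step e₁ x≈0 , step e₂ y≈0 , step e₃ z≈0)
    where
    step : ∀ {x y} → x ≈ k * y → x ≈ 0# → y ≈ 0#
    step {x} {y} e x≈0 = cancel k y 0# k≉0 (trans (sym e) (trans x≈0 (sym (zeroʳ k))))

  ∼⇒cross : ∀ k x y x′ y′ → x ≈ k * x′ → y ≈ k * y′ → x * y′ ≈ y * x′
  ∼⇒cross k x y x′ y′ e f = begin
    x * y′          ≈⟨ *-congʳ e ⟩
    (k * x′) * y′   ≈⟨ S.solve 3 (λ k x y → (k S.:* x) S.:* y S.:= (k S.:* y) S.:* x) refl k x′ y′ ⟩
    (k * y′) * x′   ≈⟨ *-congʳ f ⟨
    y * x′          ∎

  ∼-pivot : ∀ a {a′ x y z x′ y′ z′} → ¬ a′ ≈ 0# → NonZero (x , y , z) →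
            x * a′ ≈ a * x′ → y * a′ ≈ a * y′ → z * a′ ≈ a * z′ →
            (x , y , z) ∼ (x′ , y′ , z′)
  ∼-pivot a {a′} a′≉0 u≉0 ex ey ez with a″ , a′a″≈1 ← invertible a′ a′≉0 =
    a * a″ , (λ k≈0 → u≉0 (vanish k≈0 ex , vanish k≈0 ey , vanish k≈0 ez)) ,
    step ex , step ey , step ez
    where
    step : ∀ {w w′} → w * a′ ≈ a * w′ → w ≈ (a * a″) * w′
    step {w} {w′} e = begin
      w                 ≈⟨ *-identityʳ w ⟨
      w * 1#            ≈⟨ *-congˡ a′a″≈1 ⟨
      w * (a′ * a″)     ≈⟨ *-assoc w a′ a″ ⟨
      (w * a′) * a″     ≈⟨ *-congʳ e ⟩
      (a * w′) * a″     ≈⟨ S.solve 3 (λ a b c → (a S.:* b) S.:* c S.:= (a S.:* c) S.:* b) refl a w′ a″ ⟩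
      (a * a″) * w′     ∎
    vanish : a * a″ ≈ 0# → ∀ {w w′} → w * a′ ≈ a * w′ → w ≈ 0#
    vanish k≈0 {w} {w′} e = trans (step e) (trans (*-congʳ k≈0) (zeroˡ w′))

  cross⇒∼ : ∀ {x y z x′ y′ z′} → NonZero (x , y , z) → NonZero (x′ , y′ , z′) →
            x * y′ ≈ y * x′ → x * z′ ≈ z * x′ → y * z′ ≈ z * y′ →
            (x , y , z) ∼ (x′ , y′ , z′)
  cross⇒∼ {x} {y} {z} {x′} {y′} {z′} u≉0 v≉0 xy xz yz with x′ ≟ 0# | y′ ≟ 0# | z′ ≟ 0#
  ... | no x′≉0  | _        | _        = ∼-pivot x x′≉0 u≉0 refl (sym xy) (sym xz)
  ... | yes _    | no y′≉0  | _        = ∼-pivot y y′≉0 u≉0 xy refl (sym yz)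
  ... | yes _    | yes _    | no z′≉0  = ∼-pivot z z′≉0 u≉0 xz yz refl
  ... | yes x′≈0 | yes y′≈0 | yes z′≈0 = ⊥-elim (v≉0 (x′≈0 , y′≈0 , z′≈0))

  ∼-onCurve : ∀ W {u v} → u ∼ v → OnCurve W v → OnCurve W u
  ∼-onCurve W {x , y , z} {x′ , y′ , z′} (k , _ , ex , ey , ez) h = begin
    lhs x y z
      ≈⟨ +-cong (+-cong (*-cong (*-cong ey ey) ez) (*-congˡ (*-cong (*-cong ex ey) ez)))
                (*-congˡ (*-cong (*-cong ey ez) ez)) ⟩
    lhs (k * x′) (k * y′) (k * z′)
      ≈⟨ S.solve 6 (λ k x y z a₁ a₃ →
           (k :* y) :* (k :* y) :* (k :* z) :+ a₁ :* ((k :* x) :* (k :* y) :* (k :* z))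
             :+ a₃ :* ((k :* y) :* (k :* z) :* (k :* z))
           := (k :* k :* k) :* (y :* y :* z :+ a₁ :* (x :* y :* z) :+ a₃ :* (y :* z :* z)))
           refl k x′ y′ z′ a₁ a₃ ⟩
    (k * k * k) * lhs x′ y′ z′
      ≈⟨ *-congˡ h ⟩
    (k * k * k) * rhs x′ y′ z′
      ≈⟨ S.solve 6 (λ k x z a₂ a₄ a₆ →
           (k :* k :* k) :* (x :* x :* x :+ a₂ :* (x :* x :* z) :+ a₄ :* (x :* z :* z)
             :+ a₆ :* (z :* z :* z))
           := (k :* x) :* (k :* x) :* (k :* x) :+ a₂ :* ((k :* x) :* (k :* x) :* (k :* z))
             :+ a₄ :* ((k :* x) :* (k :* z) :* (k :* z))
             :+ a₆ :* ((k :* z) :* (k :* z) :* (k :* z)))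
           refl k x′ z′ a₂ a₄ a₆ ⟩
    rhs (k * x′) (k * y′) (k * z′)
      ≈⟨ +-cong (+-cong (+-cong (*-cong (*-cong ex ex) ex) (*-congˡ (*-cong (*-cong ex ex) ez)))
                        (*-congˡ (*-cong (*-cong ex ez) ez)))
                (*-congˡ (*-cong (*-cong ez ez) ez)) ⟨
    rhs x y z ∎
    where
    open Cubic commutativeRing W
    open Weierstrass W
    open S using (_:=_; _:+_; _:*_)

module _ {c ℓ c′ ℓ′} (A : CommutativeRing c ℓ) (B : CommutativeRing c′ ℓ′)
         {f : CommutativeRing.Carrier A → CommutativeRing.Carrier B}
         (f-hom : IsRingHomomorphism (CommutativeRing.rawRing A) (CommutativeRing.rawRing B) f)
         (W : Weierstrass A) where
  private
    module A = CommutativeRing A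
    module C = Cubic A W
    module C′ = Cubic B (mapWeierstrass A B f W)
  open CommutativeRing B
  open IsRingHomomorphism f-hom

  private
    **-homo : ∀ x y z → f (x A.* y A.* z) ≈ f x * f y * f z
    **-homo x y z = trans (*-homo _ z) (*-congʳ (*-homo x y))

    term : ∀ a x y z → f (a A.* (x A.* y A.* z)) ≈ f a * (f x * f y * f z)
    term a x y z = trans (*-homo a _) (*-congˡ (**-homo x y z))

  lhs-homo : ∀ x y z → f (C.lhs x y z) ≈ C′.lhs (f x) (f y) (f z)
  lhs-homo x y z =
    trans (+-homo _ _) (+-cong (trans (+-homo _ _) (+-cong (**-homo y y z) (term _ x y z)))
                               (term _ y z z))

  rhs-homo : ∀ x y z → f (C.rhs x y z) ≈ C′.rhs (f x) (f y) (f z)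
  rhs-homo x y z =
    trans (+-homo _ _) (+-cong (trans (+-homo _ _) (+-cong
      (trans (+-homo _ _) (+-cong (**-homo x x x) (term _ x x z))) (term _ x z z))) (term _ z z z))

module FunctionField {c ℓ} (K : Field c ℓ) where
  open Field K
  open Polynomial commutativeRing
  open Fractions (polynomialDomain K)

  private
    module K = Field K
    module K[t] = CommutativeRing polynomialRing

  K[t] : CommutativeRing c ℓ
  K[t] = polynomialRing

  K⟨t⟩ : Field (c ⊔ ℓ) ℓ
  K⟨t⟩ = fractionField

  private module K⟨t⟩ = Field K⟨t⟩

  overK⟨t⟩ : Weierstrass K[t] → Weierstrass K⟨t⟩.commutativeRing
  overK⟨t⟩ = mapWeierstrass K[t] K⟨t⟩.commutativeRing fromDomain

  specialize : Carrier → Weierstrass K[t] → Weierstrass commutativeRing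
  specialize t₀ = mapWeierstrass K[t] commutativeRing (eval t₀)

  constantCurve : Weierstrass commutativeRing → Weierstrass K⟨t⟩.commutativeRing
  constantCurve = mapWeierstrass commutativeRing K⟨t⟩.commutativeRing (fromDomain ∘ const)

  Nonconstant : Weierstrass K⟨t⟩.commutativeRing → Set (c ⊔ ℓ)
  Nonconstant W = ¬ (∃ λ W₀ → IsElliptic K W₀ × _≅_ K⟨t⟩ W (constantCurve W₀))

  PolyTriple : Set c
  PolyTriple = Poly × Poly × Poly

  toK⟨t⟩ : PolyTriple → Triple K⟨t⟩
  toK⟨t⟩ (x , y , z) = fromDomain x , fromDomain y , fromDomain z

  at : Carrier → PolyTriple → Triple K
  at t₀ (x , y , z) = eval t₀ x , eval t₀ y , eval t₀ z

  private
    clearDenominators : ∀ v → ∃ λ p → _∼_ K⟨t⟩ (toK⟨t⟩ p) v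
    clearDenominators (x , y , z) =
      (num x ⊛ (den y ⊛ den z) , num y ⊛ (den x ⊛ den z) , num z ⊛ (den x ⊛ den y)) ,
      fromDomain d ,
      (λ e → *-nonzero (den≉0 x) (*-nonzero (den≉0 y) (den≉0 z)) (fromDomain-injective e)) ,
      mk≃ (solve 4 (λ a b c d → (a :* (c :* d)) :* (con 1 :* b) := ((b :* (c :* d)) :* a) :* con 1)
             K[t].refl (num x) (den x) (den y) (den z)) ,
      mk≃ (solve 4 (λ a b c d → (a :* (b :* d)) :* (con 1 :* c) := ((b :* (c :* d)) :* a) :* con 1)
             K[t].refl (num y) (den x) (den y) (den z)) ,
      mk≃ (solve 4 (λ a b c d → (a :* (b :* c)) :* (con 1 :* d) := ((b :* (c :* d)) :* a) :* con 1)
             K[t].refl (num z) (den x) (den y) (den z))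
      where
      d = den x ⊛ (den y ⊛ den z)
      open SemiringSolver K[t].commutativeSemiring

    Bounded : ℕ → PolyTriple → Set
    Bounded n (x , y , z) = length x ℕ.≤ n × length y ℕ.≤ n × length z ℕ.≤ n

    divideOut : Carrier → PolyTriple → PolyTriple
    divideOut t₀ (x , y , z) = quotient t₀ x , quotient t₀ y , quotient t₀ z

    divideOut-bounded : ∀ t₀ n p → Bounded (suc n) p → Bounded n (divideOut t₀ p)
    divideOut-bounded t₀ n (x , y , z) (bx , by , bz) = shorter x bx , shorter y by , shorter z bz
      where
      shorter : ∀ w → length w ℕ.≤ suc n → length (quotient t₀ w) ℕ.≤ n
      shorter w b = ≡.subst (ℕ._≤ n) (≡.sym (length-quotient t₀ w)) (ℕ.∸-monoˡ-≤ 1 b)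

    Vanishes : Carrier → Pred PolyTriple ℓ
    Vanishes t₀ (x , y , z) = eval t₀ x ≈ 0# × eval t₀ y ≈ 0# × eval t₀ z ≈ 0#

    vanishes? : ∀ t₀ p → Dec (Vanishes t₀ p)
    vanishes? t₀ (x , y , z) =
      (eval t₀ x ≟ 0#) Dec.×-dec (eval t₀ y ≟ 0#) Dec.×-dec (eval t₀ z ≟ 0#)

    divideOut-∼ : ∀ t₀ p → Vanishes t₀ p → _∼_ K⟨t⟩ (toK⟨t⟩ (divideOut t₀ p)) (toK⟨t⟩ p)
    divideOut-∼ t₀ p@(x , y , z) (x₀ , y₀ , z₀) =
      ∼-sym K⟨t⟩ {toK⟨t⟩ p} {toK⟨t⟩ (divideOut t₀ p)}
        ( fromDomain (linear t₀) , (λ e → 1≉0 (coeff≈ (fromDomain-injective e) 1))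
        , scaled x x₀ , scaled y y₀ , scaled z z₀ )
      where
      scaled : ∀ w → eval t₀ w ≈ 0# →
               fromDomain w ≃ (fromDomain (linear t₀) ⊠ fromDomain (quotient t₀ w))
      scaled w w₀ = ≃-trans (fromDomain-cong (root⇒factor t₀ w w₀))
                            (fromDomain-⊠ (linear t₀) (quotient t₀ w))

    bounded-zero : ∀ p → Bounded 0 p → ¬ NonZero K⟨t⟩ (toK⟨t⟩ p)
    bounded-zero ([] , [] , []) _ p≉0 = p≉0 (≃-refl , ≃-refl , ≃-refl)

    -- The first argument bounds the number of coefficients of each coordinate.
    removeRoots : ∀ n t₀ p → Bounded n p → NonZero K⟨t⟩ (toK⟨t⟩ p) →
                  ∃ λ q → _∼_ K⟨t⟩ (toK⟨t⟩ q) (toK⟨t⟩ p) × NonZero K (at t₀ q)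
    removeRoots zero    t₀ p b p≉0 = ⊥-elim (bounded-zero p b p≉0)
    removeRoots (suc n) t₀ p b p≉0 with vanishes? t₀ p
    ... | no  p₀≉0 = p , ∼-refl K⟨t⟩ , p₀≉0
    ... | yes p₀≈0 =
      let p′   = divideOut t₀ p
          p′∼p = divideOut-∼ t₀ p p₀≈0
          q , q∼p′ , q₀≉0 = removeRoots n t₀ p′ (divideOut-bounded t₀ n p b)
            (∼-nonZero K⟨t⟩ {toK⟨t⟩ p′} {toK⟨t⟩ p} p′∼p p≉0)
      in q , ∼-trans K⟨t⟩ {toK⟨t⟩ q} {toK⟨t⟩ p′} {toK⟨t⟩ p} q∼p′ p′∼p , q₀≉0

  -- A point of the projective plane over K(t) has polynomial homogeneous
  -- coordinates that do not all vanish at t₀.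
  regularCoordinates : ∀ t₀ v → NonZero K⟨t⟩ v →
              ∃ λ p → _∼_ K⟨t⟩ (toK⟨t⟩ p) v × NonZero K (at t₀ p)
  regularCoordinates t₀ v v≉0 =
    let p@(x , y , z) , p∼v = clearDenominators v
        q , q∼p , q₀≉0 = removeRoots (length x ℕ.+ (length y ℕ.+ length z)) t₀ p
          ( ℕ.m≤m+n _ _
          , ℕ.≤-trans (ℕ.m≤m+n _ _) (ℕ.m≤n+m _ (length x))
          , ℕ.≤-trans (ℕ.m≤n+m _ (length y)) (ℕ.m≤n+m _ (length x)) )
          (∼-nonZero K⟨t⟩ {toK⟨t⟩ p} {v} p∼v v≉0)
    in q , ∼-trans K⟨t⟩ {toK⟨t⟩ q} {toK⟨t⟩ p} {v} q∼p p∼v , q₀≉0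

  -- Evaluation at t₀ does not depend on the choice of such coordinates.
  at-cong : ∀ t₀ p q → _∼_ K⟨t⟩ (toK⟨t⟩ p) (toK⟨t⟩ q) →
            NonZero K (at t₀ p) → NonZero K (at t₀ q) → _∼_ K (at t₀ p) (at t₀ q)
  at-cong t₀ p@(x , y , z) q@(x′ , y′ , z′) (k , _ , ex , ey , ez) p₀≉0 q₀≉0 =
    cross⇒∼ K p₀≉0 q₀≉0
      (evaluate x y′ y x′ (∼⇒cross K⟨t⟩ k (fromDomain x) (fromDomain y) (fromDomain x′) (fromDomain y′) ex ey))
      (evaluate x z′ z x′ (∼⇒cross K⟨t⟩ k (fromDomain x) (fromDomain z) (fromDomain x′) (fromDomain z′) ex ez))
      (evaluate y z′ z y′ (∼⇒cross K⟨t⟩ k (fromDomain y) (fromDomain z) (fromDomain y′) (fromDomain z′) ey ez))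
    where
    evaluate : ∀ a b c d → (fromDomain a ⊠ fromDomain b) ≃ (fromDomain c ⊠ fromDomain d) →
               eval t₀ a * eval t₀ b ≈ eval t₀ c * eval t₀ d
    evaluate a b c d e =
      trans (sym (eval-⊛ t₀ a b))
      (trans (eval-cong t₀ (fromDomain-injective
               (≃-trans (fromDomain-⊠ a b) (≃-trans e (≃-sym (fromDomain-⊠ c d))))))
             (eval-⊛ t₀ c d))

  module _ (E : Weierstrass K[t]) (t₀ : Carrier) where

    private
      Eₜ = overK⟨t⟩ E
      E₀ = specialize t₀ E

    at-onCurve : ∀ p → OnCurve K⟨t⟩ Eₜ (toK⟨t⟩ p) → OnCurve K E₀ (at t₀ p)
    at-onCurve (x , y , z) h =
      trans (sym (lhs-homo K[t] commutativeRing (eval-isRingHomomorphism t₀) E x y z))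
      (trans (eval-cong t₀ (fromDomain-injective lhs≃rhs))
             (rhs-homo K[t] commutativeRing (eval-isRingHomomorphism t₀) E x y z))
      where
      open Cubic K[t] E
      lhs≃rhs : fromDomain (lhs x y z) ≃ fromDomain (rhs x y z)
      lhs≃rhs =
        ≃-trans (lhs-homo K[t] K⟨t⟩.commutativeRing fromDomain-isRingHomomorphism E x y z)
        (≃-trans h (≃-sym (rhs-homo K[t] K⟨t⟩.commutativeRing fromDomain-isRingHomomorphism E x y z)))

    -- The specialization map: evaluate at t₀ polynomial coordinates that do not
    -- all vanish there.
    σ : Point K⟨t⟩ Eₜ → Point K E₀
    σ (mkPoint v v≉0 v∈E) =
      let p , p∼v , p≉0 = regularCoordinates t₀ v v≉0
      in mkPoint (at t₀ p) p≉0 (at-onCurve p (∼-onCurve K⟨t⟩ Eₜ {toK⟨t⟩ p} {v} p∼v v∈E))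

    σ-cong : ∀ P Q → _≈ᴾ_ K⟨t⟩ {Eₜ} P Q → _≈ᴾ_ K {E₀} (σ P) (σ Q)
    σ-cong (mkPoint u u≉0 _) (mkPoint v v≉0 _) u∼v =
      let p , p∼u , p₀≉0 = regularCoordinates t₀ u u≉0
          q , q∼v , q₀≉0 = regularCoordinates t₀ v v≉0
      in at-cong t₀ p q
           (∼-trans K⟨t⟩ {toK⟨t⟩ p} {u} {toK⟨t⟩ q} p∼u
             (∼-trans K⟨t⟩ {u} {v} {toK⟨t⟩ q} u∼v (∼-sym K⟨t⟩ {toK⟨t⟩ q} {v} q∼v)))
           p₀≉0 q₀≉0

record NumberField c ℓ : Set (Level.suc (c ⊔ ℓ)) where
  field
    asField : Field c ℓ
  open Field asField public
  open Algebra.Definitions.RawMonoid +-rawMonoid using (sum)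
  field
    fromℚ       : ℚ → Carrier
    fromℚ-hom   : IsRingHomomorphism ℚ.+-*-rawRing rawRing fromℚ
    degree      : ℕ
    basis       : Fin degree → Carrier
    spanning    : ∀ x → ∃ λ (q : Fin degree → ℚ) → x ≈ sum (λ i → fromℚ (q i) * basis i)
    independent : ∀ (q : Fin degree → ℚ) → sum (λ i → fromℚ (q i) * basis i) ≈ 0# → ∀ i → q i ≡ 0ℚ

  open Polynomial commutativeRing using (eval)

  fromℤ : ℤ → Carrier
  fromℤ n = fromℚ (n ℚ./ 1)

  -- x is a root of a monic polynomial whose lower coefficients are cs.
  IsIntegral : Pred Carrier ℓ
  IsIntegral x = ∃ λ (cs : List ℤ) → eval x (map fromℤ cs ++ 1# ∷ []) ≈ 0#

record Subring {c ℓ} (A : CommutativeRing c ℓ) p : Set (c ⊔ ℓ ⊔ Level.suc p) where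
  open CommutativeRing A
  field
    member   : Pred Carrier p
    ≈-closed : ∀ {x y} → x ≈ y → member x → member y
    0-closed : member 0#
    1-closed : member 1#
    +-closed : ∀ {x y} → member x → member y → member (x + y)
    *-closed : ∀ {x y} → member x → member y → member (x * y)
    -‿closed : ∀ {x} → member x → member (- x)

  subringRaw : RawRing (c ⊔ p) ℓ
  subringRaw = record
    { Carrier = Σ Carrier member
    ; _≈_ = λ x y → proj₁ x ≈ proj₁ y
    ; _+_ = λ x y → proj₁ x + proj₁ y , +-closed (proj₂ x) (proj₂ y)
    ; _*_ = λ x y → proj₁ x * proj₁ y , *-closed (proj₂ x) (proj₂ y)
    ; -_  = λ x → - proj₁ x , -‿closed (proj₂ x)
    ; 0#  = 0# , 0-closed
    ; 1#  = 1# , 1-closed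
    }

  inclusion-isRingMonomorphism : IsRingMonomorphism subringRaw rawRing proj₁
  inclusion-isRingMonomorphism = record
    { isRingHomomorphism = record
      { isSemiringHomomorphism = record
        { isNearSemiringHomomorphism = record
          { +-isMonoidHomomorphism = record
            { isMagmaHomomorphism = record
              { isRelHomomorphism = record { cong = id }
              ; homo = λ _ _ → refl
              }
            ; ε-homo = refl
            }
          ; *-homo = λ _ _ → refl
          }
        ; 1#-homo = refl
        }
      ; -‿homo = λ _ → refl
      }
    ; injective = id
    }

  toRing : CommutativeRing (c ⊔ p) ℓ
  toRing = record
    { RawRing subringRaw
    ; isCommutativeRing = Algebra.Morphism.RingMonomorphism.isCommutativeRing
                            inclusion-isRingMonomorphism isCommutativeRing
    }

  inclusion : CommutativeRing.Carrier toRing → Carrier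
  inclusion = proj₁

module Setting {c ℓ p} (K : NumberField c ℓ) (R : Subring (NumberField.commutativeRing K) p) where
  open NumberField K using (asField; commutativeRing; Carrier; IsIntegral)

  ringOfIntegers⊆R : Set (c ⊔ ℓ ⊔ p)
  ringOfIntegers⊆R = ∀ x → IsIntegral x → Subring.member R x

  ringR : CommutativeRing (c ⊔ p) ℓ
  ringR = Subring.toRing R

  R[t] : CommutativeRing (c ⊔ p) ℓ
  R[t] = Polynomial.polynomialRing ringR

  module K = NumberField K
  module R[t] = CommutativeRing R[t]
  open FunctionField asField public using (K[t]; K⟨t⟩; Nonconstant; overK⟨t⟩; specialize; σ)

  toK[t] : R[t].Carrier → CommutativeRing.Carrier K[t]
  toK[t] = map (Subring.inclusion R)

  _⟦_⟧ : R[t].Carrier → Carrier → Carrier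
  h ⟦ t₀ ⟧ = Polynomial.eval commutativeRing t₀ (toK[t] h)

  curve : (e₁ e₂ e₃ : R[t].Carrier) → Weierstrass K[t]
  curve e₁ e₂ e₃ = mapWeierstrass R[t] K[t] toK[t] (fromRoots R[t] e₁ e₂ e₃)

module Submission where

-- If σ P = σ Q with P ≠ Q, then P - Q (or a translate of P by a 2-torsion point)
-- is a point (X / Z² , Y / Z³) over R[t] with Z ≠ 0, Z(t₀) = 0 and X(t₀) ≠ 0.  If X
-- and Z are coprime, the squarefree part of X - eᵢ Z² divides (eᵢ - eⱼ)(eᵢ - eₖ) and
-- takes a square value at t₀, hence is a constant square by hypothesis: every
-- X - eᵢ Z² is a square aᵢ², and the point is twice the point over the same Z with
-- X′ - eᵢ Z² = (aᵢ + aⱼ)(aᵢ + aₖ).  When halving repeatedly, either a common prime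
-- factor of X and Z can be removed, or aᵢ + aⱼ divides eⱼ - eᵢ.  There are finitely
-- many such divisors up to units, and they determine X(t₀); but X(t₀) is multiplied
-- by 4 at every halving.
--
-- Divisibility in R need not be decidable, so existence statements are doubly negated;
-- this is harmless because equality in K(t) is decidable.

open import Defs
open import Algebra.Bundles using (AbelianGroup; CommutativeRing; RawRing)
import Algebra.Definitions.RawMagma
import Algebra.Definitions.RawMonoid
import Algebra.Morphism.Construct.Composition as Composition
open import Algebra.Morphism.Structures using (IsRingHomomorphism)
import Algebra.Properties.AbelianGroup
import Algebra.Properties.CommutativeMonoid.Sum
import Algebra.Properties.Group
import Algebra.Properties.Monoid.Mult
import Algebra.Properties.Ring
import Algebra.Properties.Semiring.Mult.TCOptimised
import Algebra.Properties.Semiring.Sum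
import Algebra.Solver.Ring
open import Algebra.Solver.Ring.AlmostCommutativeRing using (fromCommutativeRing; _-Raw-AlmostCommutative⟶_)
open import Data.Empty using (⊥-elim)
open import Data.Fin.Base using (Fin; toℕ; fromℕ<)
import Data.Fin.Properties as Fin
open import Data.Integer.Base as ℤ using (ℤ; +_; -[1+_])
import Data.Integer.Properties as ℤ
open import Data.List.Base using (List; []; _∷_; _++_; cartesianProduct; length; map; replicate)
import Data.List.Properties as List
open import Data.List.Relation.Binary.Permutation.Homogeneous as Permutation using (Permutation)
open import Data.List.Relation.Binary.Pointwise.Base using (Pointwise; []; _∷_)
open import Data.List.Relation.Unary.All as All using (All; []; _∷_)
import Data.List.Relation.Unary.All.Properties as All
open import Data.List.Relation.Unary.Any as Any using (Any; here; there)
import Data.List.Relation.Unary.Any.Properties as Any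
open import Data.Maybe.Base as Maybe using (Maybe)
open import Data.Nat.Base as ℕ using (ℕ; zero; suc)
import Data.Nat.Properties as ℕ
open import Data.Product.Base using (∃; ∃₂; _×_; _,_; proj₁; proj₂)
open import Data.Rational.Base as ℚ using (ℚ; 0ℚ; 1ℚ; toℚᵘ; ↥_; ↧_)
import Data.Rational.Properties as ℚ
import Data.Rational.Unnormalised.Base as ℚᵘ
import Data.Rational.Unnormalised.Properties as ℚᵘ
open import Data.Sum.Base as Sum using (_⊎_; inj₁; inj₂)
open import Function.Base using (id)
open import Function.Definitions using (Injective)
open import Level using (_⊔_)
open import Relation.Binary.Consequences using (dec⇒weaklyDec)
open import Relation.Binary.Definitions using (tri<; tri≈; tri>)
open import Relation.Binary.PropositionalEquality using (_≡_; _≢_)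
import Relation.Binary.PropositionalEquality as ≡
import Relation.Binary.Reasoning.Setoid
open import Relation.Nullary using (¬_; Dec; yes; no)
import Relation.Nullary.Decidable as Dec
open import Relation.Nullary.Decidable using (¬¬-excluded-middle; decidable-stable)

-- The square value comes from Z(t₀) = 0: all three factors X - eᵢ Z² then take the value X(t₀), and
-- Y(t₀)² = X(t₀)³ makes X(t₀) the square of Y(t₀) / X(t₀). The obstacle is to stop the halving.
-- Usually heights or finite generation of the group exclude a point that is divisible by every
-- power of 2. Here divisibility does: (aᵢ + aⱼ)(aᵢ - aⱼ) = (eⱼ - eᵢ) Z², and a prime common to aᵢ +
-- aⱼ and Z would also divide the halved X. The signs of the aᵢ are chosen so that all three take
-- one value α at t₀; the sums then take the value 2α, and the halved X takes (2α)², hence the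
-- factor 4. A prime π common to X and Z is removed by passing to (X / π², Y / π³, Z / π), so
-- induction on the number of primes of Z reduces to the case where no point over the same Z has
-- such a prime; Z can then stay fixed through all halvings. No group law is set up: halving,
-- translation and subtraction occur only as explicit triples X, Y, Z that are verified by
-- polynomial identities.

-- A ring solver with integer coefficients

module IntegerSolver {c ℓ} (A : CommutativeRing c ℓ) where
  open CommutativeRing A
  open Algebra.Properties.Ring ring using (-‿distribˡ-*; -‿distribʳ-*; -0#≈0#; -‿involutive)
  open Algebra.Properties.AbelianGroup +-abelianGroup using (⁻¹-∙-comm)
  open Algebra.Properties.Semiring.Mult.TCOptimised semiring using (×-homo-+; ×1-homo-*; 1+×) renaming (_×_ to _·_)
  open Relation.Binary.Reasoning.Setoid setoid

  private
    -- Coefficients are integers, compared by `ℤ._≟_`, so that terms such as `x - x` cancel over any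
    -- commutative ring.
    ⟦_⟧ : ℤ → Carrier
    ⟦ + n ⟧      = n · 1#
    ⟦ -[1+ n ] ⟧ = - (suc n · 1#)

    ⊖-homo : ∀ m n → ⟦ m ℤ.⊖ n ⟧ ≈ m · 1# - n · 1#
    ⊖-homo m       zero    = sym (trans (+-congˡ -0#≈0#) (+-identityʳ _))
    ⊖-homo zero    (suc n) = sym (+-identityˡ _)
    ⊖-homo (suc m) (suc n) = begin
      ⟦ suc m ℤ.⊖ suc n ⟧                ≡⟨ ≡.cong ⟦_⟧ (ℤ.[1+m]⊖[1+n]≡m⊖n m n) ⟩
      ⟦ m ℤ.⊖ n ⟧                        ≈⟨ ⊖-homo m n ⟩
      m · 1# - n · 1#                    ≈⟨ +-congʳ (+-identityʳ _) ⟨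
      (m · 1# + 0#) - n · 1#             ≈⟨ +-congʳ (+-congˡ (-‿inverseʳ 1#)) ⟨
      (m · 1# + (1# - 1#)) - n · 1#      ≈⟨ +-congʳ (+-assoc _ _ _) ⟨
      ((m · 1# + 1#) - 1#) - n · 1#      ≈⟨ +-assoc _ _ _ ⟩
      (m · 1# + 1#) + (- 1# - n · 1#)    ≈⟨ +-cong (+-comm _ _) (⁻¹-∙-comm _ _) ⟩
      (1# + m · 1#) - (1# + n · 1#)      ≈⟨ +-cong (1+× m 1#) (-‿cong (1+× n 1#)) ⟨
      suc m · 1# - suc n · 1#            ∎

    +-homo : ∀ i j → ⟦ i ℤ.+ j ⟧ ≈ ⟦ i ⟧ + ⟦ j ⟧
    +-homo (+ m)      (+ n)      = ×-homo-+ 1# m n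
    +-homo (+ m)      (-[1+ n ]) = ⊖-homo m (suc n)
    +-homo (-[1+ m ]) (+ n)      = trans (⊖-homo n (suc m)) (+-comm _ _)
    +-homo (-[1+ m ]) (-[1+ n ]) = begin
      - (suc (suc (m ℕ.+ n)) · 1#)        ≡⟨ ≡.cong (λ k → - (k · 1#)) (≡.sym (≡.cong suc (ℕ.+-suc m n))) ⟩
      - ((suc m ℕ.+ suc n) · 1#)          ≈⟨ -‿cong (×-homo-+ 1# (suc m) (suc n)) ⟩
      - (suc m · 1# + suc n · 1#)         ≈⟨ ⁻¹-∙-comm _ _ ⟨
      - (suc m · 1#) - suc n · 1#         ∎

    -‿homo : ∀ i → ⟦ ℤ.- i ⟧ ≈ - ⟦ i ⟧
    -‿homo (+ zero)   = sym -0#≈0#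
    -‿homo (+ suc n)  = refl
    -‿homo (-[1+ n ]) = sym (-‿involutive _)

    *-homo⁺ : ∀ m j → ⟦ + m ℤ.* j ⟧ ≈ m · 1# * ⟦ j ⟧
    *-homo⁺ m (+ n)      = begin
      ⟦ + m ℤ.* + n ⟧    ≡⟨ ≡.cong ⟦_⟧ (ℤ.pos-* m n) ⟨
      (m ℕ.* n) · 1#     ≈⟨ ×1-homo-* m n ⟩
      m · 1# * n · 1#    ∎
    *-homo⁺ m (-[1+ n ]) = begin
      ⟦ + m ℤ.* ℤ.- (+ suc n) ⟧    ≡⟨ ≡.cong ⟦_⟧ (ℤ.neg-distribʳ-* (+ m) (+ suc n)) ⟨
      ⟦ ℤ.- (+ m ℤ.* + suc n) ⟧    ≈⟨ -‿homo (+ m ℤ.* + suc n) ⟩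
      - ⟦ + m ℤ.* + suc n ⟧        ≈⟨ -‿cong (*-homo⁺ m (+ suc n)) ⟩
      - (m · 1# * suc n · 1#)      ≈⟨ -‿distribʳ-* _ _ ⟩
      m · 1# * - (suc n · 1#)      ∎

    *-homo : ∀ i j → ⟦ i ℤ.* j ⟧ ≈ ⟦ i ⟧ * ⟦ j ⟧
    *-homo (+ m)      j = *-homo⁺ m j
    *-homo (-[1+ m ]) j = begin
      ⟦ ℤ.- (+ suc m) ℤ.* j ⟧    ≡⟨ ≡.cong ⟦_⟧ (ℤ.neg-distribˡ-* (+ suc m) j) ⟨
      ⟦ ℤ.- (+ suc m ℤ.* j) ⟧    ≈⟨ -‿homo (+ suc m ℤ.* j) ⟩
      - ⟦ + suc m ℤ.* j ⟧        ≈⟨ -‿cong (*-homo⁺ (suc m) j) ⟩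
      - (suc m · 1# * ⟦ j ⟧)     ≈⟨ -‿distribˡ-* _ _ ⟩
      - (suc m · 1#) * ⟦ j ⟧     ∎

    coefficients : ℤ.+-*-rawRing -Raw-AlmostCommutative⟶ fromCommutativeRing A
    coefficients = record
      { ⟦_⟧ = ⟦_⟧ ; +-homo = +-homo ; *-homo = *-homo ; -‿homo = -‿homo ; 0-homo = refl ; 1-homo = refl }

    ⟦⟧-reflexive : ∀ {i j} → i ≡ j → ⟦ i ⟧ ≈ ⟦ j ⟧
    ⟦⟧-reflexive ≡.refl = refl

  open Algebra.Solver.Ring ℤ.+-*-rawRing (fromCommutativeRing A) coefficients
    (λ i j → Maybe.map ⟦⟧-reflexive (dec⇒weaklyDec ℤ._≟_ i j)) public

-- The double negation monad

infixl 1 _>>=_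
_>>=_ : ∀ {a b} {A : Set a} {B : Set b} → ¬ ¬ A → (A → ¬ ¬ B) → ¬ ¬ B
(m >>= f) k = m λ a → f a k

pure : ∀ {a} {A : Set a} → A → ¬ ¬ A
pure a k = k a

-- Primes, square-free parts and divisors in an integral domain

module Factorization {c ℓ} (D : IntegralDomain c ℓ) where
  open IntegralDomain D
  open Divisibility commutativeRing using (_∣_; IsUnit; SquareFree) public
  open Algebra.Definitions.RawMagma *-rawMagma using (_,_)
  open Relation.Binary.Reasoning.Setoid setoid
  open IntegerSolver commutativeRing using (solve; _:=_; _:*_)

  divides : ∀ {x y} q → y ≈ x * q → x ∣ y
  divides q y≈xq = q , trans (*-comm q _) (sym y≈xq)

  cofactor : ∀ {x y} → x ∣ y → ∃ λ q → y ≈ x * q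
  cofactor (q , qx≈y) = q , trans (sym qx≈y) (*-comm q _)

  ∣-respʳ : ∀ {x y z} → y ≈ z → x ∣ y → x ∣ z
  ∣-respʳ y≈z (q , e) = q , trans e y≈z

  ∣-refl : ∀ {x} → x ∣ x
  ∣-refl = 1# , *-identityˡ _

  ∣-trans : ∀ {x y z} → x ∣ y → y ∣ z → x ∣ z
  ∣-trans (p , e) (q , f) = q * p , trans (*-assoc q p _) (trans (*-congˡ e) f)

  ∣-*ʳ : ∀ {x y} z → x ∣ y → x ∣ y * z
  ∣-*ʳ z x∣y = ∣-trans x∣y (divides z refl)

  ∣-*ˡ : ∀ {x y} z → x ∣ y → x ∣ z * y
  ∣-*ˡ z x∣y = ∣-trans x∣y (z , refl)

  ∣-+ : ∀ {x y z} → x ∣ y → x ∣ z → x ∣ y + z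
  ∣-+ (p , e) (q , f) = p + q , trans (distribʳ _ p q) (+-cong e f)

  ∣-‿ : ∀ {x y} → x ∣ y → x ∣ - y
  ∣-‿ (p , e) = - p , trans (sym (-‿distribˡ-* p _)) (-‿cong e)
    where open Algebra.Properties.Ring ring using (-‿distribˡ-*)

  ∣-- : ∀ {x y z} → x ∣ y → x ∣ z → x ∣ y - z
  ∣-- x∣y x∣z = ∣-+ x∣y (∣-‿ x∣z)

  *-cong-∣ : ∀ {w x y z} → w ∣ x → y ∣ z → w * y ∣ x * z
  *-cong-∣ {w} {y = y} (p , e) (q , f) = p * q ,
    trans (solve 4 (λ p q w y → (p :* q) :* (w :* y) := (p :* w) :* (q :* y)) refl p q w y)
          (*-cong e f)

  cancelʳ : ∀ {x y z} → ¬ z ≈ 0# → x * z ≈ y * z → x ≈ y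
  cancelʳ z≉0 e = cancel _ _ _ z≉0 (trans (*-comm _ _) (trans e (*-comm _ _)))

  *-nonzero : ∀ {x y} → ¬ x ≈ 0# → ¬ y ≈ 0# → ¬ x * y ≈ 0#
  *-nonzero x≉0 y≉0 xy≈0 = y≉0 (cancel _ _ _ x≉0 (trans xy≈0 (sym (zeroʳ _))))

  *-nonzeroˡ : ∀ {x y} → ¬ x * y ≈ 0# → ¬ x ≈ 0#
  *-nonzeroˡ xy≉0 x≈0 = xy≉0 (trans (*-congʳ x≈0) (zeroˡ _))

  *-nonzeroʳ : ∀ {x y} → ¬ x * y ≈ 0# → ¬ y ≈ 0#
  *-nonzeroʳ xy≉0 y≈0 = xy≉0 (trans (*-congˡ y≈0) (zeroʳ _))

  nonzero-resp : ∀ {x y} → x ≈ y → ¬ x ≈ 0# → ¬ y ≈ 0#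
  nonzero-resp x≈y x≉0 y≈0 = x≉0 (trans x≈y y≈0)

  unit-nonzero : ∀ {u} → IsUnit u → ¬ u ≈ 0#
  unit-nonzero (v , vu≈1) u≈0 = 1≉0 (trans (sym vu≈1) (trans (*-congˡ u≈0) (zeroʳ v)))

  unit-* : ∀ {u v} → IsUnit u → IsUnit v → IsUnit (u * v)
  unit-* u v = ∣-respʳ (*-identityˡ 1#) (*-cong-∣ u v)

  record Prime (π : Carrier) : Set (c ⊔ ℓ) where
    field
      nonzero : ¬ π ≈ 0#
      nonunit : ¬ IsUnit π
      split   : ∀ a b → π ∣ a * b → ¬ ¬ (π ∣ a ⊎ π ∣ b)
  open Prime public

  prime∣square : ∀ {π y} → Prime π → π ∣ y * y → ¬ ¬ π ∣ y
  prime∣square pπ d = split pπ _ _ d >>= λ { (inj₁ e) → pure e ; (inj₂ e) → pure e }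

  prime-cancel : ∀ {π a b} → Prime π → ¬ π ∣ a → π ∣ a * b → ¬ ¬ π ∣ b
  prime-cancel pπ π∤a d = split pπ _ _ d >>= λ { (inj₁ e) → ⊥-elim (π∤a e) ; (inj₂ e) → pure e }

  -- The index counts prime factors with multiplicity.
  data Factors : ℕ → Carrier → Set (c ⊔ ℓ) where
    unit  : ∀ {u} → IsUnit u → Factors 0 u
    prime : ∀ {n π a b} → Prime π → Factors n a → b ≈ π * a → Factors (suc n) b

  Factorial : Set (c ⊔ ℓ)
  Factorial = ∀ x → ¬ x ≈ 0# → ¬ ¬ ∃ λ n → Factors n x

  Factors-resp : ∀ {n x y} → x ≈ y → Factors n x → Factors n y
  Factors-resp x≈y (unit u)       = unit (∣-trans (∣-respʳ (sym x≈y) ∣-refl) u)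
  Factors-resp x≈y (prime pπ f e) = prime pπ f (trans (sym x≈y) e)

  Factors-nonzero : ∀ {n x} → Factors n x → ¬ x ≈ 0#
  Factors-nonzero (unit u)       = unit-nonzero u
  Factors-nonzero (prime pπ f e) = nonzero-resp (sym e) (*-nonzero (nonzero pπ) (Factors-nonzero f))

  Factors-* : ∀ {m n x y} → Factors m x → Factors n y → Factors (m ℕ.+ n) (x * y)
  Factors-* (unit u) (unit v) = unit (unit-* u v)
  Factors-* {x = x} (unit u) (prime {π = π} {a} pπ f e) =
    prime pπ (Factors-* (unit u) f)
      (trans (*-congˡ e) (solve 3 (λ x π a → x :* (π :* a) := π :* (x :* a)) refl x π a))
  Factors-* (prime pπ f e) g = prime pπ (Factors-* f g) (trans (*-congʳ e) (*-assoc _ _ _))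

  -- Whichever prime is cancelled, the count of factors drops by exactly one, so that it can serve
  -- as an induction measure. If π divides the first factor ρ, primality of ρ makes the two
  -- associated; otherwise π is cancelled from the remaining factors.
  cancel-prime : ∀ {n π a b} → Factors n b → Prime π → b ≈ π * a → ¬ ¬ ∃ λ m → n ≡ suc m × Factors m a
  cancel-prime (unit u) pπ e = ⊥-elim (nonunit pπ (∣-trans (divides _ e) u))
  cancel-prime {π = π} {a} (prime {n} {ρ} {a′} pρ f e′) pπ e =
    split pπ ρ a′ (divides a (trans (sym e′) e)) >>= λ
      { (inj₁ π∣ρ) → case₁ (cofactor π∣ρ)
      ; (inj₂ π∣a′) → case₂ (cofactor π∣a′)
      }
    where
    case₁ : (∃ λ u → ρ ≈ π * u) → ¬ ¬ ∃ λ m → suc n ≡ suc m × Factors m a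
    case₁ (u , ρ≈πu) = split pρ π u (divides 1# (trans (sym ρ≈πu) (sym (*-identityʳ ρ)))) >>= λ
      { (inj₁ (w , wρ≈π)) → pure (n , ≡.refl ,
          Factors-resp
            (cancel π _ _ (nonzero pπ) (trans (sym (*-assoc _ _ _)) (trans (*-congʳ (sym ρ≈πu)) (trans (sym e′) e))))
            (Factors-* (unit (w , cancel ρ _ _ (nonzero pρ) (begin
              ρ * (w * u)   ≈⟨ solve 3 (λ r w u → r :* (w :* u) := (w :* r) :* u) refl ρ w u ⟩
              (w * ρ) * u   ≈⟨ *-congʳ wρ≈π ⟩
              π * u         ≈⟨ ρ≈πu ⟨
              ρ             ≈⟨ *-identityʳ ρ ⟨
              ρ * 1#        ∎))) f))
      ; (inj₂ (w , wρ≈u)) → ⊥-elim (nonunit pπ (w , cancel ρ _ _ (nonzero pρ) (begin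
              ρ * (w * π)   ≈⟨ solve 3 (λ r w u → r :* (w :* u) := u :* (w :* r)) refl ρ w π ⟩
              π * (w * ρ)   ≈⟨ *-congˡ wρ≈u ⟩
              π * u         ≈⟨ ρ≈πu ⟨
              ρ             ≈⟨ *-identityʳ ρ ⟨
              ρ * 1#        ∎)))
      }
    case₂ : (∃ λ a″ → a′ ≈ π * a″) → ¬ ¬ ∃ λ m → suc n ≡ suc m × Factors m a
    case₂ (a″ , a′≈πa″) = cancel-prime f pπ a′≈πa″ >>= λ { (m , ≡.refl , g) → pure (suc m , ≡.refl , prime pρ g
      (cancel π _ _ (nonzero pπ) (begin
        π * a           ≈⟨ e ⟨
        _               ≈⟨ e′ ⟩
        ρ * a′          ≈⟨ *-congˡ a′≈πa″ ⟩
        ρ * (π * a″)    ≈⟨ solve 3 (λ r p a → r :* (p :* a) := p :* (r :* a)) refl ρ π a″ ⟩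
        π * (ρ * a″)    ∎))) }

  NoCommonPrime : Carrier → Carrier → Set (c ⊔ ℓ)
  NoCommonPrime x y = ∀ π → Prime π → π ∣ x → ¬ π ∣ y

  coprime-cancel : ∀ {n h z} k → Factors n h → NoCommonPrime h z → h ∣ k * z → ¬ ¬ h ∣ k
  coprime-cancel k (unit u) _ _ = pure (∣-trans u (k , *-identityʳ k))
  coprime-cancel {h = h} {z} k (prime {π = π} {a} pπ f h≈πa) coprime h∣kz = do
    π∣k ← prime-cancel pπ (coprime π pπ π∣h) (∣-respʳ (*-comm k z) (∣-trans π∣h h∣kz))
    let k′ , k≈πk′ = cofactor π∣k
        q , kz≈hq = cofactor h∣kz
    a∣k′ ← coprime-cancel k′ f (λ ρ pρ ρ∣a → coprime ρ pρ (∣-respʳ (sym h≈πa) (∣-*ˡ π ρ∣a)))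
             (divides q (cancel π _ _ (nonzero pπ) (begin
               π * (k′ * z)   ≈⟨ *-assoc _ _ _ ⟨
               (π * k′) * z   ≈⟨ *-congʳ k≈πk′ ⟨
               k * z          ≈⟨ kz≈hq ⟩
               h * q          ≈⟨ *-congʳ h≈πa ⟩
               (π * a) * q    ≈⟨ *-assoc _ _ _ ⟩
               π * (a * q)    ∎)))
    pure (∣-trans (∣-respʳ h≈πa ∣-refl) (∣-respʳ (sym k≈πk′) (*-cong-∣ ∣-refl a∣k′)))
    where
    π∣h : π ∣ h
    π∣h = divides a h≈πa

  -- Every prime of `g` divides y², hence `y`, and its square cancels from both sides.
  square∣square : ∀ {n g w y} → Factors n g → (g * g) * w ≈ y * y → ¬ ¬ ∃ λ y′ → y ≈ g * y′ × w ≈ y′ * y′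
  square∣square {g = g} {w} {y} (unit (v , vg≈1)) e = pure (v * y ,
    (begin
      y             ≈⟨ *-identityˡ y ⟨
      1# * y        ≈⟨ *-congʳ vg≈1 ⟨
      (v * g) * y   ≈⟨ solve 3 (λ v g y → (v :* g) :* y := g :* (v :* y)) refl v g y ⟩
      g * (v * y)   ∎) ,
    (begin
      w                               ≈⟨ *-identityˡ w ⟨
      1# * w                          ≈⟨ *-congʳ (*-identityˡ 1#) ⟨
      (1# * 1#) * w                   ≈⟨ *-congʳ (*-cong vg≈1 vg≈1) ⟨
      ((v * g) * (v * g)) * w         ≈⟨ solve 3 (λ v g w → ((v :* g) :* (v :* g)) :* w := (v :* v) :* ((g :* g) :* w)) refl v g w ⟩
      (v * v) * ((g * g) * w)         ≈⟨ *-congˡ e ⟩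
      (v * v) * (y * y)               ≈⟨ solve 2 (λ v y → (v :* v) :* (y :* y) := (v :* y) :* (v :* y)) refl v y ⟩
      (v * y) * (v * y)               ∎))
  square∣square {g = g} {w} {y} (prime {π = π} {a} pπ f g≈πa) e = do
    π∣y ← prime∣square pπ (∣-respʳ e (∣-*ʳ w (∣-*ʳ g (divides a g≈πa))))
    let y₁ , y≈πy₁ = cofactor π∣y
    y′ , y₁≈ay′ , w≈ ← square∣square f (cancel π _ _ (nonzero pπ) (cancel π _ _ (nonzero pπ) (begin
      π * (π * ((a * a) * w))     ≈⟨ solve 3 (λ p a w → p :* (p :* ((a :* a) :* w)) := ((p :* a) :* (p :* a)) :* w) refl π a w ⟩
      ((π * a) * (π * a)) * w     ≈⟨ *-congʳ (*-cong g≈πa g≈πa) ⟨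
      (g * g) * w                 ≈⟨ e ⟩
      y * y                       ≈⟨ *-cong y≈πy₁ y≈πy₁ ⟩
      (π * y₁) * (π * y₁)         ≈⟨ solve 2 (λ p y → (p :* y) :* (p :* y) := p :* (p :* (y :* y))) refl π y₁ ⟩
      π * (π * (y₁ * y₁))         ∎)))
    pure (y′ , trans y≈πy₁ (trans (*-congˡ y₁≈ay′) (trans (sym (*-assoc _ _ _)) (*-congʳ (sym g≈πa)))) , w≈)

  squareFree-factor : ∀ {a h} π → h ≈ π * a → SquareFree h → SquareFree a
  squareFree-factor π h≈πa sf d dd∣a = sf d (∣-respʳ (sym h≈πa) (∣-*ˡ π dd∣a))

  -- With h = πa, y = πy₁ and y² = hk, cancelling π leaves ak = πy₁². Square-freeness keeps π out of
  -- `a`, so π divides `k`, and `a` divides y₁².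
  squareFree∣square : ∀ {n h} y → Factors n h → SquareFree h → h ∣ y * y → ¬ ¬ h ∣ y
  squareFree∣square y (unit u) _ _ = pure (∣-trans u (y , *-identityʳ y))
  squareFree∣square {h = h} y (prime {π = π} {a} pπ f h≈πa) sf h∣yy = do
    π∣y ← prime∣square pπ (∣-trans (divides a h≈πa) h∣yy)
    let y₁ , y≈πy₁ = cofactor π∣y
        k , yy≈hk = cofactor h∣yy
        ak≈πyy : a * k ≈ π * (y₁ * y₁)
        ak≈πyy = cancel π _ _ (nonzero pπ) (begin
          π * (a * k)             ≈⟨ *-assoc _ _ _ ⟨
          (π * a) * k             ≈⟨ *-congʳ h≈πa ⟨
          h * k                   ≈⟨ yy≈hk ⟨
          y * y                   ≈⟨ *-cong y≈πy₁ y≈πy₁ ⟩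
          (π * y₁) * (π * y₁)     ≈⟨ solve 2 (λ p y → (p :* y) :* (p :* y) := p :* (p :* (y :* y))) refl π y₁ ⟩
          π * (π * (y₁ * y₁))     ∎)
    π∣k ← prime-cancel pπ (λ π∣a → nonunit pπ (sf π (∣-respʳ (sym h≈πa) (*-cong-∣ ∣-refl π∣a))))
            (divides (y₁ * y₁) ak≈πyy)
    let k′ , k≈πk′ = cofactor π∣k
    a∣y₁ ← squareFree∣square y₁ f (squareFree-factor π h≈πa sf) (divides k′ (cancel π _ _ (nonzero pπ) (begin
          π * (y₁ * y₁)     ≈⟨ ak≈πyy ⟨
          a * k             ≈⟨ *-congˡ k≈πk′ ⟩
          a * (π * k′)      ≈⟨ solve 3 (λ a p k → a :* (p :* k) := p :* (a :* k)) refl a π k′ ⟩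
          π * (a * k′)      ∎)))
    pure (∣-trans (∣-respʳ h≈πa ∣-refl) (∣-respʳ (sym y≈πy₁) (*-cong-∣ ∣-refl a∣y₁)))

  -- `SquareFree` concludes `IsUnit` without double negation, so a unit that is found only
  -- classically has to become an actual one.
  UnitStable : Set (c ⊔ ℓ)
  UnitStable = ∀ u → ¬ ¬ IsUnit u → IsUnit u

  -- A further prime π is either absorbed or added. If h = πh′, then πhg² = h′(πg)². Otherwise πh is
  -- still square-free: if d² divides πh, then π does not divide d, as it would then divide h; so d²
  -- divides h.
  squareFreePart : ∀ {n x} → UnitStable → Factors n x →
                   ¬ ¬ ∃₂ λ h g → SquareFree h × x ≈ h * (g * g)
  squareFreePart {x = x} _ (unit u) = pure (x , 1# ,
    (λ d dd∣x → ∣-trans (divides d refl) (∣-trans dd∣x u)) ,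
    sym (trans (*-congˡ (*-identityˡ 1#)) (*-identityʳ x)))
  squareFreePart {x = x} stable (prime {π = π} {a} pπ f x≈πa) = do
    h , g , sf , a≈hgg ← squareFreePart stable f
    ¬¬-excluded-middle {A = π ∣ h} >>= λ
      { (yes π∣h) →
          let h′ , h≈πh′ = cofactor π∣h
          in pure (h′ , π * g , squareFree-factor π h≈πh′ sf , (begin
            x                             ≈⟨ x≈πa ⟩
            π * a                         ≈⟨ *-congˡ a≈hgg ⟩
            π * (h * (g * g))             ≈⟨ *-congˡ (*-congʳ h≈πh′) ⟩
            π * ((π * h′) * (g * g))      ≈⟨ solve 3 (λ p h g → p :* ((p :* h) :* (g :* g)) := h :* ((p :* g) :* (p :* g))) refl π h′ g ⟩
            h′ * ((π * g) * (π * g))      ∎))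
      ; (no π∤h) → pure (π * h , g , (λ d dd∣πh → stable d (do
          let k , πh≈ddk = cofactor dd∣πh
          π∣k ← prime-cancel pπ (λ π∣dd → prime∣square pπ π∣dd λ π∣d →
                  let e , d≈πe = cofactor π∣d
                  in π∤h (divides (e * e * k) (cancel π _ _ (nonzero pπ) (begin
                    π * h                         ≈⟨ πh≈ddk ⟩
                    (d * d) * k                   ≈⟨ *-congʳ (*-cong d≈πe d≈πe) ⟩
                    ((π * e) * (π * e)) * k       ≈⟨ solve 3 (λ p e k → ((p :* e) :* (p :* e)) :* k := p :* (p :* ((e :* e) :* k))) refl π e k ⟩
                    π * (π * (e * e * k))         ∎))))
                (divides h (sym πh≈ddk))
          let k′ , k≈πk′ = cofactor π∣k
          pure (sf d (divides k′ (cancel π _ _ (nonzero pπ) (begin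
            π * h                ≈⟨ πh≈ddk ⟩
            (d * d) * k          ≈⟨ *-congˡ k≈πk′ ⟩
            (d * d) * (π * k′)   ≈⟨ solve 3 (λ d p k → (d :* d) :* (p :* k) := p :* ((d :* d) :* k)) refl d π k′ ⟩
            π * ((d * d) * k′)   ∎)))))) ,
          trans x≈πa (trans (*-congˡ a≈hgg) (sym (*-assoc _ _ _))))
      }

  Associated : Carrier → Carrier → Set (c ⊔ ℓ)
  Associated x y = ∃ λ u → IsUnit u × x ≈ u * y

  -- A divisor of πa is π times a divisor of `a` or, if π does not divide it, already a divisor of
  -- `a`; the list doubles with each prime.
  divisors : ∀ {n f} → Factors n f → ∃ λ L → ∀ d → d ∣ f → ¬ ¬ Any (Associated d) L
  divisors (unit u) = 1# ∷ [] , λ d d∣f → pure (here (d , ∣-trans d∣f u , sym (*-identityʳ d)))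
  divisors {f = f} (prime {π = π} {a} pπ fs f≈πa) =
    let L , covers = divisors fs
    in L ++ map (π *_) L , λ d d∣f → do
      let k , f≈dk = cofactor d∣f
      ¬¬-excluded-middle {A = π ∣ d} >>= λ
        { (yes π∣d) → do
            let d′ , d≈πd′ = cofactor π∣d
            any ← covers d′ (divides k (cancel π _ _ (nonzero pπ)
                    (trans (sym f≈πa) (trans f≈dk (trans (*-congʳ d≈πd′) (*-assoc _ _ _))))))
            pure (Any.++⁺ʳ L (Any.map⁺ (Any.map (λ (u , uu , d′≈ul) → u , uu ,
              trans d≈πd′ (trans (*-congˡ d′≈ul) (solve 3 (λ p u l → p :* (u :* l) := u :* (p :* l)) refl π u _))) any)))
        ; (no π∤d) → do
            π∣k ← prime-cancel pπ π∤d (divides a (trans (sym f≈dk) f≈πa))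
            let k′ , k≈πk′ = cofactor π∣k
            any ← covers d (divides k′ (cancel π _ _ (nonzero pπ) (begin
              π * a           ≈⟨ f≈πa ⟨
              f               ≈⟨ f≈dk ⟩
              d * k           ≈⟨ *-congˡ k≈πk′ ⟩
              d * (π * k′)    ≈⟨ solve 3 (λ d p k → d :* (p :* k) := p :* (d :* k)) refl d π k′ ⟩
              π * (d * k′)    ∎)))
            pure (Any.++⁺ˡ any)
        }

-- Well-ordering for a predicate that need not be decidable, hence under double negation. The bound
-- `N` in `go` decreases with the candidate.
minimal : ∀ {q} (Q : ℕ → Set q) n → Q n → ¬ ¬ ∃ λ m → Q m × ∀ k → k ℕ.< m → ¬ Q k
minimal Q n Qn = go (suc n) n ℕ.≤-refl Qn
  where
  go : ∀ N n → n ℕ.< N → Q n → ¬ ¬ ∃ λ m → Q m × ∀ k → k ℕ.< m → ¬ Q k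
  go (suc N) n (ℕ.s≤s n≤N) Qn = ¬¬-excluded-middle {A = ∃ λ k → k ℕ.< n × Q k} >>= λ
    { (yes (k , k<n , Qk)) → go N k (ℕ.<-≤-trans k<n n≤N) Qk
    ; (no none) → pure (n , Qn , λ k k<n Qk → none (k , k<n , Qk))
    }

-- Degrees of polynomials over an integral domain

module PolynomialDomain {c ℓ} (D : IntegralDomain c ℓ) where
  open IntegralDomain D
  open Polynomial commutativeRing
  open Factorization D using (*-nonzero)
  open Relation.Binary.Reasoning.Setoid setoid
  private module P = CommutativeRing polynomialRing

  record Below (p : Poly) (n : ℕ) : Set ℓ where
    constructor mkBelow
    field vanish : ∀ i → n ℕ.≤ i → coeff p i ≈ 0#
  open Below public

  record HasDegree (p : Poly) (n : ℕ) : Set ℓ where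
    constructor mkDegree
    field
      lead≉0 : ¬ coeff p n ≈ 0#
      above  : Below p (suc n)
  open HasDegree public

  const-⊛ : ∀ a p → const a ⊛ p ≋ a • p
  const-⊛ a p = ≋-trans (⊕-cong ≋-refl (∷≋[] refl ≋-refl)) (⊕-identityʳ (a • p))

  coeff-const-⊛ : ∀ a p i → coeff (const a ⊛ p) i ≈ a * coeff p i
  coeff-const-⊛ a p i = trans (coeff≈ (const-⊛ a p) i) (coeff-• a p i)

  const-* : ∀ a b → const (a * b) ≋ const a ⊛ const b
  const-* a b = ≋-sym (const-⊛ a (const b))

  const-cong : ∀ {a b} → a ≈ b → const a ≋ const b
  const-cong a≈b = ∷-cong a≈b ≋-refl

  coeff-∷-⊛ : ∀ a p q i → coeff ((a ∷ p) ⊛ q) (suc i) ≈ a * coeff q (suc i) + coeff (p ⊛ q) i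
  coeff-∷-⊛ a p q i = trans (coeff-⊕ (a • q) (shift (p ⊛ q)) (suc i)) (+-congʳ (coeff-• a q (suc i)))

  Below-1 : ∀ {a p} → Below (a ∷ p) 1 → (a ∷ p) ≋ const a
  Below-1 b = ∷-cong refl (mk≋ λ i → vanish b (suc i) (ℕ.s≤s ℕ.z≤n))

  tail-Below : ∀ {a p n} → Below (a ∷ p) (suc n) → Below p n
  tail-Below b = mkBelow λ i n≤i → vanish b (suc i) (ℕ.s≤s n≤i)

  ⊛-leading : ∀ p q m n → Below p (suc m) → Below q (suc n) →
              coeff (p ⊛ q) (m ℕ.+ n) ≈ coeff p m * coeff q n × Below (p ⊛ q) (suc (m ℕ.+ n))
  ⊛-leading []      q m       n bp bq = sym (zeroˡ _) , mkBelow λ _ _ → refl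
  ⊛-leading (a ∷ p) q zero    n bp bq = scaled n , mkBelow λ i n<i →
      trans (scaled i) (trans (*-congˡ (vanish bq i n<i)) (zeroʳ a))
    where
    scaled : ∀ i → coeff ((a ∷ p) ⊛ q) i ≈ a * coeff q i
    scaled i = trans (coeff≈ (⊛-cong {a ∷ p} {const a} {q} (Below-1 bp) ≋-refl) i) (coeff-const-⊛ a q i)
  ⊛-leading (a ∷ p) q (suc m) n bp bq =
    let lead , bpq = ⊛-leading p q m n (tail-Below bp) bq
    in trans (shifted (m ℕ.+ n) (ℕ.m≤n+m n m)) lead ,
       mkBelow λ { (suc i) (ℕ.s≤s m+n<i) →
         trans (shifted i (ℕ.≤-trans (ℕ.m≤n+m n m) (ℕ.<⇒≤ m+n<i))) (vanish bpq i m+n<i) }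
    where
    shifted : ∀ i → n ℕ.≤ i → coeff ((a ∷ p) ⊛ q) (suc i) ≈ coeff (p ⊛ q) i
    shifted i n≤i = begin
      coeff ((a ∷ p) ⊛ q) (suc i)                   ≈⟨ coeff-∷-⊛ a p q i ⟩
      a * coeff q (suc i) + coeff (p ⊛ q) i         ≈⟨ +-congʳ (*-congˡ (vanish bq (suc i) (ℕ.s≤s n≤i))) ⟩
      a * 0# + coeff (p ⊛ q) i                      ≈⟨ +-congʳ (zeroʳ a) ⟩
      0# + coeff (p ⊛ q) i                          ≈⟨ +-identityˡ _ ⟩
      coeff (p ⊛ q) i                               ∎

  degree-⊛ : ∀ {p q m n} → HasDegree p m → HasDegree q n → HasDegree (p ⊛ q) (m ℕ.+ n)
  degree-⊛ {p} {q} {m} {n} dp dq =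
    let lead , b = ⊛-leading p q m n (above dp) (above dq)
    in mkDegree (λ e → *-nonzero (lead≉0 dp) (lead≉0 dq) (trans (sym lead) e)) b

  degree-resp : ∀ {p q n} → p ≋ q → HasDegree p n → HasDegree q n
  degree-resp e d = mkDegree (λ z → lead≉0 d (trans (coeff≈ e _) z))
    (mkBelow λ i n<i → trans (sym (coeff≈ e i)) (vanish (above d) i n<i))

  degree-unique : ∀ {p m n} → HasDegree p m → HasDegree p n → m ≡ n
  degree-unique {p} {m} {n} dm dn with ℕ.<-cmp m n
  ... | tri< m<n _ _ = ⊥-elim (lead≉0 dn (vanish (above dm) n m<n))
  ... | tri≈ _ m≡n _ = m≡n
  ... | tri> _ _ n<m = ⊥-elim (lead≉0 dm (vanish (above dn) m n<m))

  degree : ∀ p → p ≋ [] ⊎ ∃ λ n → HasDegree p n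
  degree []      = inj₁ ≋-refl
  degree (a ∷ p) with degree p | a ≟ 0#
  ... | inj₂ (n , d) | _ = inj₂ (suc n , mkDegree (lead≉0 d)
          (mkBelow λ { (suc i) (ℕ.s≤s n<i) → vanish (above d) i n<i }))
  ... | inj₁ p≋[] | yes a≈0 = inj₁ (∷≋[] a≈0 p≋[])
  ... | inj₁ p≋[] | no  a≉0 = inj₂ (0 , mkDegree a≉0 (mkBelow λ { (suc i) _ → coeff≈ p≋[] i }))

  degree⇒nonzero : ∀ {p n} → HasDegree p n → ¬ p ≋ []
  degree⇒nonzero d p≋[] = lead≉0 d (coeff≈ p≋[] _)

  nonzero⇒degree : ∀ p → ¬ p ≋ [] → ∃ λ n → HasDegree p n
  nonzero⇒degree p p≉0 with degree p
  ... | inj₁ p≋[] = ⊥-elim (p≉0 p≋[])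
  ... | inj₂ d    = d

  ⊛-zero-product : ∀ p q → ¬ p ≋ [] → p ⊛ q ≋ [] → q ≋ []
  ⊛-zero-product p q p≉0 pq≋[] with degree q
  ... | inj₁ q≋[]    = q≋[]
  ... | inj₂ (n , d) = ⊥-elim (degree⇒nonzero (degree-⊛ (proj₂ (nonzero⇒degree p p≉0)) d) pq≋[])

  polynomials : IntegralDomain c ℓ
  polynomials = record
    { commutativeRing = polynomialRing
    ; 1≉0    = λ e → 1≉0 (coeff≈ e 0)
    ; cancel = λ p q r p≉0 pq≋pr → PG.x∙y⁻¹≈ε⇒x≈y q r (⊛-zero-product p (q ⊕ ⊖ r) p≉0
        (P.trans (PR.x[y-z]≈xy-xz p q r) (PG.x≈y⇒x∙y⁻¹≈ε pq≋pr)))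
    ; _≟_    = λ p q → Dec.map′ (PG.x∙y⁻¹≈ε⇒x≈y p q) PG.x≈y⇒x∙y⁻¹≈ε (≋[]? (p ⊕ ⊖ q))
    }
    where
    module PR = Algebra.Properties.Ring P.ring
    module PG = Algebra.Properties.Group P.+-group
    ≋[]? : ∀ p → Dec (p ≋ [])
    ≋[]? p with degree p
    ... | inj₁ p≋[]    = yes p≋[]
    ... | inj₂ (_ , d) = no (degree⇒nonzero d)

-- Gauss: prime factorization passes from D to D[t]

module PolynomialFactorization {c ℓ} (D : IntegralDomain c ℓ)
         (factorial : Factorization.Factorial D) where
  open IntegralDomain D
  open Polynomial commutativeRing
  open PolynomialDomain D
  open Relation.Binary.Reasoning.Setoid setoid
  private
    module F = Factorization D
    module P = Factorization polynomials
    module P[t] = IntegralDomain polynomials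
  open F using (Prime)

  const∣⇒coeff∣ : ∀ {a p} → const a P.∣ p → ∀ i → a F.∣ coeff p i
  const∣⇒coeff∣ {a} d i =
    let q , e = P.cofactor d in F.divides (coeff q i) (trans (coeff≈ e i) (coeff-const-⊛ a q i))

  coeff∣⇒const∣ : ∀ {a} p → (∀ i → a F.∣ coeff p i) → const a P.∣ p
  coeff∣⇒const∣ {a} p d =
    let q , e = go p d in P.divides q (≋-trans e (≋-sym (const-⊛ a q)))
    where
    go : ∀ p → (∀ i → a F.∣ coeff p i) → ∃ λ q → p ≋ a • q
    go []      _ = [] , ≋-refl
    go (b ∷ p) d =
      let q , e = F.cofactor (d 0)
          r , f = go p (λ i → d (suc i))
      in q ∷ r , ∷-cong e f

  -- The constant term ab decides which list loses its head. If π divides `a`, subtracting the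
  -- multiple of `a` leaves π dividing the product with `p`; otherwise π divides `b`, and the same
  -- is done on the other side. `ihˡ` and `ihʳ` are the claims for the shortened products.
  coeffs-split-step : ∀ {π} → Prime π → ∀ a p b q →
    ((∀ i → π F.∣ coeff (p ⊛ (b ∷ q)) i) → ¬ ¬ ((∀ i → π F.∣ coeff p i) ⊎ (∀ i → π F.∣ coeff (b ∷ q) i))) →
    ((∀ i → π F.∣ coeff ((a ∷ p) ⊛ q) i) → ¬ ¬ ((∀ i → π F.∣ coeff (a ∷ p) i) ⊎ (∀ i → π F.∣ coeff q i))) →
    (∀ i → π F.∣ coeff ((a ∷ p) ⊛ (b ∷ q)) i) →
    ¬ ¬ ((∀ i → π F.∣ coeff (a ∷ p) i) ⊎ (∀ i → π F.∣ coeff (b ∷ q) i))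
  coeffs-split-step {π} pπ a p b q ihˡ ihʳ d = ¬¬-excluded-middle {A = π F.∣ a} >>= λ
    { (yes π∣a) → ihˡ
        (λ i → F.∣-respʳ (trans (+-congʳ (coeff-∷-⊛ a p (b ∷ q) i)) (x+y-x≈y _ _))
                         (F.∣-- (d (suc i)) (F.∣-*ʳ (coeff q i) π∣a))) >>= λ
          { (inj₁ π∣p) → pure (inj₁ λ { zero → π∣a ; (suc i) → π∣p i })
          ; (inj₂ π∣q) → pure (inj₂ π∣q)
          }
    ; (no π∤a) → do
        π∣b ← F.prime-cancel pπ π∤a (F.∣-respʳ (+-identityʳ _) (d 0))
        ihʳ (λ i → F.∣-respʳ (trans (+-congʳ (trans (coeff≈ (⊛-∷ʳ (a ∷ p) b q) (suc i))
                                              (trans (coeff-⊕ (b • p) ((a ∷ p) ⊛ q) i) (+-congʳ (coeff-• b p i)))))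
                                  (x+y-x≈y _ _))
                           (F.∣-- (d (suc i)) (F.∣-*ʳ (coeff p i) π∣b))) >>= λ
          { (inj₁ π∣p) → pure (inj₁ π∣p)
          ; (inj₂ π∣q) → pure (inj₂ λ { zero → π∣b ; (suc i) → π∣q i })
          }
    }
    where
    open IntegerSolver commutativeRing using (solve; _:=_; _:+_; _:-_)
    x+y-x≈y : ∀ x y → (x + y) - x ≈ y
    x+y-x≈y = solve 2 (λ x y → (x :+ y) :- x := y) refl

  coeffs-split : ∀ {π} → Prime π → ∀ p q → (∀ i → π F.∣ coeff (p ⊛ q) i) →
                 ¬ ¬ ((∀ i → π F.∣ coeff p i) ⊎ (∀ i → π F.∣ coeff q i))
  coeffs-split pπ []      q       d = pure (inj₁ d)
  coeffs-split pπ (a ∷ p) []      d = pure (inj₂ λ _ → F.divides 0# (sym (zeroʳ _)))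
  coeffs-split pπ (a ∷ p) (b ∷ q) d =
    coeffs-split-step pπ a p b q (coeffs-split pπ p (b ∷ q)) (coeffs-split pπ (a ∷ p) q) d

  const-prime : ∀ {π} → Prime π → P.Prime (const π)
  const-prime pπ = record
    { nonzero = λ e → F.nonzero pπ (coeff≈ e 0)
    ; nonunit = λ u → F.nonunit pπ (const∣⇒coeff∣ u 0)
    ; split   = λ p q d → coeffs-split pπ p q (const∣⇒coeff∣ d) >>= λ
        { (inj₁ e) → pure (inj₁ (coeff∣⇒const∣ p e))
        ; (inj₂ e) → pure (inj₂ (coeff∣⇒const∣ q e))
        }
    }

  const-unit : ∀ {u} → F.IsUnit u → P.IsUnit (const u)
  const-unit {u} uu = let v , e = F.cofactor uu in P.divides (const v) (≋-trans (const-cong e) (const-* u v))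

  const-factors : ∀ {n a} → F.Factors n a → P.Factors n (const a)
  const-factors (F.unit u)                = P.unit (const-unit u)
  const-factors (F.prime {π = π} {a} pπ f e) =
    P.prime (const-prime pπ) (const-factors f) (≋-trans (const-cong e) (const-* π a))

  Primitive : Poly → Set (c ⊔ ℓ)
  Primitive p = ∀ π → Prime π → ¬ const π P.∣ p

  -- The primes of the constant `a` cannot divide the primitive `p`; each goes into the cofactor of
  -- `p` and cancels.
  gauss : ∀ {n a p} q → F.Factors n a → Primitive p → p P.∣ const a ⊛ q → ¬ ¬ p P.∣ q
  gauss {a = a} q (F.unit u) _ p∣aq =
    let v , e = P.cofactor (const-unit u)
    in pure (P.∣-trans p∣aq (P.divides v (P[t].trans (P[t].sym (⊛-identityˡ q)) (P[t].trans (P[t].*-congʳ {q} e)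
         (solve 3 (λ a v q → (a :* v) :* q := (a :* q) :* v) ≋-refl (const a) v q)))))
    where open IntegerSolver polynomialRing using (solve; _:=_; _:*_)
  gauss {a = a} {p} q (F.prime {π = π} {b} pπ f a≈πb) prim p∣aq = do
    let k , aq≋pk = P.cofactor p∣aq
        πbq≋pk : const π ⊛ (const b ⊛ q) ≋ p ⊛ k
        πbq≋pk = P[t].trans (P[t].sym (P[t].*-assoc (const π) (const b) q))
                   (P[t].trans (P[t].*-congʳ {q} (≋-sym (≋-trans (const-cong a≈πb) (const-* π b)))) aq≋pk)
    π∣k ← P.prime-cancel (const-prime pπ) (prim π pπ) (P.divides (const b ⊛ q) (≋-sym πbq≋pk))
    let k′ , k≋πk′ = P.cofactor π∣k
    gauss q f prim (P.divides k′ (P[t].cancel (const π) (const b ⊛ q) (p ⊛ k′) (P.nonzero (const-prime pπ))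
      (P[t].trans πbq≋pk (P[t].trans (P[t].*-congˡ {p} k≋πk′)
        (solve 3 (λ p a k → p :* (a :* k) := a :* (p :* k)) ≋-refl p (const π) k′)))))
    where open IntegerSolver polynomialRing using (solve; _:=_; _:*_)

  divisor-primitive : ∀ {p q} → p P.∣ q → Primitive q → Primitive p
  divisor-primitive p∣q prim π pπ π∣p = prim π pπ (P.∣-trans π∣p p∣q)

  -- Each constant prime divided out is also a prime of the leading coefficient, whose factor count
  -- bounds the recursion; no gcd of coefficients is formed.
  primitivePart : ∀ {n m} p → HasDegree p m → F.Factors n (coeff p m) →
                  ¬ ¬ ∃₂ λ a q → ¬ a ≈ 0# × p ≋ const a ⊛ q × Primitive q
  primitivePart {n} {m} p dp f = ¬¬-excluded-middle {A = ∃ λ π → Prime π × const π P.∣ p} >>= λ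
    { (no none) → pure (1# , p , F.unit-nonzero F.∣-refl , ≋-sym (⊛-identityˡ p) , noPrimeDivisor none)
    ; (yes (π , pπ , π∣p)) →
        let r , p≋πr = P.cofactor π∣p
        in F.cancel-prime f pπ (trans (coeff≈ p≋πr m) (coeff-const-⊛ π r m)) >>= λ { (n′ , ≡.refl , f′) → do
          a , q , a≉0 , r≋aq , prim ← primitivePart r (quotientDegree π r p≋πr) f′
          pure (π * a , q , F.*-nonzero (F.nonzero pπ) a≉0 ,
            P[t].trans p≋πr (P[t].trans (P[t].*-congˡ {const π} r≋aq)
              (P[t].trans (P[t].sym (P[t].*-assoc (const π) (const a) q)) (P[t].*-congʳ {q} (≋-sym (const-* π a))))) , prim) }
    }
    where
    noPrimeDivisor : ¬ (∃ λ π → Prime π × const π P.∣ p) → Primitive p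
    noPrimeDivisor none π pπ π∣p = none (π , pπ , π∣p)
    quotientDegree : ∀ π r → p ≋ const π ⊛ r → HasDegree r m
    quotientDegree π r p≋πr = mkDegree
      (λ e → lead≉0 dp (trans (scaled m) (trans (*-congˡ e) (zeroʳ π))))
      (mkBelow λ i m<i → cancel π _ _ π≉0 (trans (sym (scaled i)) (trans (vanish (above dp) i m<i) (sym (zeroʳ π)))))
      where
      scaled : ∀ i → coeff p i ≈ π * coeff r i
      scaled i = trans (coeff≈ p≋πr i) (coeff-const-⊛ π r i)
      π≉0 : ¬ π ≈ 0#
      π≉0 π≈0 = lead≉0 dp (trans (scaled m) (trans (*-congʳ π≈0) (zeroˡ _)))

  -- Recursion along the coefficients of the dividend b + t h. From a h = q g + r one multiplies by
  -- t and by the leading coefficient `l` of `g`, which need not be invertible; then l t r may reach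
  -- the degree of `g`, and subtracting ρ g, with ρ the top coefficient of `r`, brings it below.
  pseudoDivision : ∀ {d} g → HasDegree g d → ∀ h →
                   ∃ λ a → ∃₂ λ q r → ¬ a ≈ 0# × const a ⊛ h ≋ q ⊛ g ⊕ r × Below r d
  pseudoDivision {zero} g dg h = coeff g 0 , h , [] , lead≉0 dg ,
    P[t].trans (P[t].*-congʳ {h} (≋-sym g≋const)) (P[t].trans (P[t].*-comm g h) (≋-sym (⊕-identityʳ (h ⊛ g)))) ,
    mkBelow λ _ _ → refl
    where
    g≋const : g ≋ const (coeff g 0)
    g≋const = mk≋ λ { zero → refl ; (suc i) → vanish (above dg) (suc i) (ℕ.s≤s ℕ.z≤n) }
  pseudoDivision {suc d} g dg [] = 1# , [] , [] , F.unit-nonzero F.∣-refl , ⊛-zeroʳ (const 1#) , mkBelow λ _ _ → refl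
  pseudoDivision {suc d} g dg (b ∷ h) with pseudoDivision g dg h
  ... | a , q , r , a≉0 , ah≋qg+r , br =
    l * a , q′ , r′ , F.*-nonzero (lead≉0 dg) a≉0 , equation , mkBelow below
    where
    open IntegerSolver polynomialRing using (solve; _:=_; _:+_; _:*_; _:-_)
    l = coeff g (suc d)
    ρ = coeff r d
    t q′ r′ : Poly
    t  = shift (const 1#)
    q′ = const l ⊛ (t ⊛ q) ⊕ const ρ
    r′ = const l ⊛ (const a ⊛ const b) ⊕ const l ⊛ (t ⊛ r) ⊕ ⊖ (const ρ ⊛ g)
    t-⊛ : ∀ p → t ⊛ p ≋ shift p
    t-⊛ p = ≋-trans (shift-⊛ (const 1#) p) (∷-cong refl (⊛-identityˡ p))
    equation : const (l * a) ⊛ (b ∷ h) ≋ q′ ⊛ g ⊕ r′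
    equation = P[t].trans
      (⊛-cong {const (l * a)} {const l ⊛ const a} {b ∷ h} {const b ⊕ t ⊛ h} (const-* l a)
        (≋-trans (∷-cong (sym (+-identityʳ b)) ≋-refl) (⊕-cong {const b} ≋-refl (≋-sym (t-⊛ h)))))
      (P[t].trans
        (solve 5 (λ l a b t h → (l :* a) :* (b :+ t :* h) := l :* (a :* b) :+ l :* (t :* (a :* h))) ≋-refl
           (const l) (const a) (const b) t h)
      (P[t].trans
        (P[t].+-congˡ {const l ⊛ (const a ⊛ const b)} (P[t].*-congˡ {const l} (P[t].*-congˡ {t} ah≋qg+r)))
        (solve 7 (λ l e t q g r p → l :* e :+ l :* (t :* (q :* g :+ r))
            := (l :* (t :* q) :+ p) :* g :+ (l :* e :+ l :* (t :* r) :- p :* g)) ≋-refl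
           (const l) (const a ⊛ const b) t q g r (const ρ))))
    below : ∀ i → suc d ℕ.≤ i → coeff r′ i ≈ 0#
    below (suc j) (ℕ.s≤s d≤j) = begin
      coeff r′ (suc j)
        ≈⟨ coeff-⊕ (const l ⊛ (const a ⊛ const b) ⊕ const l ⊛ (t ⊛ r)) (⊖ (const ρ ⊛ g)) (suc j) ⟩
      coeff (const l ⊛ (const a ⊛ const b) ⊕ const l ⊛ (t ⊛ r)) (suc j) + coeff (⊖ (const ρ ⊛ g)) (suc j)
        ≈⟨ +-cong (coeff-⊕ (const l ⊛ (const a ⊛ const b)) (const l ⊛ (t ⊛ r)) (suc j))
                  (trans (coeff-⊖ (const ρ ⊛ g) (suc j)) (-‿cong (coeff-const-⊛ ρ g (suc j)))) ⟩
      (coeff (const l ⊛ (const a ⊛ const b)) (suc j) + coeff (const l ⊛ (t ⊛ r)) (suc j)) - ρ * coeff g (suc j)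
        ≈⟨ +-congʳ (+-cong (trans (coeff-const-⊛ l (const a ⊛ const b) (suc j))
                             (trans (*-congˡ (coeff-const-⊛ a (const b) (suc j))) (trans (*-congˡ (zeroʳ a)) (zeroʳ l))))
                           (trans (coeff-const-⊛ l (t ⊛ r) (suc j)) (*-congˡ (coeff≈ (t-⊛ r) (suc j))))) ⟩
      (0# + l * coeff r j) - ρ * coeff g (suc j)
        ≈⟨ +-congʳ (+-identityˡ _) ⟩
      l * coeff r j - ρ * coeff g (suc j)
        ≈⟨ cancelled (ℕ.m≤n⇒m<n∨m≡n d≤j) ⟩
      0# ∎
      where
      cancelled : d ℕ.< j ⊎ d ≡ j → l * coeff r j - ρ * coeff g (suc j) ≈ 0#
      cancelled (inj₁ d<j) = begin
        l * coeff r j - ρ * coeff g (suc j)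
          ≈⟨ +-cong (*-congˡ (vanish br j d<j)) (-‿cong (*-congˡ (vanish (above dg) (suc j) (ℕ.s≤s d<j)))) ⟩
        l * 0# - ρ * 0#
          ≈⟨ +-cong (zeroʳ l) (-‿cong (zeroʳ ρ)) ⟩
        0# - 0#
          ≈⟨ -‿inverseʳ 0# ⟩
        0# ∎
      cancelled (inj₂ ≡.refl) = trans (+-congʳ (*-comm l ρ)) (-‿inverseʳ (ρ * l))

  degree0⇒const : ∀ {p} → HasDegree p 0 → p ≋ const (coeff p 0)
  degree0⇒const dp = mk≋ λ { zero → refl ; (suc i) → vanish (above dp) (suc i) (ℕ.s≤s ℕ.z≤n) }

  const-primitive⇒unit : ∀ {a p} → ¬ a ≈ 0# → const a P.∣ p → Primitive p → ¬ ¬ F.IsUnit a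
  const-primitive⇒unit {a} a≉0 a∣p prim = factorial a a≉0 >>= λ
    { (_ , F.unit u) → pure u
    ; (_ , F.prime {π = π} {b} pπ _ e) → ⊥-elim (prim π pπ
        (P.∣-trans (P.divides (const b) (≋-trans (const-cong e) (const-* π b))) a∣p))
    }

  unit⇒degree0 : ∀ {p} → P.IsUnit p → HasDegree p 0
  unit⇒degree0 {p} u with nonzero⇒degree p (P.unit-nonzero u)
  ... | zero  , dp = dp
  ... | suc n , dp =
    let q , 1≋pq = P.cofactor u
        _ , dq = nonzero⇒degree q (P.*-nonzeroʳ {p} (λ pq≋0 → P[t].1≉0 (≋-trans 1≋pq pq≋0)))
    in ⊥-elim (ℕ.1+n≢0 (degree-unique (degree-resp (≋-sym 1≋pq) (degree-⊛ dp dq))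
                          (mkDegree {const 1#} 1≉0 (mkBelow λ { (suc i) _ → refl }))))

  unit⇒const : ∀ {p} → P.IsUnit p → p ≋ const (coeff p 0)
  unit⇒const u = degree0⇒const (unit⇒degree0 u)

  unitStable : F.UnitStable → P.UnitStable
  unitStable stable p ¬¬u = P.∣-trans (P.∣-respʳ p≋const P.∣-refl) (const-unit (stable (coeff p 0) (do
      u ← ¬¬u
      pure (const∣⇒coeff∣ (P.∣-trans (P.∣-respʳ (≋-sym p≋const) P.∣-refl) u) 0))))
    where
    p≋const : p ≋ const (coeff p 0)
    p≋const = Dec.decidable-stable (p P[t].≟ const (coeff p 0)) (do
      u ← ¬¬u
      pure (unit⇒const u))

  Splits : Poly → Set (c ⊔ ℓ)
  Splits p = ∃₂ λ q r → ∃₂ λ m n → p ≋ q ⊛ r × HasDegree q (suc m) × HasDegree r (suc n)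

  -- The gcd of p and q is the primitive part of an element of least degree
  -- in the ideal they generate.
  unsplit⇒prime : ∀ {p n} → HasDegree p (suc n) → Primitive p → ¬ Splits p → P.Prime p
  unsplit⇒prime {p} {n} dp prim unsplit = record
    { nonzero = degree⇒nonzero dp
    ; nonunit = λ u → ℕ.1+n≢0 (degree-unique dp (unit⇒degree0 u))
    ; split   = λ q r p∣qr → ¬¬-excluded-middle {A = p P.∣ q} >>= λ
        { (yes p∣q) → pure (inj₁ p∣q)
        ; (no p∤q)  → splitʳ q r p∣qr p∤q >>= λ p∣r → pure (inj₂ p∣r)
        }
    }
    where
    open IntegerSolver polynomialRing using (solve; _:=_; _:+_; _:*_; _:-_)
    splitʳ : ∀ q r → p P.∣ q ⊛ r → ¬ p P.∣ q → ¬ ¬ p P.∣ r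
    splitʳ q r p∣qr p∤q = do
      d , (g , dg , g∈I) , least ← minimal (λ d → ∃ λ g → HasDegree g d × g ∈I) (suc n) (p , dp , p∈I)
      _ , lead-factors ← factorial _ (lead≉0 dg)
      a , g₁ , a≉0 , g≋ag₁ , prim₁ ← primitivePart g dg lead-factors
      g₁∣p ← g₁∣ dg g∈I least g≋ag₁ prim₁ p p∈I
      g₁∣q ← g₁∣ dg g∈I least g≋ag₁ prim₁ q q∈I
      let k , p≋g₁k = P.cofactor g₁∣p
          g₁k≉0 = P.nonzero-resp p≋g₁k (degree⇒nonzero dp)
          k-degree = nonzero⇒degree k (P.*-nonzeroʳ {g₁} {k} g₁k≉0)
          g₁-degree = nonzero⇒degree g₁ (P.*-nonzeroˡ {g₁} {k} g₁k≉0)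
      conclude g∈I a≉0 g≋ag₁ g₁∣q g₁-degree p≋g₁k k-degree
      where
      _∈I : Poly → Set (c ⊔ ℓ)
      g ∈I = ∃₂ λ u v → g ≋ u ⊛ p ⊕ v ⊛ q
      p∈I : p ∈I
      p∈I = const 1# , [] , ≋-sym (≋-trans (⊕-identityʳ _) (⊛-identityˡ p))
      q∈I : q ∈I
      q∈I = [] , const 1# , ≋-sym (⊛-identityˡ q)
      -- The pseudo-remainder of `h` by `g` lies in the ideal and has degree below the least one, so
      -- it is zero. Thus `g₁` divides bh, and `gauss` removes the constant `b`.
      g₁∣ : ∀ {d g a g₁} → HasDegree g d → g ∈I →
            (∀ e → e ℕ.< d → ¬ ∃ λ g → HasDegree g e × g ∈I) →
            g ≋ const a ⊛ g₁ → Primitive g₁ → ∀ h → h ∈I → ¬ ¬ g₁ P.∣ h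
      g₁∣ {d} {g} {a} {g₁} dg (u , v , g≋) least g≋ag₁ prim₁ h (u′ , v′ , h≋) =
        let b , s , r , b≉0 , bh≋sg+r , br = pseudoDivision g dg h
            r∈I : r ∈I
            r∈I = const b ⊛ u′ ⊕ ⊖ (s ⊛ u) , const b ⊛ v′ ⊕ ⊖ (s ⊛ v) ,
              P[t].trans (solve 2 (λ x r → r := (x :+ r) :- x) ≋-refl (s ⊛ g) r)
              (P[t].trans (⊕-cong (≋-trans (≋-sym bh≋sg+r) (P[t].*-congˡ {const b} h≋)) (⊖-cong (P[t].*-congˡ {s} g≋)))
                (solve 8 (λ b u′ p v′ q s u v → b :* (u′ :* p :+ v′ :* q) :- s :* (u :* p :+ v :* q)
                    := (b :* u′ :- s :* u) :* p :+ (b :* v′ :- s :* v) :* q) ≋-refl (const b) u′ p v′ q s u v))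
            r≋[] : r ≋ []
            r≋[] = remainder-zero r (degree r) br r∈I
        in factorial b b≉0 >>= λ (_ , f) → gauss h f prim₁
             (P.∣-trans (P.divides (const a) (≋-trans g≋ag₁ (⊛-comm (const a) g₁)))
               (P.divides s (≋-trans bh≋sg+r (≋-trans (⊕-cong {s ⊛ g} ≋-refl r≋[])
                 (≋-trans (⊕-identityʳ _) (⊛-comm s g))))))
        where
        remainder-zero : ∀ r → r ≋ [] ⊎ (∃ λ e → HasDegree r e) → Below r d → r ∈I → r ≋ []
        remainder-zero r (inj₁ r≋[])    br r∈I = r≋[]
        remainder-zero r (inj₂ (e , dr)) br r∈I = ⊥-elim (least e
          (ℕ.≰⇒> (λ d≤e → lead≉0 dr (vanish br e d≤e))) (r , dr , r∈I))
      -- Since p = g₁ k does not split, one factor is constant. If `k` is, primitivity of `p` makes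
      -- it a unit, and `p` would divide `g₁` and so `q`. If `g₁` is, then `g` is a nonzero constant
      -- w = u p + v q; `p` divides w r, and `gauss` removes w.
      conclude : ∀ {g a g₁ k} → g ∈I → ¬ a ≈ 0# → g ≋ const a ⊛ g₁ → g₁ P.∣ q → (∃ λ e → HasDegree g₁ e) →
                 p ≋ g₁ ⊛ k → (∃ λ e → HasDegree k e) → ¬ ¬ p P.∣ r
      conclude _ _ _ _ (suc i , d₁) p≋g₁k (suc j , dk) = ⊥-elim (unsplit (_ , _ , i , j , p≋g₁k , d₁ , dk))
      conclude {g₁ = g₁} {k} _ _ _ g₁∣q (suc i , d₁) p≋g₁k (zero , dk) =
        const-primitive⇒unit (lead≉0 dk)
          (P.∣-trans (P.∣-respʳ (≋-sym (degree0⇒const dk)) P.∣-refl) (P.divides g₁ (≋-trans p≋g₁k (⊛-comm g₁ k)))) prim >>= λ u →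
        let v , 1≋kv = P.cofactor (const-unit u)
        in ⊥-elim (p∤q (P.∣-trans (P.divides v (P[t].trans (P[t].sym (P[t].*-identityʳ g₁))
             (P[t].trans (P[t].*-congˡ {g₁} (≋-trans 1≋kv (P[t].*-congʳ {v} (≋-sym (degree0⇒const dk)))))
             (P[t].trans (P[t].sym (P[t].*-assoc g₁ k v)) (P[t].*-congʳ {v} (≋-sym p≋g₁k)))))) g₁∣q))
      conclude {g} {a} {g₁} (u , v , g≋) a≉0 g≋ag₁ _ (zero , d₁) _ _ = do
        let w = a * coeff g₁ 0
            g≋w : g ≋ const w
            g≋w = ≋-trans g≋ag₁ (≋-trans (P[t].*-congˡ {const a} (degree0⇒const d₁)) (≋-sym (const-* a (coeff g₁ 0))))
        _ , f ← factorial w (F.*-nonzero a≉0 (lead≉0 d₁))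
        gauss r f prim (P.∣-respʳ
          (P[t].trans (solve 5 (λ u p v q r → (u :* r) :* p :+ v :* (q :* r) := (u :* p :+ v :* q) :* r) ≋-refl u p v q r)
            (P[t].*-congʳ {r} (≋-trans (≋-sym g≋) g≋w)))
          (P.∣-+ (P.∣-*ˡ (u ⊛ r) P.∣-refl) (P.∣-*ˡ v p∣qr)))

  -- `N` exceeds the degree and drives the recursion: both factors of a split have smaller degree.
  primitive-factors : ∀ N {m} p → m ℕ.< N → HasDegree p m → Primitive p → ¬ ¬ ∃ λ n → P.Factors n p
  primitive-factors (suc N) {zero} p _ dp prim = do
    u ← const-primitive⇒unit (lead≉0 dp) (P.∣-respʳ (≋-sym (degree0⇒const dp)) P.∣-refl) prim
    pure (0 , P.Factors-resp (≋-sym (degree0⇒const dp)) (P.unit (const-unit u)))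
  primitive-factors (suc N) {suc m} p (ℕ.s≤s m<N) dp prim = ¬¬-excluded-middle {A = Splits p} >>= λ
    { (no unsplit) → pure (1 , P.prime (unsplit⇒prime dp prim unsplit) (P.unit P.∣-refl) (P[t].sym (P[t].*-identityʳ p)))
    ; (yes (q , r , i , j , p≋qr , dq , dr)) → do
        let m≡i+j : suc m ≡ suc i ℕ.+ suc j
            m≡i+j = degree-unique dp (degree-resp (≋-sym p≋qr) (degree-⊛ dq dr))
            i<N : suc i ℕ.< N
            i<N = ℕ.<-≤-trans (≡.subst (suc i ℕ.<_) (≡.sym m≡i+j) (ℕ.m<m+n (suc i) (ℕ.s≤s ℕ.z≤n))) m<N
            j<N : suc j ℕ.< N
            j<N = ℕ.<-≤-trans (≡.subst (suc j ℕ.<_) (≡.sym m≡i+j) (ℕ.m<n+m (suc j) (ℕ.s≤s ℕ.z≤n))) m<N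
        _ , fq ← primitive-factors N q i<N dq (divisor-primitive (P.divides r p≋qr) prim)
        _ , fr ← primitive-factors N r j<N dr (divisor-primitive (P.divides q (≋-trans p≋qr (⊛-comm q r))) prim)
        pure (_ , P.Factors-resp (≋-sym p≋qr) (P.Factors-* fq fr))
    }

  polynomials-factorial : P.Factorial
  polynomials-factorial p p≉0 = do
    let m , dp = nonzero⇒degree p p≉0
    _ , f ← factorial (coeff p m) (lead≉0 dp)
    a , q , a≉0 , p≋aq , prim ← primitivePart p dp f
    let n , dq = nonzero⇒degree q (P.*-nonzeroʳ {const a} {q} (P.nonzero-resp p≋aq p≉0))
    _ , fa ← factorial a a≉0
    _ , fq ← primitive-factors (suc n) q ℕ.≤-refl dq prim
    pure (_ , P.Factors-resp (≋-sym p≋aq) (P.Factors-* (const-factors fa) fq))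

-- From unique factorization into irreducibles to primes

Any-permutation : ∀ {a r p} {A : Set a} {R : A → A → Set r} {P : A → Set p} →
                  (∀ {x y} → R x y → P x → P y) →
                  ∀ {xs ys} → Permutation R xs ys → Any P xs → Any P ys
Any-permutation {A = A} {R} {P} respects = go
  where
  pointwise : ∀ {xs ys} → Pointwise R xs ys → Any P xs → Any P ys
  pointwise (r ∷ _)  (here p)  = here (respects r p)
  pointwise (_ ∷ rs) (there a) = there (pointwise rs a)
  go : ∀ {xs ys} → Permutation R xs ys → Any P xs → Any P ys
  go (Permutation.refl rs)      a                 = pointwise rs a
  go (Permutation.prep r _)     (here p)          = here (respects r p)
  go (Permutation.prep _ π)     (there a)         = there (go π a)
  go (Permutation.swap r _ _)   (here p)          = there (here (respects r p))
  go (Permutation.swap _ r _)   (there (here p))  = here (respects r p)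
  go (Permutation.swap _ _ π)   (there (there a)) = there (there (go π a))
  go (Permutation.trans π ρ)    a                 = go ρ (go π a)

module UniqueFactorization {c ℓ} (D : IntegralDomain c ℓ)
         (ufd : Divisibility.IsUFD (IntegralDomain.commutativeRing D)) where
  open IntegralDomain D
  open Factorization D
  open Divisibility commutativeRing using (product; Irreducible)
  open Divisibility.IsUFD ufd using (factor; factorUnique)
  open Algebra.Definitions.RawMagma *-rawMagma using (_,_)
  open Irreducible

  product-++ : ∀ xs ys → product (xs ++ ys) ≈ product xs * product ys
  product-++ []       ys = sym (*-identityˡ _)
  product-++ (x ∷ xs) ys = trans (*-congˡ (product-++ xs ys)) (sym (*-assoc x _ _))

  Any⇒∣product : ∀ {x ys} → Any (x ∣_) ys → x ∣ product ys
  Any⇒∣product {ys = _ ∷ ys} (here x∣y)  = ∣-*ʳ (product ys) x∣y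
  Any⇒∣product {ys = y ∷ _}  (there any) = ∣-*ˡ y (Any⇒∣product any)

  ∣-unit-* : ∀ {u} x → IsUnit u → u * x ∣ x
  ∣-unit-* x u = ∣-respʳ (*-identityˡ x) (*-cong-∣ u ∣-refl)

  -- If ab = πk with `a` and `b` nonzero, then π together with the irreducibles of `k` is a
  -- permutation, up to units, of those of `a` and `b`; so π is associated to one of the latter.
  irreducible⇒prime : ∀ {π} → Irreducible π → Prime π
  irreducible⇒prime {π} irr = record
    { nonzero = λ π≈0 → Sum.[ (λ 0∣1 → unit-nonzero 0∣1 refl) , (λ 0∣1 → unit-nonzero 0∣1 refl) ]′
        (split-∣1 irr (trans π≈0 (sym (zeroˡ 0#))))
    ; nonunit = p∤1 irr
    ; split   = λ a b π∣ab → pure (splits a b π∣ab)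
    }
    where
    splits : ∀ a b → π ∣ a * b → π ∣ a ⊎ π ∣ b
    splits a b π∣ab with a ≟ 0# | b ≟ 0#
    ... | yes a≈0 | _       = inj₁ (∣-respʳ (sym a≈0) (divides 0# (sym (zeroʳ π))))
    ... | no  _   | yes b≈0 = inj₂ (∣-respʳ (sym b≈0) (divides 0# (sym (zeroʳ π))))
    ... | no  a≉0 | no  b≉0 =
      let k , ab≈πk = cofactor π∣ab
          k≉0 = *-nonzeroʳ (nonzero-resp ab≈πk (*-nonzero a≉0 b≉0))
          u , as , uu , irr-as , a≈ = factor a a≉0
          v , bs , uv , irr-bs , b≈ = factor b b≉0
          w , ks , uw , irr-ks , k≈ = factor k k≉0
          ab∣ : a * b ∣ product (as ++ bs)
          ab∣ = ∣-respʳ (sym (product-++ as bs))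
                  (*-cong-∣ (∣-trans (∣-respʳ a≈ ∣-refl) (∣-unit-* _ uu)) (∣-trans (∣-respʳ b≈ ∣-refl) (∣-unit-* _ uv)))
          ∣ab : product (as ++ bs) ∣ a * b
          ∣ab = ∣-trans (∣-respʳ (product-++ as bs) ∣-refl)
                  (*-cong-∣ (divides u (trans a≈ (*-comm u _))) (divides v (trans b≈ (*-comm v _))))
          permutation = factorUnique (π ∷ ks) (as ++ bs) (irr ∷ irr-ks) (All.++⁺ irr-as irr-bs)
            ( ∣-trans (∣-trans (*-cong-∣ ∣-refl (divides w (trans k≈ (*-comm w _)))) (∣-respʳ (sym ab≈πk) ∣-refl)) ab∣
            , ∣-trans ∣ab (∣-trans (∣-respʳ ab≈πk ∣-refl) (*-cong-∣ ∣-refl (∣-trans (∣-respʳ k≈ ∣-refl) (∣-unit-* _ uw)))) )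
      in Sum.map (λ any → ∣-trans (Any⇒∣product any) (divides u (trans a≈ (*-comm u _))))
                 (λ any → ∣-trans (Any⇒∣product any) (divides v (trans b≈ (*-comm v _))))
                 (Any.++⁻ as (Any-permutation (λ (x∣y , _) π∣x → ∣-trans π∣x x∣y) permutation (here ∣-refl)))

  product-factors : ∀ {ps} → All Irreducible ps → Factors (length ps) (product ps)
  product-factors []            = unit ∣-refl
  product-factors (irr ∷ irrs)  = prime (irreducible⇒prime irr) (product-factors irrs) refl

  factorial : Factorial
  factorial x x≉0 =
    let u , ps , uu , irrs , x≈ = factor x x≉0
    in pure (_ , Factors-resp (sym x≈) (Factors-* (unit uu) (product-factors irrs)))

  -- The list returned by `factor` settles it: if it is empty, `u` is a unit, and an irreducible in
  -- it contradicts the assumption.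
  unitStable : UnitStable
  unitStable u ¬¬u with u ≟ 0#
  ... | yes u≈0 = ⊥-elim (¬¬u λ uu → unit-nonzero uu u≈0)
  ... | no  u≉0 with factor u u≉0
  ...   | v , []     , uv , _        , u≈ = ∣-trans (∣-respʳ (trans u≈ (*-identityʳ v)) ∣-refl) uv
  ...   | v , p ∷ ps , uv , irr ∷ _  , u≈ = ⊥-elim (¬¬u λ uu →
    p∤1 irr (∣-trans (∣-respʳ (sym u≈) (∣-*ˡ v (∣-*ʳ (product ps) ∣-refl))) uu))

-- Squares in a field, and what the descent asks of the evaluation map

asDomain : ∀ {c ℓ} → Field c ℓ → IntegralDomain c ℓ
asDomain F = record { commutativeRing = commutativeRing ; 1≉0 = 1≉0 ; cancel = cancel ; _≟_ = _≟_ }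
  where open Field F

module FieldSquares {c ℓ} (F : Field c ℓ) where
  open Field F
  open IntegerSolver commutativeRing using (solve; _:=_; _:+_; _:*_; _:-_; :-_)
  open Algebra.Properties.Group +-group using (x∙y⁻¹≈ε⇒x≈y; x≈y⇒x∙y⁻¹≈ε)

  zero-product : ∀ {x y} → x * y ≈ 0# → x ≈ 0# ⊎ y ≈ 0#
  zero-product {x} {y} xy≈0 with x ≟ 0#
  ... | yes x≈0 = inj₁ x≈0
  ... | no  x≉0 = inj₂ (cancel x y 0# x≉0 (trans xy≈0 (sym (zeroʳ x))))

  square-injective : ∀ {x y} → x * x ≈ y * y → x ≈ y ⊎ x ≈ - y
  square-injective {x} {y} e = Sum.map (x∙y⁻¹≈ε⇒x≈y x y)
    (λ s → x∙y⁻¹≈ε⇒x≈y x (- y) (trans (solve 2 (λ x y → x :- :- y := x :+ y) refl x y) s))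
    (zero-product (trans (solve 2 (λ x y → (x :- y) :* (x :+ y) := x :* x :- y :* y) refl x y) (x≈y⇒x∙y⁻¹≈ε e)))

  quotient-square : ∀ {h g γ} → ¬ g ≈ 0# → h * (g * g) ≈ γ * γ → ∃ λ δ → h ≈ δ * δ
  quotient-square {h} {g} {γ} g≉0 e with g⁻¹ , gg⁻¹≈1 ← invertible g g≉0 = γ * g⁻¹ ,
    trans (trans (sym (*-identityʳ h)) (*-congˡ (sym (trans (*-cong gg⁻¹≈1 gg⁻¹≈1) (*-identityˡ 1#)))))
    (trans (solve 3 (λ h g i → h :* ((g :* i) :* (g :* i)) := (h :* (g :* g)) :* (i :* i)) refl h g g⁻¹)
    (trans (*-congʳ e) (solve 2 (λ γ i → (γ :* γ) :* (i :* i) := (γ :* i) :* (γ :* i)) refl γ g⁻¹)))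

module _ {c ℓ c′ ℓ′} (D : IntegralDomain c ℓ) (K : Field c′ ℓ′) where
  private module K = Field K
  open IntegralDomain D
  open Factorization D

  TorsionFree : Set (c′ ⊔ ℓ′)
  TorsionFree = ∀ n x → Algebra.Properties.Monoid.Mult._×_ K.+-monoid (suc n) x K.≈ K.0# → x K.≈ K.0#

  -- For evaluation on R[t] this holds because units are constants.
  InjectiveOnUnits : (Carrier → K.Carrier) → Set (c ⊔ ℓ ⊔ ℓ′)
  InjectiveOnUnits f = ∀ u v → IsUnit u → IsUnit v → f u K.≈ f v → u ≈ v

  -- The hypothesis on divisors in positive form: nonconstant `h` never have a square value, and for
  -- constant `h` a square root in K lies in R.
  ReflectsSquares : (Carrier → K.Carrier) → (e₁ e₂ e₃ : Carrier) → Set (c ⊔ ℓ ⊔ c′ ⊔ ℓ′)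
  ReflectsSquares f e₁ e₂ e₃ = ∀ h → SquareFree h →
    h ∣ (e₁ - e₂) * (e₁ - e₃) ⊎ h ∣ (e₂ - e₁) * (e₂ - e₃) ⊎ h ∣ (e₃ - e₁) * (e₃ - e₂) →
    Divisibility.IsSquare K.commutativeRing (f h) → ¬ ¬ Divisibility.IsSquare commutativeRing h

-- The descent by halving

module Descent
  {c ℓ c′ ℓ′} (D : IntegralDomain c ℓ) (K : Field c′ ℓ′)
  (torsionFree : TorsionFree D K)
  {ev : IntegralDomain.Carrier D → Field.Carrier K}
  (ev-hom : IsRingHomomorphism (IntegralDomain.rawRing D) (Field.rawRing K) ev)
  (factorial : Factorization.Factorial D) (unitStable : Factorization.UnitStable D)
  (ev-unit-injective : InjectiveOnUnits D K ev)
  (e₁ e₂ e₃ : IntegralDomain.Carrier D)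
  (e₁≉e₂ : ¬ IntegralDomain._≈_ D e₁ e₂)
  (e₁≉e₃ : ¬ IntegralDomain._≈_ D e₁ e₃)
  (e₂≉e₃ : ¬ IntegralDomain._≈_ D e₂ e₃)
  (squares : ReflectsSquares D K ev e₁ e₂ e₃)
  where
  private module K = Field K
  open IntegralDomain D
  open Factorization D
  open IsRingHomomorphism ev-hom
  open Relation.Binary.Reasoning.Setoid setoid
  open IntegerSolver commutativeRing using (solve; _:=_; _:+_; _:*_; _:-_; :-_)
  open Algebra.Properties.Group +-group using (x∙y⁻¹≈ε⇒x≈y; x≈y⇒x∙y⁻¹≈ε)
  private
    module KS = IntegerSolver K.commutativeRing
    module KP = Factorization (asDomain K)
    module KM = Algebra.Properties.Monoid.Mult K.+-monoid
  open FieldSquares K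

  -- An affine point (X / Z², Y / Z³) of the curve.
  record State (Z : Carrier) : Set (c ⊔ ℓ ⊔ ℓ′) where
    constructor mkState
    field
      X Y      : Carrier
      onCurve  : Y * Y ≈ (X - e₁ * (Z * Z)) * ((X - e₂ * (Z * Z)) * (X - e₃ * (Z * Z)))
      ev-X≉0   : ¬ ev X K.≈ K.0#
  open State public

  -- aᵢ² = X - eᵢ Z², with X eliminated.
  record HalfState (Z : Carrier) (α : K.Carrier) : Set (c ⊔ ℓ ⊔ ℓ′) where
    constructor mkHalf
    field
      a₁ a₂ a₃       : Carrier
      same₂          : a₁ * a₁ + e₁ * (Z * Z) ≈ a₂ * a₂ + e₂ * (Z * Z)
      same₃          : a₁ * a₁ + e₁ * (Z * Z) ≈ a₃ * a₃ + e₃ * (Z * Z)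
      ev₁ : ev a₁ K.≈ α
      ev₂ : ev a₂ K.≈ α
      ev₃ : ev a₃ K.≈ α
  open HalfState

  ev-nonzero : ∀ {x} → ¬ ev x K.≈ K.0# → ¬ x ≈ 0#
  ev-nonzero evx≉0 x≈0 = evx≉0 (K.trans (⟦⟧-cong x≈0) 0#-homo)

  ev-shifted : ∀ {Z} X e → ev Z K.≈ K.0# → ev (X - e * (Z * Z)) K.≈ ev X
  ev-shifted {Z} X e evZ≈0 = K.trans (+-homo _ _) (K.trans (K.+-congˡ (K.trans (-‿homo _)
      (K.-‿cong (K.trans (*-homo _ _) (K.*-congˡ (K.trans (*-homo _ _) (K.*-congʳ evZ≈0)))))))
    (KS.solve 3 (λ x e z → x KS.:- e KS.:* (KS.con (+ 0) KS.:* z) KS.:= x) K.refl (ev X) (ev e) (ev Z)))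

  -- Write B₁ = hg² with `h` square-free. Since B₁B₂B₃ is a square, `h` divides B₂B₃, and B₂B₃ -
  -- B₁(B₁ + d₂Z² + d₃Z²) = d₂d₃Z⁴. As `h` shares no prime with `Z`, it divides d₂d₃; its value is
  -- the square of γ / ev g, so `sq` applies to it.
  square-factor : ∀ {B₁ B₂ B₃ Y Z γ} d₂ d₃ →
    (∀ h → SquareFree h → h ∣ d₂ * d₃ →
       Divisibility.IsSquare K.commutativeRing (ev h) → ¬ ¬ Divisibility.IsSquare commutativeRing h) →
    Y * Y ≈ B₁ * (B₂ * B₃) → B₂ ≈ B₁ + d₂ * (Z * Z) → B₃ ≈ B₁ + d₃ * (Z * Z) →
    NoCommonPrime B₁ Z → ev B₁ K.≈ γ K.* γ → ¬ γ K.≈ K.0# → ¬ ¬ ∃ λ a → B₁ ≈ a * a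
  square-factor {B₁} {B₂} {B₃} {Y} {Z} {γ} d₂ d₃ sq YY≈ B₂≈ B₃≈ coprime evB₁≈γγ γ≉0 = do
    _ , fB ← factorial B₁ B₁≉0
    h , g , sf , B₁≈hgg ← squareFreePart unitStable fB
    let hgg≉0 = nonzero-resp B₁≈hgg B₁≉0
        h≉0   = *-nonzeroˡ hgg≉0
        gg≉0  = *-nonzeroʳ {h} hgg≉0
    _ , fh ← factorial h h≉0
    _ , fg ← factorial g (*-nonzeroˡ gg≉0)
    Y′ , Y≈gY′ , hB₂B₃≈Y′Y′ ← square∣square fg (begin
      (g * g) * (h * (B₂ * B₃))   ≈⟨ solve 3 (λ g h b → g :* (h :* b) := (h :* g) :* b) refl (g * g) h (B₂ * B₃) ⟩
      (h * (g * g)) * (B₂ * B₃)   ≈⟨ *-congʳ B₁≈hgg ⟨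
      B₁ * (B₂ * B₃)              ≈⟨ YY≈ ⟨
      Y * Y                       ∎)
    h∣Y′ ← squareFree∣square Y′ fh sf (divides (B₂ * B₃) (sym hB₂B₃≈Y′Y′))
    let Y″ , Y′≈hY″ = cofactor h∣Y′
        B₂B₃≈ : B₂ * B₃ ≈ h * (Y″ * Y″)
        B₂B₃≈ = cancel h _ _ h≉0 (trans hB₂B₃≈Y′Y′ (trans (*-cong Y′≈hY″ Y′≈hY″)
          (solve 2 (λ h y → (h :* y) :* (h :* y) := h :* (h :* (y :* y))) refl h Y″)))
        h∣B₁ : h ∣ B₁
        h∣B₁ = divides (g * g) B₁≈hgg
    h∣dd ← coprime-cancel (d₂ * d₃) fh
      (λ π pπ π∣h π∣ZZZZ → prime∣square pπ π∣ZZZZ λ π∣ZZ → prime∣square pπ π∣ZZ λ π∣Z →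
        coprime π pπ (∣-trans π∣h h∣B₁) π∣Z)
      (∣-respʳ (trans (+-congʳ (*-cong B₂≈ B₃≈))
         (solve 4 (λ b w d e → (b :+ d :* w) :* (b :+ e :* w) :- b :* (b :+ d :* w :+ e :* w)
             := (d :* e) :* (w :* w)) refl B₁ (Z * Z) d₂ d₃))
         (∣-- (divides (Y″ * Y″) B₂B₃≈) (∣-*ʳ (B₁ + d₂ * (Z * Z) + d₃ * (Z * Z)) h∣B₁)))
    let ev-hgg : ev h K.* (ev g K.* ev g) K.≈ γ K.* γ
        ev-hgg = K.trans (K.sym (K.trans (*-homo _ _) (K.*-congˡ (*-homo _ _))))
                   (K.trans (⟦⟧-cong (sym B₁≈hgg)) evB₁≈γγ)
        evg≉0 : ¬ ev g K.≈ K.0#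
        evg≉0 = λ e → KP.*-nonzero γ≉0 γ≉0 (K.trans (K.sym ev-hgg)
                  (K.trans (K.*-congˡ (K.trans (K.*-congˡ e) (K.zeroʳ _))) (K.zeroʳ _)))
    q , h≈qq ← sq h sf h∣dd (quotient-square evg≉0 ev-hgg)
    pure (q * g , trans B₁≈hgg (trans (*-congʳ h≈qq)
      (solve 2 (λ q g → (q :* q) :* (g :* g) := (q :* g) :* (q :* g)) refl q g)))
    where
    B₁≉0 : ¬ B₁ ≈ 0#
    B₁≉0 = ev-nonzero λ e → KP.*-nonzero γ≉0 γ≉0 (K.trans (K.sym evB₁≈γγ) e)

  double≉0 : ∀ {α} → ¬ α K.≈ K.0# → ¬ α K.+ α K.≈ K.0#
  double≉0 {α} α≉0 e = α≉0 (torsionFree 1 α (K.trans (K.+-congˡ (K.+-identityʳ α)) e))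

  -- Square roots are determined up to sign; prescribing the value α for all three keeps their sums
  -- from vanishing at t₀.
  withSign : ∀ {x α} → ev (x * x) K.≈ α K.* α → ∃ λ y → x * x ≈ y * y × ev y K.≈ α
  withSign {x} {α} e = choose (square-injective (K.trans (K.sym (*-homo x x)) e))
    where
    choose : ev x K.≈ α ⊎ ev x K.≈ K.- α → ∃ λ y → x * x ≈ y * y × ev y K.≈ α
    choose (inj₁ evx≈α)  = x , refl , evx≈α
    choose (inj₂ evx≈-α) = - x , solve 1 (λ x → x :* x := (:- x) :* (:- x)) refl x ,
      K.trans (-‿homo x) (K.trans (K.-‿cong evx≈-α) (KS.solve 1 (λ a → KS.:- (KS.:- a) KS.:= a) K.refl _))

  -- As `Z` has value 0, each X - eᵢ Z² has the value of `X`, so a single α serves all three square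
  -- roots.
  halve : ∀ {Z α} (s : State Z) → NoCommonPrime (X s) Z → ev Z K.≈ K.0# → ev (X s) K.≈ α K.* α →
          ¬ ¬ HalfState Z α
  halve {Z} {α} (mkState X Y YY≈ evX≉0) coprime evZ≈0 evX≈αα = do
    b₁ , B₁≈ ← square-factor (e₁ - e₂) (e₁ - e₃) (λ h sf d → squares h sf (inj₁ d))
      YY≈ (shift e₁ e₂) (shift e₁ e₃) (coprimeB e₁) (evB e₁) α≉0
    b₂ , B₂≈ ← square-factor (e₂ - e₁) (e₂ - e₃) (λ h sf d → squares h sf (inj₂ (inj₁ d)))
      (trans YY≈ (solve 3 (λ a b c → a :* (b :* c) := b :* (a :* c)) refl _ _ _))
      (shift e₂ e₁) (shift e₂ e₃) (coprimeB e₂) (evB e₂) α≉0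
    b₃ , B₃≈ ← square-factor (e₃ - e₁) (e₃ - e₂) (λ h sf d → squares h sf (inj₂ (inj₂ d)))
      (trans YY≈ (solve 3 (λ a b c → a :* (b :* c) := c :* (a :* b)) refl _ _ _))
      (shift e₃ e₁) (shift e₃ e₂) (coprimeB e₃) (evB e₃) α≉0
    let a₁ , sq₁ , ev₁ = withSign (K.trans (⟦⟧-cong (sym B₁≈)) (evB e₁))
        a₂ , sq₂ , ev₂ = withSign (K.trans (⟦⟧-cong (sym B₂≈)) (evB e₂))
        a₃ , sq₃ , ev₃ = withSign (K.trans (⟦⟧-cong (sym B₃≈)) (evB e₃))
        X≈₁ = recover e₁ B₁≈ sq₁
    pure (mkHalf a₁ a₂ a₃ (trans X≈₁ (sym (recover e₂ B₂≈ sq₂))) (trans X≈₁ (sym (recover e₃ B₃≈ sq₃))) ev₁ ev₂ ev₃)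
    where
    α≉0 : ¬ α K.≈ K.0#
    α≉0 α≈0 = evX≉0 (K.trans evX≈αα (K.trans (K.*-congˡ α≈0) (K.zeroʳ α)))
    evB : ∀ e → ev (X - e * (Z * Z)) K.≈ α K.* α
    evB e = K.trans (ev-shifted X e evZ≈0) evX≈αα
    shift : ∀ e e′ → X - e′ * (Z * Z) ≈ (X - e * (Z * Z)) + (e - e′) * (Z * Z)
    shift e e′ = solve 4 (λ x e e′ w → x :- e′ :* w := (x :- e :* w) :+ (e :- e′) :* w) refl X e e′ (Z * Z)
    coprimeB : ∀ e → NoCommonPrime (X - e * (Z * Z)) Z
    coprimeB e π pπ π∣B π∣Z = coprime π pπ
      (∣-respʳ (solve 3 (λ x e w → (x :- e :* w) :+ e :* w := x) refl X e (Z * Z))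
        (∣-+ π∣B (∣-*ˡ e (∣-*ʳ Z π∣Z)))) π∣Z
    recover : ∀ e {a b} → X - e * (Z * Z) ≈ b * b → b * b ≈ a * a → a * a + e * (Z * Z) ≈ X
    recover e B≈ sq = trans (+-congʳ (sym (trans B≈ sq)))
      (solve 3 (λ x e w → (x :- e :* w) :+ e :* w := x) refl X e (Z * Z))

  -- The half of a point with X - eᵢ Z² = aᵢ² has X′ - eᵢ Z² = (aᵢ + aⱼ)(aᵢ + aₖ).
  half : ∀ {Z α} → ev Z K.≈ K.0# → ¬ α K.≈ K.0# → HalfState Z α → ∃ λ (s : State Z) → ev (X s) K.≈ (α K.+ α) K.* (α K.+ α)
  half {Z} {α} evZ≈0 α≉0 (mkHalf a₁ a₂ a₃ same₂ same₃ ev₁ ev₂ ev₃) =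
    mkState X′ ((a₁ + a₂) * (a₁ + a₃) * (a₂ + a₃)) equation X′≉0 , evX′
    where
    w = Z * Z
    X′ = (a₁ + a₂) * (a₁ + a₃) + e₁ * w
    factor₂ : X′ - e₂ * w ≈ (a₁ + a₂) * (a₂ + a₃)
    factor₂ = begin
      X′ - e₂ * w
        ≈⟨ solve 6 (λ a b c e f w → ((a :+ b) :* (a :+ c) :+ e :* w) :- f :* w
             := (a :* a :+ e :* w) :+ (a :* b :+ a :* c :+ b :* c :- f :* w)) refl a₁ a₂ a₃ e₁ e₂ w ⟩
      (a₁ * a₁ + e₁ * w) + (a₁ * a₂ + a₁ * a₃ + a₂ * a₃ - e₂ * w)
        ≈⟨ +-congʳ same₂ ⟩
      (a₂ * a₂ + e₂ * w) + (a₁ * a₂ + a₁ * a₃ + a₂ * a₃ - e₂ * w)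
        ≈⟨ solve 5 (λ a b c f w → (b :* b :+ f :* w) :+ (a :* b :+ a :* c :+ b :* c :- f :* w)
             := (a :+ b) :* (b :+ c)) refl a₁ a₂ a₃ e₂ w ⟩
      (a₁ + a₂) * (a₂ + a₃) ∎
    factor₃ : X′ - e₃ * w ≈ (a₁ + a₃) * (a₂ + a₃)
    factor₃ = begin
      X′ - e₃ * w
        ≈⟨ solve 6 (λ a b c e f w → ((a :+ b) :* (a :+ c) :+ e :* w) :- f :* w
             := (a :* a :+ e :* w) :+ (a :* b :+ a :* c :+ b :* c :- f :* w)) refl a₁ a₂ a₃ e₁ e₃ w ⟩
      (a₁ * a₁ + e₁ * w) + (a₁ * a₂ + a₁ * a₃ + a₂ * a₃ - e₃ * w)
        ≈⟨ +-congʳ same₃ ⟩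
      (a₃ * a₃ + e₃ * w) + (a₁ * a₂ + a₁ * a₃ + a₂ * a₃ - e₃ * w)
        ≈⟨ solve 5 (λ a b c f w → (c :* c :+ f :* w) :+ (a :* b :+ a :* c :+ b :* c :- f :* w)
             := (a :+ c) :* (b :+ c)) refl a₁ a₂ a₃ e₃ w ⟩
      (a₁ + a₃) * (a₂ + a₃) ∎
    equation : ((a₁ + a₂) * (a₁ + a₃) * (a₂ + a₃)) * ((a₁ + a₂) * (a₁ + a₃) * (a₂ + a₃))
               ≈ (X′ - e₁ * w) * ((X′ - e₂ * w) * (X′ - e₃ * w))
    equation = trans
      (solve 3 (λ p q r → (p :* q :* r) :* (p :* q :* r) := (p :* q) :* ((p :* r) :* (q :* r))) refl
         (a₁ + a₂) (a₁ + a₃) (a₂ + a₃))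
      (sym (*-cong (solve 2 (λ x y → (x :+ y) :- y := x) refl ((a₁ + a₂) * (a₁ + a₃)) (e₁ * w))
                   (*-cong factor₂ factor₃)))
    evX′₀ : ev (X′ - e₁ * w) K.≈ (α K.+ α) K.* (α K.+ α)
    evX′₀ = K.trans (⟦⟧-cong (solve 2 (λ x y → (x :+ y) :- y := x) refl ((a₁ + a₂) * (a₁ + a₃)) (e₁ * w)))
      (K.trans (*-homo _ _) (K.*-cong (K.trans (+-homo _ _) (K.+-cong ev₁ ev₂)) (K.trans (+-homo _ _) (K.+-cong ev₁ ev₃))))
    evX′ : ev X′ K.≈ (α K.+ α) K.* (α K.+ α)
    evX′ = K.trans (K.sym (ev-shifted X′ e₁ evZ≈0)) evX′₀
    X′≉0 : ¬ ev X′ K.≈ K.0#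
    X′≉0 e = KP.*-nonzero (double≉0 α≉0) (double≉0 α≉0) (K.trans (K.sym evX′) e)

  -- By parity of exponents. All three factors X - eᵢ Z² are divisible by π, so π³ divides Y² and
  -- therefore π⁴ does. One of the cofactors x - eᵢ π Z₁² then contains another π, which gives π ∣
  -- x. Now X = π²x₁, all three factors are divisible by π², and Y = π³y₂.
  divideOut : ∀ {Z π} Z₁ → Prime π → Z ≈ π * Z₁ → (s : State Z) → π ∣ X s → ¬ ¬ State Z₁
  divideOut {Z} {π} Z₁ pπ Z≈πZ₁ (mkState X Y YY≈ evX≉0) π∣X = do
    let x , X≈πx = cofactor π∣X
    π∣Y ← prime∣square pπ (∣-respʳ (sym (trans YY≈ (*-congʳ (factor e₁ X≈πx)))) (∣-*ʳ _ (divides _ refl)))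
    let y , Y≈πy = cofactor π∣Y
        ππ≉0 = *-nonzero (nonzero pπ) (nonzero pπ)
        yy≈ : y * y ≈ π * (r x e₁ * (r x e₂ * r x e₃))
        yy≈ = cancel (π * π) _ _ ππ≉0 (begin
          (π * π) * (y * y)
            ≈⟨ solve 2 (λ p y → (p :* p) :* (y :* y) := (p :* y) :* (p :* y)) refl π y ⟩
          (π * y) * (π * y)
            ≈⟨ *-cong Y≈πy Y≈πy ⟨
          Y * Y
            ≈⟨ YY≈ ⟩
          (X - e₁ * (Z * Z)) * ((X - e₂ * (Z * Z)) * (X - e₃ * (Z * Z)))
            ≈⟨ *-cong (factor e₁ X≈πx) (*-cong (factor e₂ X≈πx) (factor e₃ X≈πx)) ⟩
          (π * r x e₁) * ((π * r x e₂) * (π * r x e₃))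
            ≈⟨ solve 4 (λ p a b c → (p :* a) :* ((p :* b) :* (p :* c)) := (p :* p) :* (p :* (a :* (b :* c)))) refl π _ _ _ ⟩
          (π * π) * (π * (r x e₁ * (r x e₂ * r x e₃))) ∎)
    π∣y ← prime∣square pπ (divides _ yy≈)
    let y₁ , y≈πy₁ = cofactor π∣y
        πy₁y₁≈ : π * (y₁ * y₁) ≈ r x e₁ * (r x e₂ * r x e₃)
        πy₁y₁≈ = cancel π _ _ (nonzero pπ) (trans
          (solve 2 (λ p y → p :* (p :* (y :* y)) := (p :* y) :* (p :* y)) refl π y₁)
          (trans (sym (*-cong y≈πy₁ y≈πy₁)) yy≈))
    π∣x ← (split pπ _ _ (divides _ (sym πy₁y₁≈)) >>= λ
      { (inj₁ d) → pure (x-divisible x e₁ d)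
      ; (inj₂ d) → split pπ _ _ d >>= λ
        { (inj₁ d) → pure (x-divisible x e₂ d)
        ; (inj₂ d) → pure (x-divisible x e₃ d) } })
    let x₁ , x≈πx₁ = cofactor π∣x
        b : Carrier → Carrier
        b e = x₁ - e * (Z₁ * Z₁)
        r≈ : ∀ e → r x e ≈ π * b e
        r≈ e = trans (+-congʳ x≈πx₁)
          (solve 4 (λ p x e z → p :* x :- e :* (p :* (z :* z)) := p :* (x :- e :* (z :* z))) refl π x₁ e Z₁)
        y₁y₁≈ : y₁ * y₁ ≈ (π * π) * (b e₁ * (b e₂ * b e₃))
        y₁y₁≈ = cancel π _ _ (nonzero pπ) (trans πy₁y₁≈ (trans (*-cong (r≈ e₁) (*-cong (r≈ e₂) (r≈ e₃)))
          (solve 4 (λ p a b c → (p :* a) :* ((p :* b) :* (p :* c)) := p :* ((p :* p) :* (a :* (b :* c)))) refl π _ _ _)))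
    π∣y₁ ← prime∣square pπ (divides _ (trans y₁y₁≈ (*-assoc π π _)))
    let y₂ , y₁≈πy₂ = cofactor π∣y₁
    pure (mkState x₁ y₂
      (cancel (π * π) _ _ ππ≉0 (trans
        (solve 2 (λ p y → (p :* p) :* (y :* y) := (p :* y) :* (p :* y)) refl π y₂)
        (trans (sym (*-cong y₁≈πy₂ y₁≈πy₂)) y₁y₁≈)))
      (λ e → evX≉0 (K.trans (⟦⟧-cong (trans X≈πx (trans (*-congˡ x≈πx₁) (sym (*-assoc π π x₁)))))
        (K.trans (*-homo _ _) (K.trans (K.*-congˡ e) (K.zeroʳ _))))))
    where
    r : Carrier → Carrier → Carrier
    r x e = x - e * (π * (Z₁ * Z₁))
    factor : ∀ e {x} → X ≈ π * x → X - e * (Z * Z) ≈ π * r x e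
    factor e {x} X≈πx = trans (+-cong X≈πx (-‿cong (*-congˡ (*-cong Z≈πZ₁ Z≈πZ₁))))
      (solve 4 (λ p x e z → p :* x :- e :* ((p :* z) :* (p :* z)) := p :* (x :- e :* (p :* (z :* z)))) refl π x e Z₁)
    x-divisible : ∀ x e → π ∣ r x e → π ∣ x
    x-divisible x e d = ∣-respʳ (solve 2 (λ x y → (x :- y) :+ y := x) refl x (e * (π * (Z₁ * Z₁))))
      (∣-+ d (∣-*ˡ e (∣-*ʳ (Z₁ * Z₁) ∣-refl)))

  -- The α of successive halvings: powers of 2 times the first one.
  data Scale (α : K.Carrier) : K.Carrier → Set c′ where
    here   : Scale α α
    double : ∀ {β} → Scale α β → Scale α (β K.+ β)

  Scale-trans : ∀ {α β γ} → Scale α β → Scale β γ → Scale α γ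
  Scale-trans s here       = s
  Scale-trans s (double t) = double (Scale-trans s t)

  Scale-multiple : ∀ {α β} → Scale (α K.+ α) β → ∃ λ n → β K.≈ suc (suc n) KM.× α
  Scale-multiple here = 0 , K.+-congˡ (K.sym (K.+-identityʳ _))
  Scale-multiple {α} (double s) =
    let n , β≈ = Scale-multiple s
    in n ℕ.+ suc (suc n) , K.trans (K.+-cong β≈ β≈) (K.sym (KM.×-homo-+ α (suc (suc n)) (suc (suc n))))

  -- Here β = mα with m ≥ 2, so α = β or α = -β would make (m - 1)α or (m + 1)α vanish.
  Scale-square : ∀ {α β} → ¬ α K.≈ K.0# → Scale (α K.+ α) β → ¬ α K.* α K.≈ β K.* β
  Scale-square {α} {β} α≉0 s e = contradict (Scale-multiple s) (square-injective e)
    where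
    contradict : (∃ λ n → β K.≈ suc (suc n) KM.× α) → ¬ (α K.≈ β ⊎ α K.≈ K.- β)
    contradict (n , β≈) (inj₁ α≈β)  = α≉0 (torsionFree n α (K.trans
      (KS.solve 2 (λ a m → m KS.:= (a KS.:+ m) KS.:- a) K.refl α (suc n KM.× α))
      (K.trans (K.+-congʳ (K.trans (K.sym β≈) (K.sym α≈β))) (K.-‿inverseʳ α))))
    contradict (n , β≈) (inj₂ α≈-β) = α≉0 (torsionFree (suc (suc n)) α
      (K.trans (K.+-cong α≈-β (K.sym β≈)) (K.-‿inverseˡ β)))

  Class : Carrier × Carrier → ∀ {Z α} → HalfState Z α → Set (c ⊔ ℓ)
  Class (l , l′) s = Associated (a₁ s + a₂ s) l × Associated (a₁ s + a₃ s) l′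

  associated-ratio : ∀ {x y l} → Associated x l → Associated y l → ∃ λ u → IsUnit u × y ≈ u * x
  associated-ratio {x} {y} {l} (u , uu , x≈ul) (v , uv , y≈vl) =
    let w , 1≈uw = cofactor uu
    in v * w , unit-* uv (divides u (trans 1≈uw (*-comm u w))) , (begin
      y                     ≈⟨ y≈vl ⟩
      v * l                 ≈⟨ *-congʳ (*-identityʳ v) ⟨
      (v * 1#) * l          ≈⟨ *-congʳ (*-congˡ 1≈uw) ⟩
      (v * (u * w)) * l     ≈⟨ solve 4 (λ v u w l → (v :* (u :* w)) :* l := (v :* w) :* (u :* l)) refl v u w l ⟩
      (v * w) * (u * l)     ≈⟨ *-congˡ x≈ul ⟨
      (v * w) * x           ∎)

  -- The two ratios are units with the same value, hence one unit u; the sums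
  -- aᵢ + aⱼ scale by u and the differences by its inverse, which forces u² = 1.
  class-determines-square : ∀ {Z α β} l → ¬ Z ≈ 0# → ¬ α K.≈ K.0# → (s : HalfState Z α) (t : HalfState Z β) →
    Class l s → Class l t → α K.* α K.≈ β K.* β
  class-determines-square {Z} {α} {β} (l , l′) Z≉0 α≉0
    (mkHalf a₁ a₂ a₃ same₂ same₃ ev₁ ev₂ ev₃) (mkHalf b₁ b₂ b₃ tame₂ tame₃ fv₁ fv₂ fv₃) (c₂ , c₃) (d₂ , d₃) =
    K.sym (K.trans (K.*-cong β≈uα β≈uα)
      (K.trans (KS.solve 2 (λ u a → (u KS.:* a) KS.:* (u KS.:* a) KS.:= (u KS.:* u) KS.:* (a KS.:* a)) K.refl (ev u) α)
      (K.trans (K.*-congʳ (K.trans (K.sym (*-homo u u)) (K.trans (⟦⟧-cong uu≈1) 1#-homo))) (K.*-identityˡ _))))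
    where
    w = Z * Z
    ratio₂ = associated-ratio c₂ d₂
    ratio₃ = associated-ratio c₃ d₃
    u = proj₁ ratio₂
    v = proj₁ ratio₃
    uu = proj₁ (proj₂ ratio₂)
    uv = proj₁ (proj₂ ratio₃)
    sum₂ : b₁ + b₂ ≈ u * (a₁ + a₂)
    sum₂ = proj₂ (proj₂ ratio₂)
    sum₃ : b₁ + b₃ ≈ v * (a₁ + a₃)
    sum₃ = proj₂ (proj₂ ratio₃)
    -- The sums have the values 2α and 2β; the factor 2 cancels because K is torsion-free.
    ev-ratio : ∀ {u x y x′ y′} → ev x K.≈ α → ev y K.≈ α → ev x′ K.≈ β → ev y′ K.≈ β →
               x′ + y′ ≈ u * (x + y) → β K.≈ ev u K.* α
    ev-ratio {u} {x} {y} {x′} {y′} evx evy evx′ evy′ e = KG.x∙y⁻¹≈ε⇒x≈y β (ev u K.* α) (torsionFree 1 _ (K.trans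
      (KS.solve 3 (λ b u a → (b KS.:- u KS.:* a) KS.:+ ((b KS.:- u KS.:* a) KS.:+ KS.con (+ 0))
          KS.:= (b KS.:+ b) KS.:- u KS.:* (a KS.:+ a)) K.refl β (ev u) α)
      (KG.x≈y⇒x∙y⁻¹≈ε (K.trans (K.sym (K.trans (+-homo x′ y′) (K.+-cong evx′ evy′)))
        (K.trans (⟦⟧-cong e) (K.trans (*-homo u _) (K.*-congˡ (K.trans (+-homo x y) (K.+-cong evx evy)))))))))
      where
      module KG = Algebra.Properties.Group K.+-group
    β≈uα : β K.≈ ev u K.* α
    β≈uα = ev-ratio ev₁ ev₂ fv₁ fv₂ sum₂
    v≈u : v ≈ u
    v≈u = ev-unit-injective v u uv uu (KP.cancelʳ α≉0
      (K.trans (K.sym (ev-ratio ev₁ ev₃ fv₁ fv₃ sum₃)) β≈uα))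
    difference : ∀ {x y x′ y′ d e t} → ev x K.≈ α → ev y K.≈ α → t ≈ u →
      x * x + d * w ≈ y * y + e * w → x′ * x′ + d * w ≈ y′ * y′ + e * w →
      x′ + y′ ≈ t * (x + y) → x - y ≈ u * (x′ - y′)
    difference {x} {y} {x′} {y′} {d} {e} {t} evx evy t≈u same same′ sum = cancel (x + y) _ _
      (ev-nonzero λ z → double≉0 α≉0 (K.trans (K.sym (K.trans (+-homo x y) (K.+-cong evx evy))) z)) (begin
        (x + y) * (x - y)            ≈⟨ product-formula same ⟩
        (e - d) * w                  ≈⟨ product-formula same′ ⟨
        (x′ + y′) * (x′ - y′)        ≈⟨ *-congʳ (trans sum (*-congʳ t≈u)) ⟩
        (u * (x + y)) * (x′ - y′)    ≈⟨ solve 3 (λ u s d → (u :* s) :* d := s :* (u :* d)) refl u _ _ ⟩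
        (x + y) * (u * (x′ - y′))    ∎)
      where
      product-formula : ∀ {x y} → x * x + d * w ≈ y * y + e * w → (x + y) * (x - y) ≈ (e - d) * w
      product-formula {x} {y} same = begin
        (x + y) * (x - y)
          ≈⟨ solve 4 (λ x y d w → (x :+ y) :* (x :- y) := (x :* x :+ d :* w) :- (y :* y :+ d :* w)) refl x y d w ⟩
        (x * x + d * w) - (y * y + d * w)
          ≈⟨ +-congʳ same ⟩
        (y * y + e * w) - (y * y + d * w)
          ≈⟨ solve 4 (λ y d e w → (y :* y :+ e :* w) :- (y :* y :+ d :* w) := (e :- d) :* w) refl y d e w ⟩
        (e - d) * w ∎
    a₃-a₂≉0 : ¬ a₃ - a₂ ≈ 0#
    a₃-a₂≉0 e = e₂≉e₃ (cancel w _ _ (*-nonzero Z≉0 Z≉0) (trans (*-comm w e₂) (trans (begin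
        e₂ * w                           ≈⟨ solve 2 (λ a b → b := (a :+ b) :- a) refl (a₂ * a₂) (e₂ * w) ⟩
        (a₂ * a₂ + e₂ * w) - a₂ * a₂     ≈⟨ +-cong (trans (sym same₂) same₃) (-‿cong (*-cong (sym a₃≈a₂) (sym a₃≈a₂))) ⟩
        (a₃ * a₃ + e₃ * w) - a₃ * a₃     ≈⟨ solve 2 (λ a b → (a :+ b) :- a := b) refl (a₃ * a₃) (e₃ * w) ⟩
        e₃ * w                           ∎) (*-comm e₃ w))))
      where
      a₃≈a₂ = x∙y⁻¹≈ε⇒x≈y a₃ a₂ e
    uu≈1 : u * u ≈ 1#
    -- a₃ - a₂ equals both (a₁ - a₂) - (a₁ - a₃) and (a₁ + a₃) - (a₁ + a₂). From one state to the
    -- other it is therefore scaled by the inverse of u and also by u.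
    uu≈1 = cancel (a₃ - a₂) _ _ a₃-a₂≉0 (sym (begin
      (a₃ - a₂) * 1#
        ≈⟨ *-identityʳ _ ⟩
      a₃ - a₂
        ≈⟨ solve 3 (λ a b c → c :- b := (a :- b) :- (a :- c)) refl a₁ a₂ a₃ ⟩
      (a₁ - a₂) - (a₁ - a₃)
        ≈⟨ +-cong (difference ev₁ ev₂ refl same₂ tame₂ sum₂) (-‿cong (difference ev₁ ev₃ v≈u same₃ tame₃ sum₃)) ⟩
      u * (b₁ - b₂) - u * (b₁ - b₃)
        ≈⟨ solve 4 (λ u a b c → u :* (a :- b) :- u :* (a :- c) := u :* ((a :+ c) :- (a :+ b))) refl u b₁ b₂ b₃ ⟩
      u * ((b₁ + b₃) - (b₁ + b₂))
        ≈⟨ *-congˡ (+-cong (trans sum₃ (*-congʳ v≈u)) (-‿cong sum₂)) ⟩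
      u * (u * (a₁ + a₃) - u * (a₁ + a₂))
        ≈⟨ solve 4 (λ u a b c → u :* (u :* (a :+ c) :- u :* (a :+ b)) := (c :- b) :* (u :* u)) refl u a₁ a₂ a₃ ⟩
      (a₃ - a₂) * (u * u) ∎))

  module _ {Z} (Z≉0 : ¬ Z ≈ 0#) (evZ≈0 : ev Z K.≈ K.0#) (coprime : (s : State Z) → NoCommonPrime (X s) Z) where

    redouble : ∀ {α} → ¬ α K.≈ K.0# → HalfState Z α → ¬ ¬ HalfState Z (α K.+ α)
    redouble α≉0 s = let t , evX≈ = half evZ≈0 α≉0 s in halve t (coprime t) evZ≈0 evX≈

    Scale≉0 : ∀ {α β} → ¬ α K.≈ K.0# → Scale α β → ¬ β K.≈ K.0#
    Scale≉0 α≉0 here       = α≉0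
    Scale≉0 α≉0 (double s) = double≉0 (Scale≉0 α≉0 s)

    -- (p + q)(p - q) = (e - d) Z², and a prime common to p + q and `Z` would divide `X s`, against
    -- `coprime`; so all of p + q goes into e - d.
    sum∣ : ∀ {α p q d e} → ¬ α K.≈ K.0# → ev p K.≈ α → ev q K.≈ α → (s : State Z) →
           (∀ {π} → π ∣ p + q → π ∣ Z → π ∣ X s) → p * p + d * (Z * Z) ≈ q * q + e * (Z * Z) →
           ¬ ¬ p + q ∣ e - d
    sum∣ {α} {p} {q} {d} {e} α≉0 evp evq s ∣X same = do
      _ , f ← factorial (p + q) (ev-nonzero λ z →
                double≉0 α≉0 (K.trans (K.sym (K.trans (+-homo p q) (K.+-cong evp evq))) z))
      coprime-cancel (e - d) f
        (λ π pπ π∣p+q π∣ZZ → prime∣square pπ π∣ZZ λ π∣Z → coprime s π pπ (∣X π∣p+q π∣Z) π∣Z)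
        (divides (p - q) (begin
          (e - d) * w
            ≈⟨ solve 4 (λ y d e w → (e :- d) :* w := (y :* y :+ e :* w) :- (y :* y :+ d :* w)) refl q d e w ⟩
          (q * q + e * w) - (q * q + d * w)
            ≈⟨ +-congʳ same ⟨
          (p * p + d * w) - (q * q + d * w)
            ≈⟨ solve 4 (λ x y d w → (x :* x :+ d :* w) :- (y :* y :+ d :* w) := (x :+ y) :* (x :- y)) refl p q d w ⟩
          (p + q) * (p - q) ∎))
      where
      w = Z * Z

    classes : (∃₂ λ L L′ → (∀ d → d ∣ e₂ - e₁ → ¬ ¬ Any (Associated d) L) × (∀ d → d ∣ e₃ - e₁ → ¬ ¬ Any (Associated d) L′)) →
              ∃ λ L → ∀ {α} → ¬ α K.≈ K.0# → (s : HalfState Z α) → ¬ ¬ Any (λ l → Class l s) L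
    classes (L , L′ , covers , covers′) = cartesianProduct L L′ , λ α≉0 s@(mkHalf a₁ a₂ a₃ same₂ same₃ ev₁ ev₂ ev₃) → do
      let t = proj₁ (half evZ≈0 α≉0 s)
      d₂ ← sum∣ α≉0 ev₁ ev₂ t (λ π∣ π∣Z → ∣-+ (∣-*ʳ _ π∣) (∣-*ˡ e₁ (∣-*ʳ Z π∣Z))) same₂
      d₃ ← sum∣ α≉0 ev₁ ev₃ t (λ π∣ π∣Z → ∣-+ (∣-*ˡ _ π∣) (∣-*ˡ e₁ (∣-*ʳ Z π∣Z))) same₃
      any ← covers _ d₂
      any′ ← covers′ _ d₃
      pure (Any.cartesianProduct⁺ any any′)

    -- Pigeonhole by induction on the list of classes. If no state along the scale lies in the first
    -- class, that class is dropped. If one with value β does, none from 2β on can, because equal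
    -- classes would force equal squares; the argument restarts at 2β without that class.
    exhaust : ∀ L {α} → ¬ α K.≈ K.0# →
              (∀ {β} → Scale α β → (s : HalfState Z β) → ¬ ¬ Any (λ l → Class l s) L) → ¬ HalfState Z α
    exhaust [] α≉0 covers s = covers here s λ ()
    exhaust (l ∷ L) {α} α≉0 covers s =
      ¬¬-excluded-middle {A = ∃ λ β → Scale α β × ∃ λ (t : HalfState Z β) → Class l t} λ
        { (no none) → exhaust L α≉0 (λ {β} sc t → covers sc t >>= λ
            { (here c)    → ⊥-elim (none (β , sc , t , c))
            ; (there any) → pure any }) s
        ; (yes (β , αβ , t , c)) →
            let β≉0 = Scale≉0 α≉0 αβ
            in redouble β≉0 t (exhaust L (double≉0 β≉0) λ sc t′ → covers (Scale-trans (double αβ) sc) t′ >>= λ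
              { (here c′)   → ⊥-elim (Scale-square β≉0 sc (class-determines-square l Z≉0 β≉0 t t′ c c′))
              ; (there any) → pure any })
        }

  -- The induction on `n` supplies coprimality for every state over `Z`: a common prime π of `X` and
  -- `Z` would lead by `divideOut` to a state over Z / π. That quotient still vanishes at t₀, since
  -- π divides `X` and so does not vanish there.
  no-state : ∀ n Z → Factors n Z → ev Z K.≈ K.0# → ¬ State Z
  no-state n Z f evZ≈0 s₀ = (do
      _ , f₂ ← factorial (e₂ - e₁) (λ e → e₁≉e₂ (sym (x∙y⁻¹≈ε⇒x≈y e₂ e₁ e)))
      _ , f₃ ← factorial (e₃ - e₁) (λ e → e₁≉e₃ (sym (x∙y⁻¹≈ε⇒x≈y e₃ e₁ e)))
      let L , covers = divisors f₂
          L′ , covers′ = divisors f₃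
          M , coversM = classes Z≉0 evZ≈0 coprime (L , L′ , covers , covers′)
      s ← halve s₀ (coprime s₀) evZ≈0 evX≈γγ
      λ _ → exhaust Z≉0 evZ≈0 coprime M γ≉0 (λ sc t → coversM (Scale≉0 Z≉0 evZ≈0 coprime γ≉0 sc) t) s) id
    where
    Z≉0 : ¬ Z ≈ 0#
    Z≉0 = Factors-nonzero f
    coprime : (s : State Z) → NoCommonPrime (X s) Z
    coprime s π pπ π∣X π∣Z =
      let Z₁ , Z≈πZ₁ = cofactor π∣Z
          x , X≈πx = cofactor π∣X
          evπ≉0 : ¬ ev π K.≈ K.0#
          evπ≉0 = λ e → ev-X≉0 s (K.trans (⟦⟧-cong X≈πx) (K.trans (*-homo π x) (K.trans (K.*-congʳ e) (K.zeroˡ _))))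
          evZ₁≈0 = K.cancel (ev π) (ev Z₁) K.0# evπ≉0
            (K.trans (K.sym (*-homo π Z₁)) (K.trans (⟦⟧-cong (sym Z≈πZ₁)) (K.trans evZ≈0 (K.sym (K.zeroʳ _)))))
      in cancel-prime f pπ Z≈πZ₁ λ { (m , ≡.refl , f₁) → divideOut Z₁ pπ Z≈πZ₁ s π∣X (no-state m Z₁ f₁ evZ₁≈0) }
    evY² : ev (Y s₀) K.* ev (Y s₀) K.≈ ev (X s₀) K.* (ev (X s₀) K.* ev (X s₀))
    evY² = K.trans (K.sym (*-homo _ _)) (K.trans (⟦⟧-cong (onCurve s₀)) (K.trans (*-homo _ _)
      (K.*-cong (ev-shifted (X s₀) e₁ evZ≈0) (K.trans (*-homo _ _)
        (K.*-cong (ev-shifted (X s₀) e₂ evZ≈0) (ev-shifted (X s₀) e₃ evZ≈0))))))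
    -- ev Y² = (ev X)³, so the root is ev Y / ev X; it starts the sequence of α.
    square : ∃ λ γ → ev (X s₀) K.≈ γ K.* γ
    square = quotient-square (ev-X≉0 s₀) (K.sym evY²)
    evX≈γγ = proj₂ square
    γ≉0 : ¬ proj₁ square K.≈ K.0#
    γ≉0 e = ev-X≉0 s₀ (K.trans evX≈γγ (K.trans (K.*-congʳ e) (K.zeroˡ _)))

-- From a trivial kernel to injectivity, by explicit formulas

module Cubics {c ℓ c′ ℓ′} (D : IntegralDomain c ℓ) (K : Field c′ ℓ′)
  (double≉0 : ∀ {α} → ¬ Field._≈_ K α (Field.0# K) → ¬ Field._≈_ K (Field._+_ K α α) (Field.0# K))
  {ev : IntegralDomain.Carrier D → Field.Carrier K}
  (ev-hom : IsRingHomomorphism (IntegralDomain.rawRing D) (Field.rawRing K) ev)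
  where
  private
    module K = Field K
    module F = Factorization D
  open IntegralDomain D
  open F using (*-nonzero)
  open IsRingHomomorphism ev-hom
  open Relation.Binary.Reasoning.Setoid setoid
  open IntegerSolver commutativeRing using (solve; _:=_; _:+_; _:*_; _:-_)
  open Algebra.Properties.Group +-group using (x∙y⁻¹≈ε⇒x≈y; x≈y⇒x∙y⁻¹≈ε)
  private
    module KS = IntegerSolver K.commutativeRing
    module KP = Factorization (asDomain K)
    module KG = Algebra.Properties.Group K.+-group
  open FieldSquares K

  ev-- : ∀ x y → ev (x - y) K.≈ ev x K.- ev y
  ev-- x y = K.trans (+-homo x _) (K.+-congˡ (-‿homo y))

  ev-*-≈0ˡ : ∀ {x} y → ev x K.≈ K.0# → ev (x * y) K.≈ K.0#
  ev-*-≈0ˡ y e = K.trans (*-homo _ y) (K.trans (K.*-congʳ e) (K.zeroˡ _))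

  ev-*-≈0ʳ : ∀ x {y} → ev y K.≈ K.0# → ev (x * y) K.≈ K.0#
  ev-*-≈0ʳ x e = K.trans (*-homo x _) (K.trans (K.*-congˡ e) (K.zeroʳ _))

  ev-+-≈0 : ∀ {x y} → ev x K.≈ K.0# → ev y K.≈ K.0# → ev (x + y) K.≈ K.0#
  ev-+-≈0 e f = K.trans (+-homo _ _) (K.trans (K.+-cong e f) (K.+-identityˡ _))

  ev-*-≉0 : ∀ {x y} → ¬ ev x K.≈ K.0# → ¬ ev y K.≈ K.0# → ¬ ev (x * y) K.≈ K.0#
  ev-*-≉0 x≉0 y≉0 e = KP.*-nonzero x≉0 y≉0 (K.trans (K.sym (*-homo _ _)) e)

  ev-+-≉0 : ∀ {x y} → ¬ ev x K.≈ K.0# → ev y K.≈ K.0# → ¬ ev (x + y) K.≈ K.0#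
  ev-+-≉0 x≉0 y≈0 e = x≉0 (K.trans (K.sym (K.trans (+-homo _ _) (K.trans (K.+-congˡ y≈0) (K.+-identityʳ _)))) e)

  ≉0-ev : ∀ {x} → ¬ ev x K.≈ K.0# → ¬ x ≈ 0#
  ≉0-ev evx≉0 x≈0 = evx≉0 (K.trans (⟦⟧-cong x≈0) 0#-homo)

  module Roots (e₁ e₂ e₃ : Carrier) where

    OnCubic : Carrier → Carrier → Carrier → Set ℓ
    OnCubic x y z = y * y * z ≈ (x - e₁ * z) * ((x - e₂ * z) * (x - e₃ * z))

    OnWeighted : Carrier → Carrier → Carrier → Set ℓ
    OnWeighted X Y Z = Y * Y ≈ (X - e₁ * (Z * Z)) * ((X - e₂ * (Z * Z)) * (X - e₃ * (Z * Z)))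

    -- The point (X / Z² , Y / Z³) specializes to the point at infinity.
    NoKernel : Set (c ⊔ ℓ ⊔ ℓ′)
    NoKernel = ∀ X Y Z → OnWeighted X Y Z → ¬ ev X K.≈ K.0# → ev Z K.≈ K.0# → Z ≈ 0#

  swap₂ : ∀ {e₁ e₂ e₃} → Roots.NoKernel e₁ e₂ e₃ → Roots.NoKernel e₂ e₁ e₃
  swap₂ noKernel X Y Z e = noKernel X Y Z (trans e (solve 3 (λ a b c → a :* (b :* c) := b :* (a :* c)) refl _ _ _))

  swap₃ : ∀ {e₁ e₂ e₃} → Roots.NoKernel e₁ e₂ e₃ → Roots.NoKernel e₃ e₁ e₂
  swap₃ noKernel X Y Z e = noKernel X Y Z (trans e (solve 3 (λ a b c → a :* (b :* c) := b :* (c :* a)) refl _ _ _))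

  module _ (e₁ e₂ e₃ : Carrier) (noKernel : Roots.NoKernel e₁ e₂ e₃) where
    open Roots e₁ e₂ e₃

    -- x/z = U/x² near the point at infinity.
    infinity : ∀ {x y z} → OnCubic x y z → ev x K.≈ K.0# → ev z K.≈ K.0# → ¬ ev y K.≈ K.0# → x ≈ 0# × z ≈ 0#
    infinity {x} {y} {z} on x₀≈0 z₀≈0 y₀≉0 = x≈0 , z≈0
      where
      s₁ = e₁ + e₂ + e₃
      s₂ = e₁ * e₂ + e₁ * e₃ + e₂ * e₃
      s₃ = e₁ * e₂ * e₃
      -- The cubic in x and z expands to x³ - zV, so the curve equation becomes zU = x³. Hence x/z =
      -- U/x² and y/z = yU/x³, and U has the nonzero value of y² at t₀.
      V U : Carrier
      V = s₁ * (x * x) - s₂ * (x * z) + s₃ * (z * z)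
      U = y * y + V
      zU≈xxx : z * U ≈ x * x * x
      zU≈xxx = begin
        z * U
          ≈⟨ solve 3 (λ y z v → z :* (y :* y :+ v) := y :* y :* z :+ z :* v) refl y z V ⟩
        y * y * z + z * V
          ≈⟨ +-congʳ on ⟩
        (x - e₁ * z) * ((x - e₂ * z) * (x - e₃ * z)) + z * V
          ≈⟨ solve 5 (λ x z a b c → (x :- a :* z) :* ((x :- b :* z) :* (x :- c :* z))
               :+ z :* ((a :+ b :+ c) :* (x :* x) :- (a :* b :+ a :* c :+ b :* c) :* (x :* z) :+ (a :* b :* c) :* (z :* z))
               := x :* x :* x) refl x z e₁ e₂ e₃ ⟩
        x * x * x ∎
      onWeighted : OnWeighted U (y * U) x
      onWeighted = begin
        (y * U) * (y * U)
          ≈⟨ solve 7 (λ x y z a b c u → (y :* u) :* (y :* u)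
               := u :* u :* (y :* y :+ (a :* (x :* x) :- b :* (x :* z) :+ c :* (z :* z)))
                  :- (a :* (x :* x) :* (u :* u) :- b :* x :* u :* (z :* u) :+ c :* ((z :* u) :* (z :* u))))
               refl x y z s₁ s₂ s₃ U ⟩
        U * U * U - (s₁ * (x * x) * (U * U) - s₂ * x * U * (z * U) + s₃ * ((z * U) * (z * U)))
          ≈⟨ +-congˡ (-‿cong (+-cong (+-congˡ (-‿cong (*-congˡ zU≈xxx))) (*-congˡ (*-cong zU≈xxx zU≈xxx)))) ⟩
        U * U * U - (s₁ * (x * x) * (U * U) - s₂ * x * U * (x * x * x) + s₃ * ((x * x * x) * (x * x * x)))
          ≈⟨ solve 5 (λ x a b c u →
               u :* u :* u :- ((a :+ b :+ c) :* (x :* x) :* (u :* u)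
                 :- (a :* b :+ a :* c :+ b :* c) :* x :* u :* (x :* x :* x)
                 :+ (a :* b :* c) :* ((x :* x :* x) :* (x :* x :* x)))
               := (u :- a :* (x :* x)) :* ((u :- b :* (x :* x)) :* (u :- c :* (x :* x))))
               refl x e₁ e₂ e₃ U ⟩
        (U - e₁ * (x * x)) * ((U - e₂ * (x * x)) * (U - e₃ * (x * x))) ∎
      U₀≉0 : ¬ ev U K.≈ K.0#
      U₀≉0 = ev-+-≉0 (ev-*-≉0 y₀≉0 y₀≉0) (ev-+-≈0 (K.trans (ev-- _ _) (K.trans
        (K.+-cong (ev-*-≈0ʳ s₁ (ev-*-≈0ˡ x x₀≈0)) (K.-‿cong (ev-*-≈0ʳ s₂ (ev-*-≈0ˡ z x₀≈0)))) (K.-‿inverseʳ K.0#)))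
        (ev-*-≈0ʳ s₃ (ev-*-≈0ˡ z z₀≈0)))
      x≈0 : x ≈ 0#
      x≈0 = noKernel U (y * U) x onWeighted U₀≉0 x₀≈0
      z≈0 : z ≈ 0#
      z≈0 = F.cancelʳ (≉0-ev U₀≉0) (trans zU≈xxx (trans (*-congˡ x≈0) (trans (zeroʳ _) (sym (zeroˡ U)))))

    -- X / Z² is the x-coordinate of the translate by the 2-torsion point (e₁ , 0).
    twoTorsion : ∀ {x y z} → ¬ ev e₁ K.≈ ev e₂ → ¬ ev e₁ K.≈ ev e₃ → OnCubic x y z →
                 ev x K.≈ ev (e₁ * z) → ev y K.≈ K.0# → ¬ ev z K.≈ K.0# → x ≈ e₁ * z × y ≈ 0#
    twoTorsion {x} {y} {z} e₁₂≉0 e₁₃≉0 on x₀≈ y₀≈0 z₀≉0 = x≈e₁z , y≈0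
      where
      A₁ = x - e₁ * z
      A₂ = x - e₂ * z
      A₃ = x - e₃ * z
      d₂ = e₁ - e₂
      d₃ = e₁ - e₃
      -- Translation by (e₁ , 0) sends x/z to e₁ + d₂d₃z/A₁. With Z² = y²z² = A₁A₂A₃z as denominator
      -- its numerator is `X`. A point that meets (e₁ , 0) at t₀ is thus moved to infinity there.
      X Y Z : Carrier
      X = d₂ * d₃ * (A₂ * A₃ * (z * z)) + e₁ * (Z * Z)
      Y = d₂ * d₃ * ((A₂ * A₃ * z) * (A₂ * A₃ * z))
      Z = y * z
      ZZ≈ : Z * Z ≈ A₁ * (A₂ * A₃) * z
      ZZ≈ = trans (solve 2 (λ y z → (y :* z) :* (y :* z) := (y :* y :* z) :* z) refl y z) (*-congʳ on)
      factor : ∀ e → X - e * (Z * Z) ≈ d₂ * d₃ * (A₂ * A₃ * (z * z)) + (e₁ - e) * (A₁ * (A₂ * A₃) * z)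
      factor e = trans (solve 4 (λ b a e w → (b :+ a :* w) :- e :* w := b :+ (a :- e) :* w) refl _ e₁ e (Z * Z))
                   (+-congˡ (*-congˡ ZZ≈))
      onWeighted : OnWeighted X Y Z
      onWeighted = sym (begin
        (X - e₁ * (Z * Z)) * ((X - e₂ * (Z * Z)) * (X - e₃ * (Z * Z)))
          ≈⟨ *-cong (factor e₁) (*-cong (factor e₂) (factor e₃)) ⟩
        _ ≈⟨ *-cong
               (solve 4 (λ a b e w → b :+ (e :- e) :* w := b) refl A₁ (d₂ * d₃ * (A₂ * A₃ * (z * z))) e₁ (A₁ * (A₂ * A₃) * z))
               (*-cong
               (solve 7 (λ x z e f g a b → (e :- f) :* (e :- g) :* (a :* b :* (z :* z)) :+ (e :- f) :* ((x :- e :* z) :* (a :* b) :* z)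
                   := (e :- f) :* (a :* b :* z) :* (x :- g :* z)) refl x z e₁ e₂ e₃ A₂ A₃)
               (solve 7 (λ x z e f g a b → (e :- f) :* (e :- g) :* (a :* b :* (z :* z)) :+ (e :- g) :* ((x :- e :* z) :* (a :* b) :* z)
                   := (e :- g) :* (a :* b :* z) :* (x :- f :* z)) refl x z e₁ e₂ e₃ A₂ A₃)) ⟩
        (d₂ * d₃ * (A₂ * A₃ * (z * z))) * ((d₂ * (A₂ * A₃ * z) * A₃) * (d₃ * (A₂ * A₃ * z) * A₂))
          ≈⟨ solve 5 (λ d e a b z → (d :* e :* (a :* b :* (z :* z))) :* ((d :* (a :* b :* z) :* b) :* (e :* (a :* b :* z) :* a))
               := (d :* e :* ((a :* b :* z) :* (a :* b :* z))) :* (d :* e :* ((a :* b :* z) :* (a :* b :* z))))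
               refl d₂ d₃ A₂ A₃ z ⟩
        Y * Y ∎)
      difference≉0 : ∀ {e} → ¬ ev e₁ K.≈ ev e → ¬ ev (e₁ - e) K.≈ K.0#
      difference≉0 {e} e₁≉e d = e₁≉e (KG.x∙y⁻¹≈ε⇒x≈y _ _ (K.trans (K.sym (ev-- e₁ e)) d))
      A≉0 : ∀ {e} → ¬ ev e₁ K.≈ ev e → ¬ ev (x - e * z) K.≈ K.0#
      A≉0 {e} e₁≉e a = ev-*-≉0 (difference≉0 e₁≉e) z₀≉0 (K.trans
        (K.trans (⟦⟧-cong (solve 3 (λ a e z → (a :- e) :* z := a :* z :- e :* z) refl e₁ e z))
          (K.trans (ev-- _ _) (K.trans (K.+-congʳ (K.sym x₀≈)) (K.sym (ev-- _ _))))) a)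
      Z₀≈0 : ev Z K.≈ K.0#
      Z₀≈0 = ev-*-≈0ˡ z y₀≈0
      X₀≉0 : ¬ ev X K.≈ K.0#
      X₀≉0 = ev-+-≉0 (ev-*-≉0 (ev-*-≉0 (difference≉0 e₁₂≉0) (difference≉0 e₁₃≉0))
                       (ev-*-≉0 (ev-*-≉0 (A≉0 e₁₂≉0) (A≉0 e₁₃≉0)) (ev-*-≉0 z₀≉0 z₀≉0)))
                     (ev-*-≈0ʳ e₁ (ev-*-≈0ˡ Z Z₀≈0))
      y≈0 : y ≈ 0#
      y≈0 = F.cancelʳ (≉0-ev z₀≉0) (trans (noKernel X Y Z onWeighted X₀≉0 Z₀≈0) (sym (zeroˡ z)))
      x≈e₁z : x ≈ e₁ * z
      x≈e₁z = x∙y⁻¹≈ε⇒x≈y _ _ (F.cancelʳ (*-nonzero (≉0-ev (A≉0 e₁₂≉0)) (≉0-ev (A≉0 e₁₃≉0)))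
        (trans (sym on) (trans (*-congʳ (trans (*-congʳ y≈0) (zeroˡ y))) (trans (zeroˡ z) (sym (zeroˡ _))))))

    -- N / (u d)² is the x-coordinate of the difference of the points (Xᵢ / d² , Yᵢ / d³).
    chord : ∀ {X₁ Y₁ X₂ Y₂ d} → OnWeighted X₁ Y₁ d → OnWeighted X₂ Y₂ d → ¬ ev d K.≈ K.0# →
            ev X₁ K.≈ ev X₂ → ev Y₁ K.≈ ev Y₂ → ¬ ev Y₁ K.≈ K.0# → X₁ ≈ X₂ × Y₁ ≈ Y₂
    chord {X₁} {Y₁} {X₂} {Y₂} {d} on₁ on₂ d₀≉0 X₀ Y₀ Y₁₀≉0 = sym X₂≈X₁ , Y₁≈Y₂
      where
      B₁ = X₁ - e₁ * (d * d)
      B₂ = X₁ - e₂ * (d * d)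
      B₃ = X₁ - e₃ * (d * d)
      -- With T = x - X₁ the cubic is T³ + f₂T² + f₁T + B₁B₂B₃. The line through (X₁ , -Y₁) and (X₂
      -- , Y₂) has slope m/u; its third point is the difference of the two given points and has T =
      -- n/u².
      f₁ = B₁ * B₂ + B₁ * B₃ + B₂ * B₃
      f₂ = B₁ + B₂ + B₃
      u = X₂ - X₁
      m = Y₁ + Y₂
      n = m * m - (f₂ + u) * (u * u)
      N M : Carrier
      N = n + X₁ * (u * u)
      M = m * n - Y₁ * (u * (u * u))
      n≈ : n ≈ f₁ * u + (m * Y₁ + m * Y₁)
      n≈ = begin
        n
          ≈⟨ solve 6 (λ y z b c d u → (y :+ z) :* (y :+ z) :- (b :+ c :+ d :+ u) :* (u :* u)
               := (b :* c :+ b :* d :+ c :* d) :* u :+ (((y :+ z) :* y :+ (y :+ z) :* y) :+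
                  ((z :* z :- y :* y) :- ((b :+ u) :* ((c :+ u) :* (d :+ u)) :- b :* (c :* d)))))
               refl Y₁ Y₂ B₁ B₂ B₃ u ⟩
        f₁ * u + ((m * Y₁ + m * Y₁) + ((Y₂ * Y₂ - Y₁ * Y₁) - ((B₁ + u) * ((B₂ + u) * (B₃ + u)) - B₁ * (B₂ * B₃))))
          ≈⟨ +-congˡ (+-congˡ (x≈y⇒x∙y⁻¹≈ε (+-cong (trans on₂ (*-cong (B+u e₁) (*-cong (B+u e₂) (B+u e₃)))) (-‿cong on₁)))) ⟩
        f₁ * u + ((m * Y₁ + m * Y₁) + 0#)
          ≈⟨ +-congˡ (+-identityʳ _) ⟩
        f₁ * u + (m * Y₁ + m * Y₁) ∎
        where
        B+u : ∀ e → X₂ - e * (d * d) ≈ (X₁ - e * (d * d)) + u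
        B+u e = solve 3 (λ x y a → y :- a := (x :- a) :+ (y :- x)) refl X₁ X₂ (e * (d * d))
      onWeighted : OnWeighted N M (u * d)
      onWeighted = begin
        M * M
          ≈⟨ solve 7 (λ y b c d m n u →
               (m :* n :- y :* (u :* (u :* u))) :* (m :* n :- y :* (u :* (u :* u)))
               := n :* (n :* (m :* m :- (b :+ c :+ d :+ u) :* (u :* u)) :+ (b :+ c :+ d) :* n :* (u :* u)
                    :+ u :* (u :* u) :* (n :- (m :* y :+ m :* y))) :+ y :* y :* (u :* (u :* u) :* (u :* (u :* u))))
               refl Y₁ B₁ B₂ B₃ m n u ⟩
        n * (n * n + f₂ * n * (u * u) + u * (u * u) * (n - (m * Y₁ + m * Y₁))) + Y₁ * Y₁ * (u * (u * u) * (u * (u * u)))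
          ≈⟨ +-cong (*-congˡ (+-congˡ (*-congˡ (+-congʳ n≈)))) (*-congʳ on₁) ⟩
        n * (n * n + f₂ * n * (u * u) + u * (u * u) * (f₁ * u + (m * Y₁ + m * Y₁) - (m * Y₁ + m * Y₁)))
          + B₁ * (B₂ * B₃) * (u * (u * u) * (u * (u * u)))
          ≈⟨ solve 6 (λ b c d k n u →
               n :* (n :* n :+ (b :+ c :+ d) :* n :* (u :* u)
                 :+ u :* (u :* u) :* ((b :* c :+ b :* d :+ c :* d) :* u :+ k :- k))
                 :+ b :* (c :* d) :* (u :* (u :* u) :* (u :* (u :* u)))
               := (n :+ b :* (u :* u)) :* ((n :+ c :* (u :* u)) :* (n :+ d :* (u :* u))))
               refl B₁ B₂ B₃ (m * Y₁ + m * Y₁) n u ⟩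
        (n + B₁ * (u * u)) * ((n + B₂ * (u * u)) * (n + B₃ * (u * u)))
          ≈⟨ *-cong (factor e₁) (*-cong (factor e₂) (factor e₃)) ⟩
        (N - e₁ * ((u * d) * (u * d))) * ((N - e₂ * ((u * d) * (u * d))) * (N - e₃ * ((u * d) * (u * d)))) ∎
        where
        factor : ∀ e → n + (X₁ - e * (d * d)) * (u * u) ≈ N - e * ((u * d) * (u * d))
        factor e = solve 5 (λ n x e d u → n :+ (x :- e :* (d :* d)) :* (u :* u)
          := (n :+ x :* (u :* u)) :- e :* ((u :* d) :* (u :* d))) refl n X₁ e d u
      -- The two points agree at t₀, so their difference is infinite there: u vanishes, and both n
      -- and N take the value of m², which is nonzero because m takes twice the value of Y₁.
      u₀≈0 : ev u K.≈ K.0#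
      u₀≈0 = K.trans (ev-- X₂ X₁) (KG.x≈y⇒x∙y⁻¹≈ε (K.sym X₀))
      m₀≉0 : ¬ ev m K.≈ K.0#
      m₀≉0 e = double≉0 Y₁₀≉0 (K.trans (K.trans (K.+-congˡ Y₀) (K.sym (+-homo Y₁ Y₂))) e)
      N₀≉0 : ¬ ev N K.≈ K.0#
      N₀≉0 = ev-+-≉0 (λ e → ev-+-≉0 {m * m} (ev-*-≉0 m₀≉0 m₀≉0)
               (K.trans (-‿homo _) (K.trans (K.-‿cong (ev-*-≈0ʳ (f₂ + u) (ev-*-≈0ˡ u u₀≈0))) (KG.ε⁻¹≈ε))) e)
               (ev-*-≈0ʳ X₁ (ev-*-≈0ˡ u u₀≈0))
      X₂≈X₁ : X₂ ≈ X₁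
      X₂≈X₁ = x∙y⁻¹≈ε⇒x≈y _ _ (F.cancelʳ (≉0-ev d₀≉0)
        (trans (noKernel N M (u * d) onWeighted N₀≉0 (ev-*-≈0ˡ d u₀≈0)) (sym (zeroˡ d))))
      Y₁≈Y₂ : Y₁ ≈ Y₂
      Y₁≈Y₂ = x∙y⁻¹≈ε⇒x≈y _ _ (F.cancelʳ (≉0-ev m₀≉0) (begin
        (Y₁ - Y₂) * m         ≈⟨ solve 2 (λ y z → (y :- z) :* (y :+ z) := y :* y :- z :* z) refl Y₁ Y₂ ⟩
        Y₁ * Y₁ - Y₂ * Y₂     ≈⟨ x≈y⇒x∙y⁻¹≈ε (trans on₁ (trans (*-cong (B e₁) (*-cong (B e₂) (B e₃))) (sym on₂))) ⟩
        0#                    ≈⟨ zeroˡ m ⟨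
        0# * m                ∎))
        where
        B : ∀ e → X₁ - e * (d * d) ≈ X₂ - e * (d * d)
        B e = +-congʳ (sym X₂≈X₁)

  module _ (e₁ e₂ e₃ : Carrier) (noKernel : Roots.NoKernel e₁ e₂ e₃)
    (e₁₂ : ¬ ev e₁ K.≈ ev e₂) (e₁₃ : ¬ ev e₁ K.≈ ev e₃) (e₂₃ : ¬ ev e₂ K.≈ ev e₃) where
    open Roots e₁ e₂ e₃

    Proportional : (x y z x′ y′ z′ : Carrier) → Set ℓ
    Proportional x y z x′ y′ z′ = x * y′ ≈ y * x′ × x * z′ ≈ z * x′ × y * z′ ≈ z * y′

    proportional-infinity : ∀ {x y z x′ y′ z′} → x ≈ 0# × z ≈ 0# → x′ ≈ 0# × z′ ≈ 0# → Proportional x y z x′ y′ z′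
    proportional-infinity (x≈0 , z≈0) (x′≈0 , z′≈0) =
      both x≈0 x′≈0 , both x≈0 x′≈0 , sym (both z≈0 z′≈0)
      where
      both : ∀ {a a′ b b′} → a ≈ 0# → a′ ≈ 0# → a * b′ ≈ b * a′
      both a≈0 a′≈0 = trans (trans (*-congʳ a≈0) (zeroˡ _)) (sym (trans (*-congˡ a′≈0) (zeroʳ _)))

    proportional-twoTorsion : ∀ {x y z x′ y′ z′} e → x ≈ e * z × y ≈ 0# → x′ ≈ e * z′ × y′ ≈ 0# →
                              Proportional x y z x′ y′ z′
    proportional-twoTorsion {z = z} {z′ = z′} e (x≈ , y≈0) (x′≈ , y′≈0) =
      trans (trans (*-congˡ y′≈0) (zeroʳ _)) (sym (trans (*-congʳ y≈0) (zeroˡ _))) ,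
      trans (*-congʳ x≈) (trans (solve 3 (λ e z w → (e :* z) :* w := z :* (e :* w)) refl e z z′) (*-congˡ (sym x′≈))) ,
      trans (trans (*-congʳ y≈0) (zeroˡ _)) (sym (trans (*-congˡ y′≈0) (zeroʳ _)))

    proportional-generic : ∀ {x y z x′ y′ z′} → OnCubic x y z → OnCubic x′ y′ z′ →
      ¬ ev z K.≈ K.0# → ¬ ev z′ K.≈ K.0# → ¬ ev y K.≈ K.0# →
      ev (x * z′) K.≈ ev (z * x′) → ev (y * z′) K.≈ ev (z * y′) → Proportional x y z x′ y′ z′
    proportional-generic {x} {y} {z} {x′} {y′} {z′} on on′ z₀≉0 z₀′≉0 y₀≉0 ex ey =
      F.cancelʳ d≉0 (begin
        (x * y′) * d            ≈⟨ solve 4 (λ x y z w → (x :* y) :* (z :* w) := (x :* w) :* (z :* y)) refl x y′ z z′ ⟩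
        (x * z′) * (z * y′)     ≈⟨ *-cong xz′≈ (sym yz′≈) ⟩
        (z * x′) * (y * z′)     ≈⟨ solve 4 (λ x y z w → (z :* x) :* (y :* w) := (y :* x) :* (z :* w)) refl x′ y z z′ ⟩
        (y * x′) * d            ∎) ,
      xz′≈ , yz′≈
      where
      d = z * z′
      d₀≉0 : ¬ ev d K.≈ K.0#
      d₀≉0 = ev-*-≉0 z₀≉0 z₀′≉0
      d≉0 = ≉0-ev d₀≉0
      -- x/z = xwd/d² and y/z = ywd²/d³. Both points get the denominator d = zz′, as `chord`
      -- requires.
      weighted : ∀ {x y z} w → OnCubic x y z → z * w ≈ d → OnWeighted (x * w * d) (y * w * (d * d)) d
      weighted {x} {y} {z} w on zw≈d = begin
        (y * w * (d * d)) * (y * w * (d * d))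
          ≈⟨ solve 3 (λ y w d → (y :* w :* (d :* d)) :* (y :* w :* (d :* d)) := y :* y :* (w :* w) :* (d :* d :* d) :* d) refl y w d ⟩
        y * y * (w * w) * (d * d * d) * d
          ≈⟨ *-congˡ zw≈d ⟨
        y * y * (w * w) * (d * d * d) * (z * w)
          ≈⟨ solve 4 (λ y z w d → y :* y :* (w :* w) :* (d :* d :* d) :* (z :* w) := (y :* y :* z) :* ((w :* d) :* ((w :* d) :* (w :* d)))) refl y z w d ⟩
        (y * y * z) * ((w * d) * ((w * d) * (w * d)))
          ≈⟨ *-congʳ on ⟩
        ((x - e₁ * z) * ((x - e₂ * z) * (x - e₃ * z))) * ((w * d) * ((w * d) * (w * d)))
          ≈⟨ solve 4 (λ a b c v → (a :* (b :* c)) :* (v :* (v :* v)) := (a :* v) :* ((b :* v) :* (c :* v))) refl _ _ _ (w * d) ⟩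
        ((x - e₁ * z) * (w * d)) * (((x - e₂ * z) * (w * d)) * ((x - e₃ * z) * (w * d)))
          ≈⟨ *-cong (factor e₁) (*-cong (factor e₂) (factor e₃)) ⟩
        _ ∎
        where
        factor : ∀ e → (x - e * z) * (w * d) ≈ x * w * d - e * (d * d)
        factor e = trans
          (solve 5 (λ x e z w d → (x :- e :* z) :* (w :* d) := x :* w :* d :- e :* ((z :* w) :* d)) refl x e z w d)
          (+-congˡ (-‿cong (*-congˡ (*-congʳ zw≈d))))
      equal : x * z′ * d ≈ x′ * z * d × y * z′ * (d * d) ≈ y′ * z * (d * d)
      equal = chord e₁ e₂ e₃ noKernel (weighted z′ on refl) (weighted z on′ (*-comm z′ z)) d₀≉0
        (K.trans (*-homo _ d) (K.trans (K.*-congʳ (K.trans ex (⟦⟧-cong (*-comm z x′)))) (K.sym (*-homo _ d))))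
        (K.trans (*-homo _ _) (K.trans (K.*-congʳ (K.trans ey (⟦⟧-cong (*-comm z y′)))) (K.sym (*-homo _ _))))
        (ev-*-≉0 (ev-*-≉0 y₀≉0 z₀′≉0) (ev-*-≉0 d₀≉0 d₀≉0))
      xz′≈ : x * z′ ≈ z * x′
      xz′≈ = trans (F.cancelʳ d≉0 (proj₁ equal)) (*-comm x′ z)
      yz′≈ : y * z′ ≈ z * y′
      yz′≈ = trans (F.cancelʳ (*-nonzero d≉0 d≉0) (proj₂ equal)) (*-comm y′ z)

    proportional-torsion : ∀ {x y z x′ y′ z′} e f g → Roots.NoKernel e f g → ¬ ev e K.≈ ev f → ¬ ev e K.≈ ev g →
      Roots.OnCubic e f g x y z → Roots.OnCubic e f g x′ y′ z′ → _∼_ K (ev x , ev y , ev z) (ev x′ , ev y′ , ev z′) →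
      ¬ ev z K.≈ K.0# → ev y K.≈ K.0# → ev (x - e * z) K.≈ K.0# → Proportional x y z x′ y′ z′
    proportional-torsion {x} {y} {z} {x′} {y′} {z′} e f g noKernel ef eg on on′ (k , k≉0 , ex , ey , ez) z₀≉0 y₀≈0 a =
      proportional-twoTorsion e
        (twoTorsion e f g noKernel ef eg on x₀≈ y₀≈0 z₀≉0)
        (twoTorsion e f g noKernel ef eg on′ x₀′≈
          (K.cancel k _ _ k≉0 (K.trans (K.sym ey) (K.trans y₀≈0 (K.sym (K.zeroʳ k)))))
          (λ z₀′≈0 → z₀≉0 (K.trans ez (K.trans (K.*-congˡ z₀′≈0) (K.zeroʳ k)))))
      where
      x₀≈ : ev x K.≈ ev (e * z)
      x₀≈ = KG.x∙y⁻¹≈ε⇒x≈y _ _ (K.trans (K.sym (ev-- _ _)) a)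
      x₀′≈ : ev x′ K.≈ ev (e * z′)
      x₀′≈ = K.cancel k _ _ k≉0 (K.trans (K.sym ex) (K.trans x₀≈ (K.trans (*-homo e z) (K.trans (K.*-congˡ ez)
        (K.trans (KS.solve 3 (λ e k w → e KS.:* (k KS.:* w) KS.:= k KS.:* (e KS.:* w)) K.refl (ev e) k (ev z′))
          (K.*-congˡ (K.sym (*-homo e z′))))))))

    -- `chord` needs a nonzero y-coordinate at t₀, so points that specialize to infinity or to a
    -- 2-torsion point are treated by their own formulas. For 2-torsion the roots are permuted until
    -- the factor that vanishes at t₀ comes first.
    proportional : ∀ {x y z x′ y′ z′} → OnCubic x y z → OnCubic x′ y′ z′ →
      NonZero K (ev x , ev y , ev z) → NonZero K (ev x′ , ev y′ , ev z′) →
      _∼_ K (ev x , ev y , ev z) (ev x′ , ev y′ , ev z′) → Proportional x y z x′ y′ z′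
    proportional {x} {y} {z} {x′} {y′} {z′} on on′ p≉0 p′≉0 (k , k≉0 , ex , ey , ez)
      with ev z K.≟ K.0# | ev y K.≟ K.0#
    ... | yes z₀≈0 | _ = proportional-infinity (atInfinity on p≉0 z₀≈0) (atInfinity on′ p′≉0 (descale ez z₀≈0))
      where
      descale : ∀ {a b} → a K.≈ k K.* b → a K.≈ K.0# → b K.≈ K.0#
      descale e a≈0 = K.cancel k _ _ k≉0 (K.trans (K.sym e) (K.trans a≈0 (K.sym (K.zeroʳ k))))
      atInfinity : ∀ {x y z} → OnCubic x y z → NonZero K (ev x , ev y , ev z) → ev z K.≈ K.0# → x ≈ 0# × z ≈ 0#
      atInfinity {x} {y} {z} on p≉0 z₀≈0 = infinity e₁ e₂ e₃ noKernel on x₀≈0 z₀≈0 λ y₀≈0 → p≉0 (x₀≈0 , y₀≈0 , z₀≈0)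
        where
        fromFactor : ∀ e → ev (x - e * z) K.≈ K.0# → ev x K.≈ K.0#
        fromFactor e a = K.trans (KG.x∙y⁻¹≈ε⇒x≈y _ _ (K.trans (K.sym (ev-- x (e * z))) a)) (ev-*-≈0ʳ e z₀≈0)
        x₀≈0 : ev x K.≈ K.0#
        x₀≈0 with zero-product (K.trans (K.sym (*-homo _ _)) (K.trans (⟦⟧-cong (sym on)) (ev-*-≈0ʳ (y * y) z₀≈0)))
        ... | inj₁ a = fromFactor e₁ a
        ... | inj₂ b with zero-product (K.trans (K.sym (*-homo _ _)) b)
        ...   | inj₁ a = fromFactor e₂ a
        ...   | inj₂ a = fromFactor e₃ a
    ... | no z₀≉0 | no y₀≉0 = proportional-generic on on′ z₀≉0 z₀′≉0 y₀≉0 (crossed ex) (crossed ey)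
      where
      z₀′≉0 : ¬ ev z′ K.≈ K.0#
      z₀′≉0 e = z₀≉0 (K.trans ez (K.trans (K.*-congˡ e) (K.zeroʳ k)))
      crossed : ∀ {a a′} → ev a K.≈ k K.* ev a′ → ev (a * z′) K.≈ ev (z * a′)
      crossed {a} {a′} e = K.trans (*-homo a z′) (K.trans (∼⇒cross K k (ev a) (ev z) (ev a′) (ev z′) e ez) (K.sym (*-homo z a′)))
    ... | no z₀≉0 | yes y₀≈0 with zero-product (K.trans (K.sym (*-homo _ _)) (K.trans (⟦⟧-cong (sym on)) (ev-*-≈0ˡ z (ev-*-≈0ˡ y y₀≈0))))
    ...   | inj₁ a = proportional-torsion e₁ e₂ e₃ noKernel e₁₂ e₁₃ on on′ (k , k≉0 , ex , ey , ez) z₀≉0 y₀≈0 a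
    ...   | inj₂ b with zero-product (K.trans (K.sym (*-homo _ _)) b)
    ...     | inj₁ a = proportional-torsion e₂ e₁ e₃ (swap₂ noKernel) (λ e → e₁₂ (K.sym e)) e₂₃
                         (trans on swapped₂) (trans on′ swapped₂) (k , k≉0 , ex , ey , ez) z₀≉0 y₀≈0 a
      where
      swapped₂ : ∀ {a b c} → a * (b * c) ≈ b * (a * c)
      swapped₂ = solve 3 (λ a b c → a :* (b :* c) := b :* (a :* c)) refl _ _ _
    ...     | inj₂ a = proportional-torsion e₃ e₁ e₂ (swap₃ noKernel) (λ e → e₁₃ (K.sym e)) (λ e → e₂₃ (K.sym e))
                         (trans on swapped₃) (trans on′ swapped₃) (k , k≉0 , ex , ey , ez) z₀≉0 y₀≈0 a
      where
      swapped₃ : ∀ {a b c} → a * (b * c) ≈ c * (a * b)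
      swapped₃ = solve 3 (λ a b c → a :* (b :* c) := c :* (a :* b)) refl _ _ _

-- Integers and fractions in ℚ

toℚᵘ-/1 : ∀ i → toℚᵘ (i ℚ./ 1) ℚᵘ.≃ ℚᵘ.mkℚᵘ i 0
toℚᵘ-/1 i = ℚ.toℚᵘ-fromℚᵘ (ℚᵘ.mkℚᵘ i 0)

/1-homo-+ : ∀ i j → (i ℤ.+ j) ℚ./ 1 ≡ i ℚ./ 1 ℚ.+ j ℚ./ 1
/1-homo-+ i j = ℚ.toℚᵘ-injective (begin
  toℚᵘ ((i ℤ.+ j) ℚ./ 1)                      ≈⟨ toℚᵘ-/1 (i ℤ.+ j) ⟩
  ℚᵘ.mkℚᵘ (i ℤ.+ j) 0                         ≈⟨ ℚᵘ.*≡* (≡.cong (ℤ._* + 1) (≡.cong₂ ℤ._+_ (≡.sym (ℤ.*-identityʳ i)) (≡.sym (ℤ.*-identityʳ j)))) ⟩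
  ℚᵘ.mkℚᵘ i 0 ℚᵘ.+ ℚᵘ.mkℚᵘ j 0                ≈⟨ ℚᵘ.+-cong (toℚᵘ-/1 i) (toℚᵘ-/1 j) ⟨
  toℚᵘ (i ℚ./ 1) ℚᵘ.+ toℚᵘ (j ℚ./ 1)          ≈⟨ ℚ.toℚᵘ-homo-+ (i ℚ./ 1) (j ℚ./ 1) ⟨
  toℚᵘ (i ℚ./ 1 ℚ.+ j ℚ./ 1)                  ∎)
  where open Relation.Binary.Reasoning.Setoid ℚᵘ.≃-setoid

/1-homo-* : ∀ i j → (i ℤ.* j) ℚ./ 1 ≡ (i ℚ./ 1) ℚ.* (j ℚ./ 1)
/1-homo-* i j = ℚ.toℚᵘ-injective (begin
  toℚᵘ ((i ℤ.* j) ℚ./ 1)                      ≈⟨ toℚᵘ-/1 (i ℤ.* j) ⟩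
  ℚᵘ.mkℚᵘ i 0 ℚᵘ.* ℚᵘ.mkℚᵘ j 0                ≈⟨ ℚᵘ.*-cong (toℚᵘ-/1 i) (toℚᵘ-/1 j) ⟨
  toℚᵘ (i ℚ./ 1) ℚᵘ.* toℚᵘ (j ℚ./ 1)          ≈⟨ ℚ.toℚᵘ-homo-* (i ℚ./ 1) (j ℚ./ 1) ⟨
  toℚᵘ ((i ℚ./ 1) ℚ.* (j ℚ./ 1))                  ∎)
  where open Relation.Binary.Reasoning.Setoid ℚᵘ.≃-setoid

/1-injective : ∀ i → i ℚ./ 1 ≡ 0ℚ → i ≡ + 0
/1-injective i e with ℚᵘ.≃-trans (ℚᵘ.≃-sym (toℚᵘ-/1 i)) (ℚ.toℚᵘ-cong e)
... | ℚᵘ.*≡* i*1≡0 = ≡.trans (≡.sym (ℤ.*-identityʳ i)) i*1≡0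

p*↧p≡↥p : ∀ p → p ℚ.* ((↧ p) ℚ./ 1) ≡ (↥ p) ℚ./ 1
p*↧p≡↥p p@record{} = ℚ.toℚᵘ-injective (begin
  toℚᵘ (p ℚ.* ((↧ p) ℚ./ 1))             ≈⟨ ℚ.toℚᵘ-homo-* p ((↧ p) ℚ./ 1) ⟩
  toℚᵘ p ℚᵘ.* toℚᵘ ((↧ p) ℚ./ 1)       ≈⟨ ℚᵘ.*-congˡ {toℚᵘ p} (toℚᵘ-/1 (↧ p)) ⟩
  toℚᵘ p ℚᵘ.* ℚᵘ.mkℚᵘ (↧ p) 0          ≈⟨ ℚᵘ.*≡* (≡.trans (ℤ.*-identityʳ _) (≡.cong (↥ p ℤ.*_) (≡.sym (≡.cong +_ (ℕ.*-identityʳ (ℚ.denominatorℕ p)))))) ⟩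
  ℚᵘ.mkℚᵘ (↥ p) 0                      ≈⟨ toℚᵘ-/1 (↥ p) ⟨
  toℚᵘ ((↥ p) ℚ./ 1)                   ∎)
  where open Relation.Binary.Reasoning.Setoid ℚᵘ.≃-setoid

r-r/q*q≡0 : ∀ r q .{{_ : ℚ.NonZero q}} → r ℚ.+ ℚ.- (r ℚ.* ℚ.1/ q) ℚ.* q ≡ 0ℚ
r-r/q*q≡0 r q = begin
  r ℚ.+ ℚ.- (r ℚ.* ℚ.1/ q) ℚ.* q     ≡⟨ ≡.cong (r ℚ.+_) (ℚ.neg-distribˡ-* (r ℚ.* ℚ.1/ q) q) ⟨
  r ℚ.+ ℚ.- (r ℚ.* ℚ.1/ q ℚ.* q)     ≡⟨ ≡.cong (λ t → r ℚ.+ ℚ.- t) (ℚ.*-assoc r (ℚ.1/ q) q) ⟩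
  r ℚ.- r ℚ.* (ℚ.1/ q ℚ.* q)         ≡⟨ ≡.cong (λ t → r ℚ.- r ℚ.* t) (ℚ.*-inverseˡ q) ⟩
  r ℚ.- r ℚ.* 1ℚ                     ≡⟨ ≡.cong (λ t → r ℚ.- t) (ℚ.*-identityʳ r) ⟩
  r ℚ.- r                            ≡⟨ ℚ.+-inverseʳ r ⟩
  0ℚ                                 ∎
  where open ≡.≡-Reasoning

-- Every element of a number field has an integral multiple

module Denominators {c ℓ} (K : NumberField c ℓ) where
  open NumberField K
  open IsRingHomomorphism fromℚ-hom
  open Polynomial commutativeRing using (eval)
  open Algebra.Definitions.RawMonoid +-rawMonoid using (sum)
  open Relation.Binary.Reasoning.Setoid setoid
  open IntegerSolver commutativeRing using (solve; _:=_; _:+_; _:*_; con)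
  private
    module M = Algebra.Properties.Monoid.Mult +-monoid
    module F = Factorization (asDomain asField)
    module S = Algebra.Properties.Semiring.Sum semiring
    module CS = Algebra.Properties.CommutativeMonoid.Sum +-commutativeMonoid

  fromℚ-nonzero : ∀ {q} → q ≢ 0ℚ → ¬ fromℚ q ≈ 0#
  fromℚ-nonzero {q} q≢0 e = 1≉0 (begin
    1#                         ≈⟨ 1#-homo ⟨
    fromℚ 1ℚ                   ≡⟨ ≡.cong fromℚ (ℚ.*-inverseʳ q) ⟨
    fromℚ (q ℚ.* ℚ.1/ q)       ≈⟨ *-homo q (ℚ.1/ q) ⟩
    fromℚ q * fromℚ (ℚ.1/ q)   ≈⟨ *-congʳ e ⟩
    0# * fromℚ (ℚ.1/ q)        ≈⟨ zeroˡ _ ⟩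
    0#                         ∎)
    where
    instance
      q-nonZero : ℚ.NonZero q
      q-nonZero = ℚ.≢-nonZero q≢0

  fromℤ-nonzero : ∀ {i} → i ≢ + 0 → ¬ fromℤ i ≈ 0#
  fromℤ-nonzero {i} i≢0 = fromℚ-nonzero λ e → i≢0 (/1-injective i e)

  fromℤ-+ : ∀ i j → fromℤ (i ℤ.+ j) ≈ fromℤ i + fromℤ j
  fromℤ-+ i j = trans (reflexive (≡.cong fromℚ (/1-homo-+ i j))) (+-homo _ _)

  fromℤ-* : ∀ i j → fromℤ (i ℤ.* j) ≈ fromℤ i * fromℤ j
  fromℤ-* i j = trans (reflexive (≡.cong fromℚ (/1-homo-* i j))) (*-homo _ _)

  fromℤ-× : ∀ n x → fromℤ (+ n) * x ≈ n M.× x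
  fromℤ-× zero    x = trans (*-congʳ 0#-homo) (zeroˡ x)
  fromℤ-× (suc n) x = begin
    fromℤ (+ suc n) * x                ≈⟨ *-congʳ (fromℤ-+ (+ 1) (+ n)) ⟩
    (fromℤ (+ 1) + fromℤ (+ n)) * x    ≈⟨ distribʳ x _ _ ⟩
    fromℤ (+ 1) * x + fromℤ (+ n) * x  ≈⟨ +-cong (trans (*-congʳ 1#-homo) (*-identityˡ x)) (fromℤ-× n x) ⟩
    x + n M.× x                        ∎

  torsionFree : ∀ n x → suc n M.× x ≈ 0# → x ≈ 0#
  torsionFree n x e = cancel (fromℤ (+ suc n)) x 0# (fromℤ-nonzero {+ suc n} λ ())
    (trans (fromℤ-× (suc n) x) (trans e (sym (zeroʳ _))))

  Integer : Carrier → Set ℓ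
  Integer x = ∃ λ i → x ≈ fromℤ i

  Integer-* : ∀ {x y} → Integer x → Integer y → Integer (x * y)
  Integer-* (i , x≈) (j , y≈) = i ℤ.* j , trans (*-cong x≈ y≈) (sym (fromℤ-* i j))

  commonDenominator : ∀ qs → ∃ λ d → Integer d × ¬ d ≈ 0# × All (λ q → Integer (d * fromℚ q)) qs
  commonDenominator [] = 1# , (+ 1 , sym 1#-homo) , 1≉0 , []
  commonDenominator (q ∷ qs) =
    let d , d∈ℤ , d≉0 , ds = commonDenominator qs
        ∈ℤ : Integer (fromℤ (↧ q))
        ∈ℤ = ↧ q , refl
    in fromℤ (↧ q) * d , Integer-* ∈ℤ d∈ℤ , F.*-nonzero (fromℤ-nonzero {↧ q} λ ()) d≉0 ,
       (let i , e = Integer-* d∈ℤ (↥ q , trans (sym (*-homo q ((↧ q) ℚ./ 1))) (reflexive (≡.cong fromℚ (p*↧p≡↥p q))))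
        in i , trans (solve 3 (λ n d q → (n :* d) :* q := d :* (q :* n)) refl (fromℤ (↧ q)) d (fromℚ q)) e) ∷
       All.map (λ {r} r∈ℤ → let i , e = Integer-* ∈ℤ r∈ℤ in i , trans (*-assoc _ _ _) e) ds

  monic : Carrier → List ℚ → Carrier
  monic x []       = 1#
  monic x (q ∷ qs) = fromℚ q + x * monic x qs

  module _ (x : Carrier) where

    private
      d = degree

    CombinationFrom : ℕ → Carrier → Set ℓ
    CombinationFrom m y = ∃ λ (q : Fin d → ℚ) →
      (∀ i → toℕ i ℕ.< m → q i ≡ 0ℚ) × y ≈ sum (λ i → fromℚ (q i) * basis i)

    -- Lower coefficients of the monic polynomial `rs` plus `a` times the monic polynomial `qs` of
    -- smaller degree. The implicit leading 1 of `qs` contributes `a` at position `length qs`; the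
    -- clauses for an empty second list are only fillers.
    axpy : ℚ → List ℚ → List ℚ → List ℚ
    axpy a []       []       = []
    axpy a []       (r ∷ rs) = (r ℚ.+ a) ∷ rs
    axpy a (q ∷ qs) []       = []
    axpy a (q ∷ qs) (r ∷ rs) = (r ℚ.+ a ℚ.* q) ∷ axpy a qs rs

    length-axpy : ∀ a qs rs → length qs ℕ.< length rs → length (axpy a qs rs) ≡ length rs
    length-axpy a []       (r ∷ rs) _         = ≡.refl
    length-axpy a (q ∷ qs) (r ∷ rs) (ℕ.s≤s l) = ≡.cong suc (length-axpy a qs rs l)

    monic-axpy : ∀ a qs rs → length qs ℕ.< length rs → monic x (axpy a qs rs) ≈ monic x rs + fromℚ a * monic x qs
    monic-axpy a [] (r ∷ rs) _ = trans (+-congʳ (+-homo r a))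
      (trans (solve 4 (λ r a x m → (r :+ a) :+ x :* m := (r :+ x :* m) :+ a) refl _ _ x _) (+-congˡ (sym (*-identityʳ _))))
    monic-axpy a (q ∷ qs) (r ∷ rs) (ℕ.s≤s l) = trans
      (+-cong (trans (+-homo r _) (+-congˡ (*-homo a q))) (*-congˡ (monic-axpy a qs rs l)))
      (solve 6 (λ r a q x m n → (r :+ a :* q) :+ x :* (m :+ a :* n) := (r :+ x :* m) :+ a :* (q :+ x :* n)) refl _ _ _ x _ _)

    combination-axpy : ∀ {m y z} a (y∈ : CombinationFrom m y) (z∈ : CombinationFrom m z) →
      (∀ i → toℕ i ≡ m → proj₁ z∈ i ℚ.+ a ℚ.* proj₁ y∈ i ≡ 0ℚ) → CombinationFrom (suc m) (z + fromℚ a * y)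
    combination-axpy {m} {y} {z} a (q , q≡0 , y≈) (r , r≡0 , z≈) eliminates =
      (λ i → r i ℚ.+ a ℚ.* q i) , vanishing , (begin
        z + fromℚ a * y
          ≈⟨ +-cong z≈ (*-congˡ y≈) ⟩
        sum (λ i → fromℚ (r i) * basis i) + fromℚ a * sum (λ i → fromℚ (q i) * basis i)
          ≈⟨ +-congˡ (S.*-distribˡ-sum (fromℚ a) (λ i → fromℚ (q i) * basis i)) ⟩
        sum (λ i → fromℚ (r i) * basis i) + sum (λ i → fromℚ a * (fromℚ (q i) * basis i))
          ≈⟨ CS.∑-distrib-+ (λ i → fromℚ (r i) * basis i) (λ i → fromℚ a * (fromℚ (q i) * basis i)) ⟨
        sum (λ i → fromℚ (r i) * basis i + fromℚ a * (fromℚ (q i) * basis i))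
          ≈⟨ CS.sum-cong-≋ (λ i → sym (trans (*-congʳ (trans (+-homo _ _) (+-congˡ (*-homo _ _))))
               (solve 4 (λ r a q b → (r :+ a :* q) :* b := r :* b :+ a :* (q :* b)) refl (fromℚ (r i)) (fromℚ a) (fromℚ (q i)) (basis i)))) ⟩
        sum (λ i → fromℚ (r i ℚ.+ a ℚ.* q i) * basis i) ∎)
      where
      vanishing : ∀ i → toℕ i ℕ.< suc m → r i ℚ.+ a ℚ.* q i ≡ 0ℚ
      vanishing i i<1+m with ℕ.m<1+n⇒m<n∨m≡n i<1+m
      ... | inj₁ i<m = ≡.trans (≡.cong₂ (λ s t → s ℚ.+ a ℚ.* t) (r≡0 i i<m) (q≡0 i i<m))
                         (≡.trans (ℚ.+-identityˡ (a ℚ.* 0ℚ)) (ℚ.*-zeroʳ a))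
      ... | inj₂ i≡m = eliminates i i≡m

    -- The degree is unbounded so that a multiple of one such polynomial can be
    -- subtracted from another without losing its leading coefficient 1.
    eliminate : ∀ m N → m ℕ.≤ d → ∃ λ qs → N ℕ.≤ length qs × CombinationFrom m (monic x qs)
    eliminate zero N _ =
      let qs = replicate N 0ℚ
          q , e = spanning (monic x qs)
      in qs , ℕ.≤-reflexive (≡.sym (List.length-replicate N)) , q , (λ _ ()) , e
    eliminate (suc m) N m<d with eliminate m N (ℕ.<⇒≤ m<d)
    ... | qs , N≤ , q , q≡0 , y≈ with q (fromℕ< m<d) ℚ.≟ 0ℚ
    ...   | yes qₘ≡0 = qs , N≤ , q , vanishing , y≈
      where
      vanishing : ∀ i → toℕ i ℕ.< suc m → q i ≡ 0ℚ
      vanishing i i<1+m with ℕ.m<1+n⇒m<n∨m≡n i<1+m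
      ... | inj₁ i<m = q≡0 i i<m
      ... | inj₂ i≡m = ≡.trans (≡.cong q (Fin.toℕ-injective (≡.trans i≡m (≡.sym (Fin.toℕ-fromℕ< m<d))))) qₘ≡0
    ...   | no qₘ≢0 with eliminate m (suc (length qs)) (ℕ.<⇒≤ m<d)
    ...     | rs , qs<rs , r , r≡0 , z≈ =
      axpy a qs rs ,
      ℕ.≤-trans N≤ (ℕ.≤-trans (ℕ.<⇒≤ qs<rs) (ℕ.≤-reflexive (≡.sym (length-axpy a qs rs qs<rs)))) ,
      let s , s≡0 , e = combination-axpy a (q , q≡0 , y≈) (r , r≡0 , z≈) eliminates
      in s , s≡0 , trans (monic-axpy a qs rs qs<rs) e
      where
      j = fromℕ< m<d
      instance
        qⱼ-nonZero : ℚ.NonZero (q j)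
        qⱼ-nonZero = ℚ.≢-nonZero qₘ≢0
      a = ℚ.- (r j ℚ.* ℚ.1/ q j)
      eliminates : ∀ i → toℕ i ≡ m → r i ℚ.+ a ℚ.* q i ≡ 0ℚ
      eliminates i i≡m with Fin.toℕ-injective {i = i} {j} (≡.trans i≡m (≡.sym (Fin.toℕ-fromℕ< m<d)))
      ... | ≡.refl = r-r/q*q≡0 (r j) (q j)

    algebraic : ∃ λ qs → monic x qs ≈ 0#
    algebraic =
      let qs , _ , q , q≡0 , e = eliminate d 0 ℕ.≤-refl
      in qs , trans e (trans (CS.sum-cong-≋ (λ i → trans (*-congʳ (trans (reflexive (≡.cong fromℚ (q≡0 i (Fin.toℕ<n i)))) 0#-homo))
           (zeroˡ (basis i)))) (CS.sum-replicate-zero d))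

    -- For f monic of degree n, aⁿ f(x) is a monic polynomial in ax whose coefficient at index i is
    -- multiplied by a to the power n - i. The factor `b` is aⁿ.
    scaleRoot : ∀ {a} → Integer a → ∀ qs → All (λ q → Integer (a * fromℚ q)) qs →
                ∃₂ λ cs b → Integer b × eval (a * x) (map fromℤ cs ++ 1# ∷ []) ≈ b * monic x qs
    scaleRoot {a} a∈ℤ [] [] = [] , 1# , (+ 1 , sym 1#-homo) ,
      solve 2 (λ y o → o :+ y :* con (+ 0) := con (+ 1) :* o) refl (a * x) 1#
    scaleRoot {a} a∈ℤ (q ∷ qs) (aq∈ℤ ∷ rest) =
      let cs , b , b∈ℤ , e = scaleRoot a∈ℤ qs rest
          i , baq≈i = Integer-* b∈ℤ aq∈ℤ
      in i ∷ cs , a * b , Integer-* a∈ℤ b∈ℤ ,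
         trans (+-cong (sym baq≈i) (*-congˡ e))
           (solve 5 (λ b a q x m → b :* (a :* q) :+ a :* x :* (b :* m) := (a :* b) :* (q :+ x :* m)) refl b a (fromℚ q) x (monic x qs))

  Integer⇒integral : ∀ {x} → Integer x → IsIntegral x
  Integer⇒integral {x} (i , x≈i) = (ℤ.- i) ∷ [] , (begin
    fromℤ (ℤ.- i) + x * (1# + x * 0#)   ≈⟨ +-congˡ (*-congˡ (trans (+-congˡ (zeroʳ x)) (+-identityʳ 1#))) ⟩
    fromℤ (ℤ.- i) + x * 1#              ≈⟨ +-congˡ (trans (*-identityʳ x) x≈i) ⟩
    fromℤ (ℤ.- i) + fromℤ i             ≈⟨ fromℤ-+ (ℤ.- i) i ⟨
    fromℤ (ℤ.- i ℤ.+ i)                 ≡⟨ ≡.cong fromℤ (ℤ.+-inverseˡ i) ⟩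
    fromℤ (+ 0)                         ≈⟨ 0#-homo ⟩
    0#                                  ∎)

  integralDenominator : ∀ x → ∃ λ a → IsIntegral a × ¬ a ≈ 0# × IsIntegral (a * x)
  integralDenominator x =
    let qs , root = algebraic x
        a , a∈ℤ , a≉0 , aqs = commonDenominator qs
        cs , b , _ , e = scaleRoot x a∈ℤ qs aqs
    in a , Integer⇒integral a∈ℤ , a≉0 , cs , trans e (trans (*-congˡ root) (zeroʳ b))

-- Roots and discriminant of the Weierstrass cubic

module Discriminant {c ℓ} (A : CommutativeRing c ℓ) where
  open CommutativeRing A
  open Weierstrass
  open IntegerSolver A using (solve; _:=_; _:+_; _:*_; _:-_; :-_; con; Polynomial)
  private module M = Algebra.Properties.Monoid.Mult +-monoid

  Δ-cong : ∀ {W W′ : Weierstrass A} → a₁ W ≈ a₁ W′ → a₂ W ≈ a₂ W′ → a₃ W ≈ a₃ W′ → a₄ W ≈ a₄ W′ → a₆ W ≈ a₆ W′ →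
           Cubic.Δ A W ≈ Cubic.Δ A W′
  Δ-cong E₁ E₂ E₃ E₄ E₆ =
    +-cong (+-cong (+-cong (-‿cong (*-cong (*-cong B₂ B₂) B₈)) (-‿cong (M.×-congʳ 8 (*-cong (*-cong B₄ B₄) B₄))))
                   (-‿cong (M.×-congʳ 27 (*-cong B₆ B₆))))
           (M.×-congʳ 9 (*-cong (*-cong B₂ B₄) B₆))
    where
    B₂ = +-cong (*-cong E₁ E₁) (M.×-congʳ 4 E₂)
    B₄ = +-cong (M.×-congʳ 2 E₄) (*-cong E₁ E₃)
    B₆ = +-cong (*-cong E₃ E₃) (M.×-congʳ 4 E₆)
    B₈ = +-cong (+-cong (+-cong (+-cong (*-cong (*-cong E₁ E₁) E₆) (M.×-congʳ 4 (*-cong E₂ E₆)))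
                                (-‿cong (*-cong (*-cong E₁ E₃) E₄)))
                        (*-cong E₂ (*-cong E₃ E₃)))
                (-‿cong (*-cong E₄ E₄))

  -- Read contrapositively, a nonzero discriminant separates the first two roots; `rotate` brings
  -- any other pair there.
  Δ-doubleRoot : ∀ r s → Cubic.Δ A (fromRoots A r r s) ≈ 0#
  Δ-doubleRoot = solve 2 (λ r s →
    let A₂ = :- (r :+ r :+ s)
        A₄ = r :* r :+ r :* s :+ r :* s
        A₆ = :- (r :* r :* s)
        O  = con (+ 0)
        B₂ = O :* O :+ times 4 A₂
        B₄ = times 2 A₄ :+ O :* O
        B₆ = O :* O :+ times 4 A₆
        B₈ = O :* O :* A₆ :+ times 4 (A₂ :* A₆) :- O :* O :* A₄ :+ A₂ :* (O :* O) :- A₄ :* A₄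
    in :- (B₂ :* B₂ :* B₈) :- times 8 (B₄ :* B₄ :* B₄) :- times 27 (B₆ :* B₆) :+ times 9 (B₂ :* B₄ :* B₆) := O) refl
    where
    -- Unfolds exactly as the multiples in `Cubic.Δ` do, with a final 0, so that the interpreted
    -- polynomial matches `Δ`.
    times : ∀ {n} → ℕ → Polynomial n → Polynomial n
    times zero    p = con (+ 0)
    times (suc k) p = p :+ times k p

  -- `fromRoots` up to `≈`: a ring homomorphism preserves this relation, but not the literal form of
  -- the coefficients.
  record HasRoots (W : Weierstrass A) (r₁ r₂ r₃ : Carrier) : Set ℓ where
    field
      a₁≈ : a₁ W ≈ 0#
      a₂≈ : a₂ W ≈ - (r₁ + r₂ + r₃)
      a₃≈ : a₃ W ≈ 0#
      a₄≈ : a₄ W ≈ r₁ * r₂ + r₁ * r₃ + r₂ * r₃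
      a₆≈ : a₆ W ≈ - (r₁ * r₂ * r₃)
  open HasRoots

  distinct₁₂ : ∀ {W r₁ r₂ r₃} → HasRoots W r₁ r₂ r₃ → ¬ Cubic.Δ A W ≈ 0# → ¬ r₁ ≈ r₂
  distinct₁₂ {W} {r₁} {r₂} {r₃} h Δ≉0 e = Δ≉0 (trans (Δ-cong {W} {fromRoots A r₁ r₁ r₃} (a₁≈ h)
    (trans (a₂≈ h) (-‿cong (+-congʳ (+-congˡ (sym e)))))
    (a₃≈ h)
    (trans (a₄≈ h) (+-cong (+-congʳ (*-congˡ (sym e))) (*-congʳ (sym e))))
    (trans (a₆≈ h) (-‿cong (*-congʳ (*-congˡ (sym e)))))) (Δ-doubleRoot r₁ r₃))

  rotate : ∀ {W r₁ r₂ r₃} → HasRoots W r₁ r₂ r₃ → HasRoots W r₂ r₃ r₁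
  rotate {W} {r₁} {r₂} {r₃} h = record
    { a₁≈ = a₁≈ h
    ; a₂≈ = trans (a₂≈ h) (solve 3 (λ a b c → :- (a :+ b :+ c) := :- (b :+ c :+ a)) refl r₁ r₂ r₃)
    ; a₃≈ = a₃≈ h
    ; a₄≈ = trans (a₄≈ h) (solve 3 (λ a b c → a :* b :+ a :* c :+ b :* c := b :* c :+ b :* a :+ c :* a) refl r₁ r₂ r₃)
    ; a₆≈ = trans (a₆≈ h) (solve 3 (λ a b c → :- (a :* b :* c) := :- (b :* c :* a)) refl r₁ r₂ r₃)
    }

  factored : ∀ {W r₁ r₂ r₃} → HasRoots W r₁ r₂ r₃ → ∀ {x y z} → Cubic.lhs A W x y z ≈ Cubic.rhs A W x y z →
             y * y * z ≈ (x - r₁ * z) * ((x - r₂ * z) * (x - r₃ * z))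
  factored {W} {r₁} {r₂} {r₃} h {x} {y} {z} on = trans
    (sym (trans (+-cong (+-congˡ (trans (*-congʳ (a₁≈ h)) (zeroˡ _))) (trans (*-congʳ (a₃≈ h)) (zeroˡ _)))
      (trans (+-identityʳ _) (+-identityʳ _))))
    (trans on (trans (+-cong (+-cong (+-congˡ (*-congʳ (a₂≈ h))) (*-congʳ (a₄≈ h))) (*-congʳ (a₆≈ h)))
      (solve 5 (λ x z a b c → x :* x :* x :+ (:- (a :+ b :+ c)) :* (x :* x :* z)
           :+ (a :* b :+ a :* c :+ b :* c) :* (x :* z :* z) :+ (:- (a :* b :* c)) :* (z :* z :* z)
         := (x :- a :* z) :* ((x :- b :* z) :* (x :- c :* z))) refl x z r₁ r₂ r₃)))

mapRoots : ∀ {c ℓ c′ ℓ′} (A : CommutativeRing c ℓ) (B : CommutativeRing c′ ℓ′)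
  {f : CommutativeRing.Carrier A → CommutativeRing.Carrier B} →
  IsRingHomomorphism (CommutativeRing.rawRing A) (CommutativeRing.rawRing B) f →
  ∀ {W r₁ r₂ r₃} → Discriminant.HasRoots A W r₁ r₂ r₃ → Discriminant.HasRoots B (mapWeierstrass A B f W) (f r₁) (f r₂) (f r₃)
mapRoots A B f-hom h = record
  { a₁≈ = trans (⟦⟧-cong a₁≈) 0#-homo
  ; a₂≈ = trans (⟦⟧-cong a₂≈) (trans (-‿homo _) (-‿cong (trans (+-homo _ _) (+-congʳ (+-homo _ _)))))
  ; a₃≈ = trans (⟦⟧-cong a₃≈) 0#-homo
  ; a₄≈ = trans (⟦⟧-cong a₄≈) (trans (+-homo _ _) (+-cong (trans (+-homo _ _) (+-cong (*-homo _ _) (*-homo _ _))) (*-homo _ _)))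
  ; a₆≈ = trans (⟦⟧-cong a₆≈) (trans (-‿homo _) (-‿cong (trans (*-homo _ _) (*-congʳ (*-homo _ _)))))
  }
  where
  open CommutativeRing B
  open IsRingHomomorphism f-hom
  open Discriminant.HasRoots h

fromRoots-hasRoots : ∀ {c ℓ} (A : CommutativeRing c ℓ) r₁ r₂ r₃ →
                     Discriminant.HasRoots A (fromRoots A r₁ r₂ r₃) r₁ r₂ r₃
fromRoots-hasRoots A _ _ _ = record { a₁≈ = refl ; a₂≈ = refl ; a₃≈ = refl ; a₄≈ = refl ; a₆≈ = refl }
  where open CommutativeRing A

-- The descent applied to R[t], and its consequence for K(t)

module _ {c ℓ p} (K : NumberField c ℓ) (R : Subring (NumberField.commutativeRing K) p) where
  open Setting K R
  open CommutativeRing R[t]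
  open Divisibility R[t]

  NonsquareDivisors : (e₁ e₂ e₃ : R[t].Carrier) → K.Carrier → Set (c ⊔ ℓ ⊔ p)
  NonsquareDivisors e₁ e₂ e₃ t₀ = ∀ h → ¬ Polynomial.IsConstant ringR h → SquareFree h →
    h ∣ (e₁ - e₂) * (e₁ - e₃) ⊎ h ∣ (e₂ - e₁) * (e₂ - e₃) ⊎ h ∣ (e₃ - e₁) * (e₃ - e₂) →
    ¬ Divisibility.IsSquare K.commutativeRing (h ⟦ t₀ ⟧)

module Specialization {c ℓ p} (K : NumberField c ℓ) (R : Subring (NumberField.commutativeRing K) p)
  (integers⊆R : Setting.ringOfIntegers⊆R K R)
  (ufd : Divisibility.IsUFD (Subring.toRing R))
  (e₁ e₂ e₃ : CommutativeRing.Carrier (Setting.R[t] K R))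
  (t₀ : NumberField.Carrier K)
  (elliptic₀ : IsElliptic (NumberField.asField K)
     (Setting.specialize K R t₀ (Setting.curve K R e₁ e₂ e₃)))
  (nonsquare : NonsquareDivisors K R e₁ e₂ e₃ t₀)
  where
  open Setting K R
  private module Rt = CommutativeRing R[t]

  domainR : IntegralDomain _ _
  domainR = record
    { commutativeRing = ringR
    ; 1≉0    = K.1≉0
    ; cancel = λ x y z → K.cancel (proj₁ x) (proj₁ y) (proj₁ z)
    ; _≟_    = λ x y → proj₁ x K.≟ proj₁ y
    }

  open Subring R
  private
    module UF = UniqueFactorization domainR ufd
    module FR = Factorization domainR
    module PD = PolynomialDomain domainR
    module PF = PolynomialFactorization domainR UF.factorial
    module FP = Factorization PD.polynomials
    module PR = Polynomial ringR
    module PK = Polynomial K.commutativeRing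
    module Kt = CommutativeRing K[t]
    module FK = Factorization (polynomialDomain K.asField)
    module Den = Denominators K

  toK-⊕ : ∀ p q → toK[t] (p PR.⊕ q) ≡ toK[t] p PK.⊕ toK[t] q
  toK-⊕ []      q       = ≡.refl
  toK-⊕ (a ∷ p) []      = ≡.refl
  toK-⊕ (a ∷ p) (b ∷ q) = ≡.cong (_ ∷_) (toK-⊕ p q)

  toK-• : ∀ a p → toK[t] (a PR.• p) ≡ proj₁ a PK.• toK[t] p
  toK-• a []      = ≡.refl
  toK-• a (b ∷ p) = ≡.cong (_ ∷_) (toK-• a p)

  toK-⊛ : ∀ p q → toK[t] (p PR.⊛ q) ≡ toK[t] p PK.⊛ toK[t] q
  toK-⊛ []      q = ≡.refl
  toK-⊛ (a ∷ p) q = ≡.trans (toK-⊕ (a PR.• q) (PR.shift (p PR.⊛ q)))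
    (≡.cong₂ PK._⊕_ (toK-• a q) (≡.cong (K.0# ∷_) (toK-⊛ p q)))

  toK-⊖ : ∀ p → toK[t] (PR.⊖ p) ≡ PK.⊖ toK[t] p
  toK-⊖ []      = ≡.refl
  toK-⊖ (a ∷ p) = ≡.cong (_ ∷_) (toK-⊖ p)

  coeff-toK : ∀ p i → PK.coeff (toK[t] p) i ≡ proj₁ (PR.coeff p i)
  coeff-toK []      i       = ≡.refl
  coeff-toK (a ∷ p) zero    = ≡.refl
  coeff-toK (a ∷ p) (suc i) = coeff-toK p i

  toK-cong : ∀ {p q} → p PR.≋ q → toK[t] p PK.≋ toK[t] q
  toK-cong {p} {q} e = PK.mk≋ λ i → K.trans (K.reflexive (coeff-toK p i))
    (K.trans (PR.coeff≈ e i) (K.reflexive (≡.sym (coeff-toK q i))))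

  toK-injective : ∀ {p q} → toK[t] p PK.≋ toK[t] q → p PR.≋ q
  toK-injective {p} {q} e = PR.mk≋ λ i → K.trans (K.reflexive (≡.sym (coeff-toK p i)))
    (K.trans (PK.coeff≈ e i) (K.reflexive (coeff-toK q i)))

  toK-isRingHomomorphism : IsRingHomomorphism Rt.rawRing Kt.rawRing toK[t]
  toK-isRingHomomorphism = record
    { isSemiringHomomorphism = record
      { isNearSemiringHomomorphism = record
        { +-isMonoidHomomorphism = record
          { isMagmaHomomorphism = record
            { isRelHomomorphism = record { cong = toK-cong }
            ; homo = λ p q → Kt.reflexive (toK-⊕ p q)
            }
          ; ε-homo = PK.≋-refl
          }
        ; *-homo = λ p q → Kt.reflexive (toK-⊛ p q)
        }
      ; 1#-homo = PK.≋-refl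
      }
    ; -‿homo = λ p → Kt.reflexive (toK-⊖ p)
    }

  evaluation-isRingHomomorphism : IsRingHomomorphism Rt.rawRing (CommutativeRing.rawRing K.commutativeRing) (_⟦ t₀ ⟧)
  evaluation-isRingHomomorphism = Composition.isRingHomomorphism K.trans toK-isRingHomomorphism (PK.eval-isRingHomomorphism t₀)

  hasRoots : Discriminant.HasRoots K[t] (curve e₁ e₂ e₃) (toK[t] e₁) (toK[t] e₂) (toK[t] e₃)
  hasRoots = mapRoots R[t] K[t] toK-isRingHomomorphism (fromRoots-hasRoots R[t] e₁ e₂ e₃)

  hasRoots₀ : Discriminant.HasRoots K.commutativeRing (specialize t₀ (curve e₁ e₂ e₃)) (e₁ ⟦ t₀ ⟧) (e₂ ⟦ t₀ ⟧) (e₃ ⟦ t₀ ⟧)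
  hasRoots₀ = mapRoots K[t] K.commutativeRing (PK.eval-isRingHomomorphism t₀) hasRoots

  module Disc₀ = Discriminant K.commutativeRing
  e₁₂ : ¬ e₁ ⟦ t₀ ⟧ K.≈ e₂ ⟦ t₀ ⟧
  e₁₂ = Disc₀.distinct₁₂ hasRoots₀ elliptic₀
  e₂₃ : ¬ e₂ ⟦ t₀ ⟧ K.≈ e₃ ⟦ t₀ ⟧
  e₂₃ = Disc₀.distinct₁₂ (Disc₀.rotate hasRoots₀) elliptic₀
  e₁₃ : ¬ e₁ ⟦ t₀ ⟧ K.≈ e₃ ⟦ t₀ ⟧
  e₁₃ e = Disc₀.distinct₁₂ (Disc₀.rotate (Disc₀.rotate hasRoots₀)) elliptic₀ (K.sym e)

  evaluation-constant : ∀ {p a} → p PR.≋ PR.const a → p ⟦ t₀ ⟧ K.≈ proj₁ a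
  evaluation-constant {p} {a} p≋a = K.trans (PK.eval-cong t₀ (toK-cong {p} p≋a)) (PK.eval-const t₀ (proj₁ a))

  evaluation-unit-injective : ∀ u v → FP.IsUnit u → FP.IsUnit v → u ⟦ t₀ ⟧ K.≈ v ⟦ t₀ ⟧ → u PR.≋ v
  evaluation-unit-injective u v uu uv e = PR.≋-trans u≋ (PR.≋-trans (PD.const-cong
      (K.trans (K.sym (evaluation-constant {u} {PR.coeff u 0} u≋)) (K.trans e (evaluation-constant {v} {PR.coeff v 0} v≋)))) (PR.≋-sym v≋))
    where
    u≋ = PF.unit⇒const uu
    v≋ = PF.unit⇒const uv

  denominator : ∀ x → ∃ λ a → member a × ¬ a K.≈ K.0# × member (a K.* x)
  denominator x =
    let a , a-integral , a≉0 , ax-integral = Den.integralDenominator x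
    in a , integers⊆R a a-integral , a≉0 , integers⊆R (a K.* x) ax-integral

  commonDenominator : ∀ xs → ∃ λ a → member a × ¬ a K.≈ K.0# × All (λ x → member (a K.* x)) xs
  commonDenominator []       = K.1# , 1-closed , K.1≉0 , []
  commonDenominator (x ∷ xs) =
    let a , a∈R , a≉0 , ax∈R = denominator x
        b , b∈R , b≉0 , bxs∈R = commonDenominator xs
    in a K.* b , *-closed a∈R b∈R , Factorization.*-nonzero (asDomain K.asField) a≉0 b≉0 ,
       ≈-closed (K.trans (K.sym (K.*-assoc b a x)) (K.*-congʳ (K.*-comm b a))) (*-closed b∈R ax∈R) ∷
       All.map (λ {y} by∈R → ≈-closed (K.sym (K.*-assoc a b y)) (*-closed a∈R by∈R)) bxs∈R

  -- For a denominator `d` of δ, d²a = (dδ)² is an equation in R, where `square∣square` cancels d².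
  square-in-K⇒square-in-R : ∀ a → Divisibility.IsSquare K.commutativeRing (proj₁ a) → ¬ ¬ Divisibility.IsSquare ringR a
  square-in-K⇒square-in-R a (δ , a≈δδ) = do
    let d , d∈R , d≉0 , dδ∈R = denominator δ
    _ , f ← UF.factorial (d , d∈R) d≉0
    b , _ , a≈bb ← FR.square∣square {w = a} {y = d K.* δ , dδ∈R} f (K.trans (K.*-congˡ a≈δδ)
      (solve 2 (λ d δ → (d :* d) :* (δ :* δ) := (d :* δ) :* (d :* δ)) K.refl d δ))
    pure (b , a≈bb)
    where open IntegerSolver K.commutativeRing using (solve; _:=_; _:*_)

  -- A nonconstant `h` contradicts `nonsquare`. A constant is its own value at t₀, and its square
  -- root is found in R.
  squares : ∀ h → FP.SquareFree h →
     h FP.∣ (e₁ Rt.- e₂) Rt.* (e₁ Rt.- e₃) ⊎ h FP.∣ (e₂ Rt.- e₁) Rt.* (e₂ Rt.- e₃) ⊎ h FP.∣ (e₃ Rt.- e₁) Rt.* (e₃ Rt.- e₂) →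
     Divisibility.IsSquare K.commutativeRing (h ⟦ t₀ ⟧) → ¬ ¬ Divisibility.IsSquare R[t] h
  squares h sf h∣ (δ , h₀≈δδ) = ¬¬-excluded-middle {A = PR.IsConstant h} >>= λ
    { (no nonconstant) → ⊥-elim (nonsquare h nonconstant sf h∣ (δ , h₀≈δδ))
    ; (yes (a , h≋a)) → do
        b , a≈bb ← square-in-K⇒square-in-R a (δ , K.trans (K.sym (evaluation-constant {h} {a} h≋a)) h₀≈δδ)
        pure (PR.const b , PR.≋-trans h≋a (PR.≋-trans (PD.const-cong a≈bb) (PD.const-* b b)))
    }

  private module Desc = Descent PD.polynomials K.asField Den.torsionFree evaluation-isRingHomomorphism
                    PF.polynomials-factorial (PF.unitStable UF.unitStable) evaluation-unit-injective
                    e₁ e₂ e₃ (λ e → e₁₂ (PK.eval-cong t₀ (toK-cong e))) (λ e → e₁₃ (PK.eval-cong t₀ (toK-cong e)))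
                    (λ e → e₂₃ (PK.eval-cong t₀ (toK-cong e))) squares

  lift : ∀ {q} → All member q → ∃ λ p → toK[t] p ≡ q
  lift []           = [] , ≡.refl
  lift (a∈R ∷ q∈R) = let p , e = lift q∈R in (_ , a∈R) ∷ p , ≡.cong (_ ∷_) e

  All-• : ∀ {a q} → member a → All member q → All member (a PK.• q)
  All-• a∈R []           = []
  All-• a∈R (b∈R ∷ q∈R) = *-closed a∈R b∈R ∷ All-• a∈R q∈R

  module Cub = Cubics (polynomialDomain K.asField) K.asField Desc.double≉0 (PK.eval-isRingHomomorphism t₀)
  open Cub.Roots (toK[t] e₁) (toK[t] e₂) (toK[t] e₃) using (NoKernel)

  -- A common denominator `a` of all coefficients turns (X , Y , Z) into (a²X , a³Y , aZ), which is
  -- the same point with coordinates in R[t]; `no-state` applies to it.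
  noKernel : NoKernel
  noKernel X Y Z on X₀≉0 Z₀≈0 =
    let a , a∈R , a≉0 , axyz∈R = commonDenominator (X ++ (Y ++ Z))
        yz∈R = All.++⁻ʳ X axyz∈R
        X′ , X′≡ = lift (All-• a∈R (All.map⁺ (All.++⁻ˡ X axyz∈R)))
        Y′ , Y′≡ = lift (All-• a∈R (All-• a∈R (All.map⁺ (All.++⁻ˡ Y yz∈R))))
        Z′ , Z′≡ = lift (All.map⁺ (All.++⁻ʳ Y yz∈R))
    in decidable-stable (Z ≟ []) λ Z≉0 → cleared a a≉0 X′ Y′ Z′
         (Kt.trans (Kt.reflexive X′≡) (•≋ a (•≋ a Kt.refl)))
         (Kt.trans (Kt.reflexive Y′≡) (•≋ a (•≋ a (•≋ a Kt.refl))))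
         (Kt.trans (Kt.reflexive Z′≡) (•≋ a Kt.refl)) Z≉0
    where
    open IntegralDomain (polynomialDomain K.asField) using (_≟_)
    open IsRingHomomorphism toK-isRingHomomorphism
    open IntegerSolver K[t] using (solve; _:=_; _:*_; _:-_)
    •≋ : ∀ a {q r} → q PK.≋ r → a PK.• q PK.≋ PK.const a PK.⊛ r
    •≋ a {q} {r} e = PK.≋-trans (PK.•-cong K.refl e)
      (PK.≋-sym (PolynomialDomain.const-⊛ (asDomain K.asField) a r))
    evaluation-scaled : ∀ a q → PK.eval t₀ (PK.const a PK.⊛ q) K.≈ a K.* PK.eval t₀ q
    evaluation-scaled a q = K.trans (PK.eval-⊛ t₀ (PK.const a) q) (K.*-congʳ (PK.eval-const t₀ a))
    module _ (a : K.Carrier) (a≉0 : ¬ a K.≈ K.0#) (X′ Y′ Z′ : Rt.Carrier) where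
      private A = PK.const a
      cleared : toK[t] X′ PK.≋ A PK.⊛ (A PK.⊛ X) → toK[t] Y′ PK.≋ A PK.⊛ (A PK.⊛ (A PK.⊛ Y)) → toK[t] Z′ PK.≋ A PK.⊛ Z →
                ¬ ¬ Z PK.≋ []
      cleared X′≋ Y′≋ Z′≋ Z≉0 = PF.polynomials-factorial Z′ Z′≉0
        λ (n , f) → Desc.no-state n Z′ f Z′₀≈0 (Desc.mkState X′ Y′ on′ X′₀≉0)
        where
        A≉0 : ¬ A PK.≋ []
        A≉0 e = a≉0 (PK.coeff≈ e 0)
        Z′≉0 : ¬ Z′ PR.≋ []
        Z′≉0 e = FK.*-nonzero {A} {Z} A≉0 Z≉0 (PK.≋-trans (PK.≋-sym Z′≋) (toK-cong e))
        Z′₀≈0 : Z′ ⟦ t₀ ⟧ K.≈ K.0#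
        Z′₀≈0 = K.trans (PK.eval-cong t₀ Z′≋) (K.trans (evaluation-scaled a Z) (K.trans (K.*-congˡ Z₀≈0) (K.zeroʳ a)))
        X′₀≉0 : ¬ X′ ⟦ t₀ ⟧ K.≈ K.0#
        X′₀≉0 e = KD.*-nonzero a≉0 (KD.*-nonzero a≉0 X₀≉0) (K.trans (K.sym (K.trans (PK.eval-cong t₀ X′≋)
          (K.trans (evaluation-scaled a (A PK.⊛ X)) (K.*-congˡ (evaluation-scaled a X))))) e)
          where module KD = Factorization (asDomain K.asField)
        shifted : Rt.Carrier → Rt.Carrier
        shifted e = X′ Rt.- e Rt.* (Z′ Rt.* Z′)
        factor : ∀ e → toK[t] (shifted e) PK.≋ (A PK.⊛ A) PK.⊛ (X Kt.- toK[t] e PK.⊛ (Z PK.⊛ Z))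
        factor e = Kt.trans (+-homo X′ _) (Kt.trans (Kt.+-cong X′≋ (Kt.trans (-‿homo (e Rt.* (Z′ Rt.* Z′)))
            (Kt.-‿cong (Kt.trans (*-homo e _) (Kt.*-congˡ {toK[t] e} (Kt.trans (*-homo Z′ Z′) (Kt.*-cong Z′≋ Z′≋)))))))
          (solve 4 (λ a x e z → a :* (a :* x) :- e :* ((a :* z) :* (a :* z)) := (a :* a) :* (x :- e :* (z :* z)))
             Kt.refl A X (toK[t] e) Z))
        on′ : Y′ Rt.* Y′ PR.≋ shifted e₁ Rt.* (shifted e₂ Rt.* shifted e₃)
        on′ = toK-injective (Kt.trans (*-homo Y′ Y′) (Kt.trans (Kt.*-cong Y′≋ Y′≋)
          (Kt.trans (solve 2 (λ a y → (a :* (a :* (a :* y))) :* (a :* (a :* (a :* y)))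
                      := (a :* a :* (a :* a) :* (a :* a)) :* (y :* y)) Kt.refl A Y)
          (Kt.trans (Kt.*-congˡ {A PK.⊛ A PK.⊛ (A PK.⊛ A) PK.⊛ (A PK.⊛ A)} on)
          (Kt.trans (solve 4 (λ a b c d → (a :* a :* (a :* a) :* (a :* a)) :* (b :* (c :* d))
                      := ((a :* a) :* b) :* (((a :* a) :* c) :* ((a :* a) :* d))) Kt.refl A
                      (X Kt.- toK[t] e₁ PK.⊛ (Z PK.⊛ Z)) (X Kt.- toK[t] e₂ PK.⊛ (Z PK.⊛ Z)) (X Kt.- toK[t] e₃ PK.⊛ (Z PK.⊛ Z)))
          (Kt.sym (Kt.trans (*-homo (shifted e₁) (shifted e₂ Rt.* shifted e₃))
            (Kt.*-cong (factor e₁) (Kt.trans (*-homo (shifted e₂) (shifted e₃)) (Kt.*-cong (factor e₂) (factor e₃)))))))))))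

  private
    module Frac = Fractions (polynomialDomain K.asField)
    module FF = FunctionField K.asField
    E = curve e₁ e₂ e₃

  onCubic : ∀ {q} → OnCurve K⟨t⟩ (overK⟨t⟩ E) (FF.toK⟨t⟩ q) →
            Cub.Roots.OnCubic (toK[t] e₁) (toK[t] e₂) (toK[t] e₃) (proj₁ q) (proj₁ (proj₂ q)) (proj₂ (proj₂ q))
  onCubic {x , y , z} on = Discriminant.factored K[t] hasRoots {x} {y} {z} (Frac.fromDomain-injective
    (Frac.≃-trans (lhs-homo K[t] (Field.commutativeRing K⟨t⟩) Frac.fromDomain-isRingHomomorphism E x y z)
    (Frac.≃-trans on (Frac.≃-sym (rhs-homo K[t] (Field.commutativeRing K⟨t⟩) Frac.fromDomain-isRingHomomorphism E x y z)))))

  regular⇒nonZero : ∀ {q} → NonZero K.asField (FF.at t₀ q) → NonZero K⟨t⟩ (FF.toK⟨t⟩ q)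
  regular⇒nonZero {x , y , z} q₀≉0 (x≈0 , y≈0 , z≈0) = q₀≉0 (vanishes x x≈0 , vanishes y y≈0 , vanishes z z≈0)
    where
    vanishes : ∀ w → Frac.fromDomain w Frac.≃ Frac.fromDomain [] → PK.eval t₀ w K.≈ K.0#
    vanishes w e = PK.eval-cong t₀ (Frac.fromDomain-injective e)

  regular-injective : ∀ q r → OnCurve K⟨t⟩ (overK⟨t⟩ E) (FF.toK⟨t⟩ q) → OnCurve K⟨t⟩ (overK⟨t⟩ E) (FF.toK⟨t⟩ r) →
    NonZero K.asField (FF.at t₀ q) → NonZero K.asField (FF.at t₀ r) →
    _∼_ K.asField (FF.at t₀ q) (FF.at t₀ r) → _∼_ K⟨t⟩ (FF.toK⟨t⟩ q) (FF.toK⟨t⟩ r)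
  regular-injective q@(x , y , z) r@(x′ , y′ , z′) q∈E r∈E q₀≉0 r₀≉0 q₀∼r₀ =
    let xy , xz , yz = Cub.proportional (toK[t] e₁) (toK[t] e₂) (toK[t] e₃) noKernel e₁₂ e₁₃ e₂₃
          {x} {y} {z} {x′} {y′} {z′} (onCubic {q} q∈E) (onCubic {r} r∈E) q₀≉0 r₀≉0 q₀∼r₀
    in cross⇒∼ K⟨t⟩ (regular⇒nonZero {q} q₀≉0) (regular⇒nonZero {r} r₀≉0)
         (cross x y′ y x′ xy) (cross x z′ z x′ xz) (cross y z′ z y′ yz)
    where
    cross : ∀ a b a′ b′ → a PK.⊛ b PK.≋ a′ PK.⊛ b′ →
            (Frac.fromDomain a Frac.⊠ Frac.fromDomain b) Frac.≃ (Frac.fromDomain a′ Frac.⊠ Frac.fromDomain b′)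
    cross a b a′ b′ e = Frac.≃-trans (Frac.≃-sym (Frac.fromDomain-⊠ a b))
                          (Frac.≃-trans (Frac.fromDomain-cong e) (Frac.fromDomain-⊠ a′ b′))

  injective : ∀ u u≉0 v v≉0 →
    OnCurve K⟨t⟩ (overK⟨t⟩ (curve e₁ e₂ e₃)) u → OnCurve K⟨t⟩ (overK⟨t⟩ (curve e₁ e₂ e₃)) v →
    _∼_ K.asField (FF.at t₀ (proj₁ (FF.regularCoordinates t₀ u u≉0))) (FF.at t₀ (proj₁ (FF.regularCoordinates t₀ v v≉0))) →
    _∼_ K⟨t⟩ u v
  injective u u≉0 v v≉0 u∈E v∈E = lemma (FF.regularCoordinates t₀ u u≉0) (FF.regularCoordinates t₀ v v≉0)
    where
    -- Stated for arbitrary regular coordinates: only their properties matter, not how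
    -- `regularCoordinates` finds them.
    lemma : (∃q : ∃ λ q → _∼_ K⟨t⟩ (FF.toK⟨t⟩ q) u × NonZero K.asField (FF.at t₀ q)) →
            (∃r : ∃ λ r → _∼_ K⟨t⟩ (FF.toK⟨t⟩ r) v × NonZero K.asField (FF.at t₀ r)) →
            _∼_ K.asField (FF.at t₀ (proj₁ ∃q)) (FF.at t₀ (proj₁ ∃r)) → _∼_ K⟨t⟩ u v
    lemma (q , q∼u , q₀≉0) (r , r∼v , r₀≉0) q₀∼r₀ =
      ∼-trans K⟨t⟩ {u} {FF.toK⟨t⟩ q} {v} (∼-sym K⟨t⟩ {FF.toK⟨t⟩ q} {u} q∼u)
        (∼-trans K⟨t⟩ {FF.toK⟨t⟩ q} {FF.toK⟨t⟩ r} {v}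
          (regular-injective q r (∼-onCurve K⟨t⟩ (overK⟨t⟩ E) {FF.toK⟨t⟩ q} {u} q∼u u∈E)
            (∼-onCurve K⟨t⟩ (overK⟨t⟩ E) {FF.toK⟨t⟩ r} {v} r∼v v∈E) q₀≉0 r₀≉0 q₀∼r₀) r∼v)

theorem3p2 : ∀ {c ℓ p} (K : NumberField c ℓ) (R : Subring (NumberField.commutativeRing K) p) →
  let open Setting K R
      open CommutativeRing R[t]
      open Divisibility R[t]
  in
  ringOfIntegers⊆R →
  Divisibility.IsUFD ringR →
  FinitelyGenerated (AbelianGroup.group (unitGroup ringR)) →
  (e₁ e₂ e₃ : R[t].Carrier) →
  let E = curve e₁ e₂ e₃ in
  IsElliptic K⟨t⟩ (overK⟨t⟩ E) →
  Nonconstant (overK⟨t⟩ E) →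
  (t₀ : K.Carrier) →
  IsElliptic K.asField (specialize t₀ E) →
  (∀ h → ¬ Polynomial.IsConstant ringR h → SquareFree h →
     h ∣ (e₁ - e₂) * (e₁ - e₃) ⊎ h ∣ (e₂ - e₁) * (e₂ - e₃) ⊎ h ∣ (e₃ - e₁) * (e₃ - e₂) →
     ¬ Divisibility.IsSquare K.commutativeRing (h ⟦ t₀ ⟧)) →
  Injective (_≈ᴾ_ K⟨t⟩) (_≈ᴾ_ K.asField) (σ E t₀)
theorem3p2 K R integers⊆R ufd _ e₁ e₂ e₃ _ _ t₀ elliptic₀ nonsquare {mkPoint u u≉0 u∈E} {mkPoint v v≉0 v∈E} σu∼σv =
  Specialization.injective K R integers⊆R ufd e₁ e₂ e₃ t₀ elliptic₀ nonsquare u u≉0 v v≉0 u∈E v∈E σu∼σv
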